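{- Let $k \ge 1$ be an integer, $r \ge 2$ a prime, and $n \ge rk$ an integer. Let $\mathcal{P} = \{P_1, \dots, P_\ell\}$ be a partition of $[n]$ with $|P_i| \le r-1$ for all $i$. Let $t\ge1$ be an integer with $t \le r(k-3)+2$. Then $$\chi(\mathrm{KG}^r(n,k;\mathcal{P})_{t\text{ -wide}}) = \left\lceil \frac{n-r(k-1)}{r-1} \right\rceil.$$
   Context: For a hypergraph $H$, an $m$-coloring is a map from the vertices to $[m]$ such that no hyperedge is monochromatic; $\chi(H)$ is the least such $m$. A set $\sigma\subseteq[n]$ is called $t$-wide if it is not contained in any of the sets $\{i,i+1,\dots,i+t-1\}$ for $i\in[n-t+1]$. For a partition $\mathcal{P}=\{P_1,\dots,P_\ell\}$ of $[n]$, $\mathrm{KG}^r(n,k;\mathcal{P})_{t\text{ -wide}}$ is the $r$-uniform hypergraph whose vertices are the $k$-element subsets $\sigma\subseteq[n]$ that are $t$-wide and satisfy $|\sigma\cap P_i|\le1$ for all $i$, and whose hyperedges are the collections of $r$ such sets that are pairwise disjoint. -}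

module Defs where

open import Data.Nat using (ℕ; zero; suc; _+_; _*_; _∸_; _≤_; _<_; NonZero)
open import Data.Nat.DivMod using (_/_)
open import Data.Fin using (Fin; toℕ)
open import Data.Fin.Subset using (Subset; _∈_; _∩_; ∣_∣; ⊥; _⊆_)
open import Data.Vec using (tabulate)
open import Data.Bool using (Bool; true; false)
open import Data.Product using (_×_; ∃)
open import Relation.Binary.PropositionalEquality using (_≡_; _≢_)
open import Relation.Nullary using (¬_; does)
open import Data.Fin using (_≟_)

-- Ground set [n] is represented by Fin n (0-indexed: element j ∈ Fin n stands for j+1).

window : (n i t : ℕ) → Subset n
window n i t = tabulate (λ j → inWin (toℕ j))
  where
  open import Data.Nat using (_≤ᵇ_; _<ᵇ_)
  open import Data.Bool using (_∧_)
  inWin : ℕ → Bool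
  inWin x = (i ≤ᵇ x) ∧ (x <ᵇ i + t)

TWide : (n t : ℕ) → Subset n → Set
TWide n t σ = ∀ (i : ℕ) → i + t ≤ n → ¬ (σ ⊆ window n i t)

-- A partition P = {P_1,...,P_ℓ} of [n] is given by its block-assignment map
-- p : Fin n → Fin ℓ (element x lies in block P_{p x}).
block : ∀ {n ℓ} → (Fin n → Fin ℓ) → Fin ℓ → Subset n
block p b = tabulate (λ x → does (p x ≟ b))

IsVertex : (n k t : ℕ) {ℓ : ℕ} → (Fin n → Fin ℓ) → Subset n → Set
IsVertex n k t {ℓ} p σ =
  (∣ σ ∣ ≡ k) × TWide n t σ × (∀ (b : Fin ℓ) → ∣ σ ∩ block p b ∣ ≤ 1)

-- Hyperedges: r vertices, pairwise disjoint (hence pairwise distinct, as k ≥ 1),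
-- given as an indexed family e : Fin r → Subset n.
IsHyperedge : (n k t : ℕ) {ℓ : ℕ} → (Fin n → Fin ℓ) → (r : ℕ) → (Fin r → Subset n) → Set
IsHyperedge n k t p r e =
  (∀ j → IsVertex n k t p (e j)) × (∀ j j' → j ≢ j' → e j ∩ e j' ≡ ⊥)

-- An m-colouring: a map from (vertices, i.e. subsets satisfying IsVertex) to Fin m
-- such that no hyperedge is monochromatic.
-- (The colour map is defined on all of Subset n; values on non-vertices are irrelevant.)
IsColouring : (n k t : ℕ) {ℓ : ℕ} → (Fin n → Fin ℓ) → (r m : ℕ) → (Subset n → Fin m) → Set
IsColouring n k t p r m c =
  ∀ (e : Fin r → Subset n) → IsHyperedge n k t p r e →
    ¬ (∃ λ (a : Fin m) → ∀ j → c (e j) ≡ a)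

Colourable : (n k t : ℕ) {ℓ : ℕ} → (Fin n → Fin ℓ) → (r m : ℕ) → Set
Colourable n k t p r m = ∃ λ (c : Subset n → Fin m) → IsColouring n k t p r m c

ChromaticNumberIs : (n k t : ℕ) {ℓ : ℕ} → (Fin n → Fin ℓ) → (r m : ℕ) → Set
ChromaticNumberIs n k t p r m =
  Colourable n k t p r m × (∀ m' → m' < m → ¬ Colourable n k t p r m')

-- Ceiling division ⌈a / b⌉ for b ≥ 1 (the b = 0 case is a junk value, never used
-- in the theorem since r ≥ 2 there).
⌈_/_⌉ : ℕ → ℕ → ℕ
⌈ a / zero ⌉ = 0
⌈ a / suc b ⌉ = (a + b) / suc b

{-# OPTIONS --safe #-}
-- Upper bound: colour a set by the interval of length r − 1 that contains its
-- minimum, cutting off at the last colour.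
--
-- Lower bound: suppose m colours suffice although r(k − 1) + m(r − 1) < n.  Pad
-- each block with dummies to exactly r − 1 columns and add one further dummy
-- column.  A face is a labelling of some columns by ℤ/r that is injective on
-- every block (a simplex of a join of chessboard complexes); it splits the
-- labelled elements of [n] into parts X_j.  Its value is the number of dummies
-- plus min(r(k − 1), |S| + |T| + |M|) plus Σ_a |U_a|, where S is the set of
-- labels in use, T the set of labels recurring after every label has occurred,
-- M the set of elements having every label both before and after them, and U_a
-- the set of j such that X_j contains a vertex of colour a.  If
-- |S| + |T| + |M| > r(k − 1), then |M| > r(k − 3), and the most frequent label in
-- M, together with one earlier and one later element, yields a t-wide vertex.
-- Hence faces carry an equivariant sign in ℤ/r which does not change when a face
-- grows and its value stays the same.  The value is positive and smaller than the
-- number of columns, so every complete flag of faces contains two consecutive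
-- faces of equal sign.
--
-- This is impossible for every equivariant sign.  Let ε be the signature of a
-- sequence of r labels, a cocycle, and ω its ℓ-fold cup power.  Sum ω of the
-- signs over all complete flags, each top face weighted by the fundamental cycle
-- of the join of chessboard complexes.  By the prism homotopy and Stokes this sum
-- does not depend on the sign modulo r, and if the sign of a face is the label of
-- its first column, it equals ((r − 1)!)^ℓ.
module Submission where

-- The weighted top faces form a cycle on the columns of the blocks, and the extra dummy column,
-- labelled 0 throughout, is the apex of a cone over it. On the cone the prism homotopy leaves only
-- a term over the base. This term is invariant under rotation, which permutes the labels of a
-- column in one orbit of length r; so it is a multiple of r, which ((r - 1)!)^ℓ is not since r is
-- prime. The argument needs a cycle but no connectivity of the complex. Blocks are padded to r - 1
-- columns because then one label is missing on each of them, and exchanging it with the label of a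
-- deleted column cancels the coefficients.
--
-- The sign asks in turn the first dummy, the sets U_a, S and T. A nonempty proper subset of ℤ/r has
-- an equivariant barycentre as r is prime, and a colouring keeps each U_a proper. If all these sets
-- are empty or full, the sign is the label that was the last to occur for the first time. T and M
-- exist for this case: when in a larger face all labels occur before that place, T or M grows.

-- Cochains on lists: coboundary, flags, prism homotopy and cup product.

module Cochains where

  open import Data.Integer using (ℤ; 0ℤ; 1ℤ; _+_; _*_; -_; _-_)
  open import Data.Integer.Properties using (+-identityʳ; *-zeroʳ)
  open import Data.Integer.Tactic.RingSolver using (solve-∀)
  open import Data.List using (List; []; _∷_; _++_; map; length)
  open import Data.List.Properties using (length-map)
  open import Data.List.Relation.Unary.All using (All; []; _∷_)
  open import Data.Nat as ℕ using (ℕ; zero; suc; _<_; s≤s; z≤n)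
  open import Data.Product using (_×_; _,_)
  open import Relation.Binary.PropositionalEquality
  open ≡-Reasoning

  private variable
    A B : Set

  infix 4 _⋖_
  data _⋖_ {A : Set} : List A → List A → Set where
    here  : ∀ {x xs} → xs ⋖ x ∷ xs
    there : ∀ {x xs ys} → ys ⋖ xs → x ∷ ys ⋖ x ∷ xs

  ⋖-length : ∀ {ρ τ : List A} → ρ ⋖ τ → suc (length ρ) ≡ length τ
  ⋖-length here      = refl
  ⋖-length (there d) = cong suc (⋖-length d)

  -- On faces D is dual to the simplicial boundary, on sequences of signs it is the coboundary.
  D : (List A → ℤ) → List A → ℤ
  D f []       = 0ℤ
  D f (x ∷ xs) = f xs - D (λ ys → f (x ∷ ys)) xs

  D-cong : ∀ {f g : List A → ℤ} xs → (∀ {ys} → ys ⋖ xs → f ys ≡ g ys) → D f xs ≡ D g xs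
  D-cong []       _  = refl
  D-cong (x ∷ xs) eq = cong₂ _-_ (eq here) (D-cong xs (λ d → eq (there d)))

  D-zero : ∀ {f : List A → ℤ} xs → (∀ {ys} → ys ⋖ xs → f ys ≡ 0ℤ) → D f xs ≡ 0ℤ
  D-zero []       _  = refl
  D-zero (x ∷ xs) eq = cong₂ _-_ (eq here) (D-zero xs (λ d → eq (there d)))

  D-sub : ∀ (f g : List A → ℤ) xs → D (λ ys → f ys - g ys) xs ≡ D f xs - D g xs
  D-sub f g []       = refl
  D-sub f g (x ∷ xs) = begin
    f xs - g xs - D (λ ys → f (x ∷ ys) - g (x ∷ ys)) xs
      ≡⟨ cong (λ z → f xs - g xs - z) (D-sub _ _ xs) ⟩
    f xs - g xs - (D _ xs - D _ xs)
      ≡⟨ rearrange (f xs) (g xs) _ _ ⟩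
    f xs - D _ xs - (g xs - D _ xs) ∎
    where
    rearrange : ∀ a b c d → a - b - (c - d) ≡ a - c - (b - d)
    rearrange = solve-∀

  D-scale : ∀ c (f : List A → ℤ) xs → D (λ ys → c * f ys) xs ≡ c * D f xs
  D-scale c f []       = sym (*-zeroʳ c)
  D-scale c f (x ∷ xs) = trans (cong (λ z → c * f xs - z) (D-scale c _ xs)) (factor c (f xs) _)
    where
    factor : ∀ c a b → c * a - c * b ≡ c * (a - b)
    factor = solve-∀

  D-map : ∀ (h : A → B) (f : List B → ℤ) xs → D (λ ys → f (map h ys)) xs ≡ D f (map h xs)
  D-map h f []       = refl
  D-map h f (x ∷ xs) = cong (λ z → f (map h xs) - z) (D-map h (λ ys → f (h x ∷ ys)) xs)

  D∘D : ∀ (f : List A → ℤ) xs → D (D f) xs ≡ 0ℤ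
  D∘D f []       = refl
  D∘D f (x ∷ xs) = begin
    D f xs - D (λ ys → f ys - D fₓ ys) xs ≡⟨ cong (λ z → D f xs - z) (D-sub f (D fₓ) xs) ⟩
    D f xs - (D f xs - D (D fₓ) xs)       ≡⟨ cancel (D f xs) _ ⟩
    D (D fₓ) xs                           ≡⟨ D∘D fₓ xs ⟩
    0ℤ                                    ∎
    where
    fₓ = λ ys → f (x ∷ ys)
    cancel : ∀ a b → a - (a - b) ≡ b
    cancel = solve-∀

  sgn : ℕ → ℤ
  sgn zero    = 1ℤ
  sgn (suc p) = - sgn p

  -- A column of `v` is deleted only after passing all of `u`, whence the sign. Through this the
  -- boundary of a join splits block by block.
  D-++ : ∀ (F : List A → ℤ) u v →
         D F (u ++ v) ≡ D (λ u′ → F (u′ ++ v)) u + sgn (length u) * D (λ v′ → F (u ++ v′)) v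
  D-++ F []      v = identity (D F v)
    where
    identity : ∀ a → a ≡ 0ℤ + 1ℤ * a
    identity = solve-∀
  D-++ F (x ∷ u) v = trans (cong (λ z → F (u ++ v) - z) (D-++ (λ M → F (x ∷ M)) u v)) (rearrange (F (u ++ v)) _ (sgn (length u)) _)
    where
    rearrange : ∀ a b s c → a - (b + s * c) ≡ a - b + - s * c
    rearrange = solve-∀

  -- The value of f on the barycentric subdivision of τ: the signed sum of f
  -- over the flags τ ⋗ τ₁ ⋗ τ₂ ⋗ ⋯ of n faces, listed from the top down.
  S : ℕ → (List (List A) → ℤ) → List A → ℤ
  S zero    f τ = f []
  S (suc n) f τ = D (λ τ′ → S n (λ L → f (τ ∷ L)) τ′) τ

  data Flag {A : Set} : ℕ → List A → List (List A) → Set where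
    []  : ∀ {τ} → Flag zero τ []
    _∷_ : ∀ {n τ τ′ L} → τ′ ⋖ τ → Flag n τ′ L → Flag (suc n) τ (τ ∷ L)

  flag-length : ∀ {n τ} {L : List (List A)} → Flag n τ L → length L ≡ n
  flag-length []      = refl
  flag-length (_ ∷ F) = cong suc (flag-length F)

  flag-nonempty : ∀ {n τ} {L : List (List A)} → Flag n τ L → All (λ ρ → 0 < length ρ) L
  flag-nonempty []            = []
  flag-nonempty (here ∷ F)    = s≤s z≤n ∷ flag-nonempty F
  flag-nonempty (there _ ∷ F) = s≤s z≤n ∷ flag-nonempty F

  S-cong : ∀ n {f g : List (List A) → ℤ} τ → (∀ {L} → Flag n τ L → f L ≡ g L) → S n f τ ≡ S n g τ
  S-cong zero    τ eq = eq []
  S-cong (suc n) τ eq = D-cong τ (λ d → S-cong n _ (λ F → eq (d ∷ F)))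

  S-zero : ∀ n {f : List (List A) → ℤ} τ → (∀ {L} → Flag n τ L → f L ≡ 0ℤ) → S n f τ ≡ 0ℤ
  S-zero zero    τ eq = eq []
  S-zero (suc n) τ eq = D-zero τ (λ d → S-zero n _ (λ F → eq (d ∷ F)))

  S-sub : ∀ n (f g : List (List A) → ℤ) τ → S n (λ L → f L - g L) τ ≡ S n f τ - S n g τ
  S-sub zero    f g τ = refl
  S-sub (suc n) f g τ = trans (D-cong τ (λ {τ′} _ → S-sub n _ _ τ′)) (D-sub _ _ τ)

  S-scale : ∀ n c (f : List (List A) → ℤ) τ → S n (λ L → c * f L) τ ≡ c * S n f τ
  S-scale zero    c f τ = refl
  S-scale (suc n) c f τ = trans (D-cong τ (λ {τ′} _ → S-scale n c _ τ′)) (D-scale c _ τ)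

  S-map : ∀ n (h : A → B) (f : List (List B) → ℤ) τ →
          S n (λ L → f (map (map h) L)) τ ≡ S n f (map h τ)
  S-map zero    h f τ = refl
  S-map (suc n) h f τ = trans (D-cong τ (λ {τ′} _ → S-map n h _ τ′)) (D-map h _ τ)

  -- A flag entry below the top can be replaced in exactly two ways, with opposite signs; this is
  -- `D∘D`. Only the deletion of the top face `τ` survives, and it leaves the flags of the facets of
  -- `τ`.
  S-stokes : ∀ n (f : List (List A) → ℤ) τ → S (suc n) (D f) τ ≡ D (S n f) τ
  S-stokes n f τ = begin
    D (λ τ′ → S n (λ L → f L - D fτ L) τ′) τ     ≡⟨ D-cong τ (λ {τ′} _ → S-sub n f (D fτ) τ′) ⟩
    D (λ τ′ → S n f τ′ - S n (D fτ) τ′) τ        ≡⟨ D-sub _ _ τ ⟩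
    D (S n f) τ - D (S n (D fτ)) τ               ≡⟨ cong (λ z → D (S n f) τ - z) (vanish n) ⟩
    D (S n f) τ - 0ℤ                             ≡⟨ +-identityʳ _ ⟩
    D (S n f) τ                                  ∎
    where
    fτ = λ L → f (τ ∷ L)
    vanish : ∀ m → D (S m (D fτ)) τ ≡ 0ℤ
    vanish zero    = D-zero τ (λ _ → refl)
    vanish (suc m) = trans (D-cong τ (λ {τ′} _ → S-stokes m fτ τ′)) (D∘D _ τ)

  module Prism (s t : A → B) where

    H : (List B → ℤ) → List A → ℤ
    H ω []      = 0ℤ
    H ω (a ∷ L) = ω (s a ∷ t a ∷ map t L) - H (λ M → ω (s a ∷ M)) L

    H-sub : ∀ (f g : List B → ℤ) L → H (λ M → f M - g M) L ≡ H f L - H g L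
    H-sub f g []      = refl
    H-sub f g (a ∷ L) = trans (cong (λ z → f M₀ - g M₀ - z) (H-sub fs gs L)) (rearrange (f M₀) (g M₀) (H fs L) (H gs L))
      where
      M₀ = s a ∷ t a ∷ map t L
      fs = λ M → f (s a ∷ M)
      gs = λ M → g (s a ∷ M)
      rearrange : ∀ a b c d → a - b - (c - d) ≡ a - c - (b - d)
      rearrange = solve-∀

    H-zero : ∀ {f : List B → ℤ} L → (∀ M → length M ≡ suc (length L) → f M ≡ 0ℤ) → H f L ≡ 0ℤ
    H-zero []      eq = refl
    H-zero (a ∷ L) eq = cong₂ _-_ (eq _ (cong (λ n → suc (suc n)) (length-map t L)))
                                  (H-zero L (λ M p → eq _ (cong suc p)))

    H-cong : ∀ {f g : List B → ℤ} L → (∀ M → length M ≡ suc (length L) → f M ≡ g M) → H f L ≡ H g L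
    H-cong         []      eq = refl
    H-cong {f} {g} (a ∷ L) eq = cong₂ _-_ (eq _ (cong (λ n → suc (suc n)) (length-map t L)))
                                          (H-cong {λ M → f (s a ∷ M)} {λ M → g (s a ∷ M)} L (λ M p → eq _ (cong suc p)))

    H-scale : ∀ c (f : List B → ℤ) L → H (λ M → c * f M) L ≡ c * H f L
    H-scale c f []      = sym (*-zeroʳ c)
    H-scale c f (a ∷ L) = trans (cong (λ z → c * f M₀ - z) (H-scale c (λ M → f (s a ∷ M)) L)) (factor c (f M₀) _)
      where
      M₀ = s a ∷ t a ∷ map t L
      factor : ∀ c a b → c * a - c * b ≡ c * (a - b)
      factor = solve-∀

    -- Equivariance is demanded only at the entries of `L`, because the signs are equivariant only
    -- on nonempty faces.
    H-map : ∀ (g : A → A) (h : B → B) (ω : List B → ℤ) {L} →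
            All (λ a → s (g a) ≡ h (s a) × t (g a) ≡ h (t a)) L → H ω (map g L) ≡ H (λ M → ω (map h M)) L
    H-map g h ω [] = refl
    H-map g h ω {a ∷ L} ((sa , ta) ∷ eqs) = cong₂ _-_
      (cong₂ (λ b M → ω (b ∷ M)) sa (cong₂ _∷_ ta (map-t eqs)))
      (trans (cong (λ b → H (λ M → ω (b ∷ M)) (map g L)) sa) (H-map g h (λ M → ω (h (s a) ∷ M)) eqs))
      where
      map-t : ∀ {L} → All (λ a → s (g a) ≡ h (s a) × t (g a) ≡ h (t a)) L → map t (map g L) ≡ map h (map t L)
      map-t []               = refl
      map-t ((_ , ta) ∷ eqs) = cong₂ _∷_ ta (map-t eqs)

    homotopy : ∀ (ω : List B → ℤ) L → D (H ω) L + H (D ω) L ≡ ω (map t L) - ω (map s L)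
    homotopy ω []      = sym (cancel (ω []))
      where
      cancel : ∀ a → a - a ≡ 0ℤ
      cancel = solve-∀
    homotopy ω (a ∷ L) = begin
      H ω L - D (λ L′ → ωst (map t L′) - H ωs L′) L + (ω (t a ∷ tL) - (ωs tL - D ωst tL) - H (λ M → ω M - D ωs M) L)
        ≡⟨ cong₂ (λ u v → H ω L - u + (ω (t a ∷ tL) - (ωs tL - D ωst tL) - v))
             (trans (D-sub _ _ L) (cong (_- D (H ωs) L) (D-map t ωst L))) (H-sub ω (D ωs) L) ⟩
      H ω L - (D ωst tL - D (H ωs) L) + (ω (t a ∷ tL) - (ωs tL - D ωst tL) - (H ω L - H (D ωs) L))
        ≡⟨ rearrange (H ω L) (D ωst tL) (D (H ωs) L) (ω (t a ∷ tL)) (ωs tL) (H (D ωs) L) ⟩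
      ω (t a ∷ tL) - ωs tL + (D (H ωs) L + H (D ωs) L)
        ≡⟨ cong (λ z → ω (t a ∷ tL) - ωs tL + z) (homotopy ωs L) ⟩
      ω (t a ∷ tL) - ωs tL + (ωs tL - ωs (map s L))
        ≡⟨ telescope (ω (t a ∷ tL)) (ωs tL) _ ⟩
      ω (t a ∷ tL) - ωs (map s L) ∎
      where
      tL  = map t L
      ωs  = λ M → ω (s a ∷ M)
      ωst = λ M → ω (s a ∷ t a ∷ M)
      rearrange : ∀ h d e o u k → h - (d - e) + (o - (u - d) - (h - k)) ≡ o - u + (e + k)
      rearrange = solve-∀
      telescope : ∀ a b c → a - b + (b - c) ≡ a - c
      telescope = solve-∀

  -- Vanishing on degenerate simplices. Through it a flag contributes nothing as soon as two
  -- consecutive faces have the same sign.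
  Normalised : (List B → ℤ) → Set
  Normalised {B} f = ∀ pre (a : B) post → f (pre ++ a ∷ a ∷ post) ≡ 0ℤ

  module _ (lab : A → B) (d : B) where

    headLabel : List A → B
    headLabel []      = d
    headLabel (x ∷ _) = lab x

    -- Deleting a column other than the first keeps the head label, so the flag is degenerate. Only
    -- the flag that always deletes the first column survives.
    S-headLabel : ∀ n {g : List B → ℤ} → Normalised g → ∀ τ → length τ ≡ n →
                  S n (λ L → g (map headLabel L)) τ ≡ g (map lab τ)
    S-headLabel zero    norm []      refl = refl
    S-headLabel (suc n) {g} norm (x ∷ τ) refl = begin
      S n f τ - D (λ ys → S n f (x ∷ ys)) τ ≡⟨ cong (λ z → S n f τ - z) (vanish n τ refl) ⟩
      S n f τ - 0ℤ                          ≡⟨ +-identityʳ _ ⟩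
      S n f τ                               ≡⟨ S-headLabel n {λ M → g (lab x ∷ M)} (λ pre → norm (lab x ∷ pre)) τ refl ⟩
      g (lab x ∷ map lab τ)                 ∎
      where
      f = λ L → g (lab x ∷ map headLabel L)
      vanish : ∀ m ρ → length ρ ≡ m → D (λ ys → S m f (x ∷ ys)) ρ ≡ 0ℤ
      vanish _       []      _ = refl
      vanish (suc m) (y ∷ ρ) _ = D-zero {f = λ ys → S (suc m) f (x ∷ ys)} (y ∷ ρ)
        (λ {ys} _ → S-zero (suc m) {f} (x ∷ ys) λ { (_∷_ {L = L} _ _) → norm [] (lab x) (map headLabel L) })

  -- The Alexander-Whitney product. `p` is the degree of `α`, which reads the first `p + 1` entries
  -- and shares the last of them with `β`.
  cup : ℕ → (List A → ℤ) → (List A → ℤ) → List A → ℤ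
  cup _       α β []      = 0ℤ
  cup zero    α β (x ∷ L) = α (x ∷ []) * β (x ∷ L)
  cup (suc p) α β (x ∷ L) = cup p (λ M → α (x ∷ M)) β L

  cup-sub : ∀ p (α α′ β : List A → ℤ) L → cup p (λ M → α M - α′ M) β L ≡ cup p α β L - cup p α′ β L
  cup-sub zero    α α′ β []      = refl
  cup-sub (suc p) α α′ β []      = refl
  cup-sub zero    α α′ β (x ∷ L) = distrib (α (x ∷ [])) (α′ (x ∷ [])) (β (x ∷ L))
    where
    distrib : ∀ a b c → (a - b) * c ≡ a * c - b * c
    distrib = solve-∀
  cup-sub (suc p) α α′ β (x ∷ L) = cup-sub p _ _ β L

  -- The two terms in which the shared entry is deleted cancel. The length bound keeps `β` from
  -- being evaluated at the empty list.
  cup-leibniz : ∀ p (α β : List A → ℤ) L → suc p < length L →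
    D (cup p α β) L ≡ cup (suc p) (D α) β L + sgn p * cup p α (D β) L
  cup-leibniz zero    α β (x ∷ []) (s≤s ())
  cup-leibniz zero    α β (x ∷ y ∷ L) _ = begin
    α (y ∷ []) * β (y ∷ L) - D (λ M → α (x ∷ []) * β (x ∷ M)) (y ∷ L)
      ≡⟨ cong (λ z → α (y ∷ []) * β (y ∷ L) - z) (D-scale (α (x ∷ [])) (λ M → β (x ∷ M)) (y ∷ L)) ⟩
    α (y ∷ []) * β (y ∷ L) - α (x ∷ []) * D (λ M → β (x ∷ M)) (y ∷ L)
      ≡⟨ rearrange (α (y ∷ [])) (β (y ∷ L)) (α (x ∷ [])) _ ⟩
    (α (y ∷ []) - (α (x ∷ []) - 0ℤ)) * β (y ∷ L) + 1ℤ * (α (x ∷ []) * (β (y ∷ L) - D (λ M → β (x ∷ M)) (y ∷ L))) ∎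
    where
    rearrange : ∀ a b c d → a * b - c * d ≡ (a - (c - 0ℤ)) * b + 1ℤ * (c * (b - d))
    rearrange = solve-∀
  cup-leibniz (suc p) α β (x ∷ L) (s≤s lt) = begin
    cup (suc p) α β L - D (cup p αx β) L
      ≡⟨ cong (λ z → cup (suc p) α β L - z) (cup-leibniz p αx β L lt) ⟩
    cup (suc p) α β L - (cup (suc p) (D αx) β L + sgn p * cup p αx (D β) L)
      ≡⟨ rearrange (cup (suc p) α β L) _ (sgn p) _ ⟩
    (cup (suc p) α β L - cup (suc p) (D αx) β L) + - sgn p * cup p αx (D β) L
      ≡⟨ cong (λ z → z + - sgn p * cup p αx (D β) L) (cup-sub (suc p) α (D αx) β L) ⟨
    cup (suc p) (λ M → α M - D αx M) β L + - sgn p * cup p αx (D β) L ∎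
    where
    αx = λ M → α (x ∷ M)
    rearrange : ∀ a b s c → a - (b + s * c) ≡ (a - b) + - s * c
    rearrange = solve-∀

  cup-cong : ∀ p {α α′ β β′ : List A → ℤ} → (∀ M → length M ≡ suc p → α M ≡ α′ M) →
             ∀ L → (∀ M → p ℕ.+ length M ≡ length L → β M ≡ β′ M) → cup p α β L ≡ cup p α′ β′ L
  cup-cong zero    eq []      eq′ = refl
  cup-cong (suc p) eq []      eq′ = refl
  cup-cong zero    eq (x ∷ L) eq′ = cong₂ _*_ (eq _ refl) (eq′ _ refl)
  cup-cong (suc p) eq (x ∷ L) eq′ = cup-cong p (λ M q → eq (x ∷ M) (cong suc q)) L (λ M q → eq′ M (cong suc q))

  cup-zeroˡ : ∀ p {α : List A → ℤ} (β : List A → ℤ) → (∀ M → length M ≡ suc p → α M ≡ 0ℤ) → ∀ L → cup p α β L ≡ 0ℤ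
  cup-zeroˡ zero    β eq []      = refl
  cup-zeroˡ (suc p) β eq []      = refl
  cup-zeroˡ zero    β eq (x ∷ L) = cong (_* β (x ∷ L)) (eq _ refl)
  cup-zeroˡ (suc p) β eq (x ∷ L) = cup-zeroˡ p β (λ M q → eq (x ∷ M) (cong suc q)) L

  cup-zeroʳ : ∀ p (α : List A → ℤ) {β : List A → ℤ} L → (∀ M → p ℕ.+ length M ≡ length L → β M ≡ 0ℤ) → cup p α β L ≡ 0ℤ
  cup-zeroʳ zero    α []      eq = refl
  cup-zeroʳ (suc p) α []      eq = refl
  cup-zeroʳ zero    α (x ∷ L) eq = trans (cong (α _ *_) (eq _ refl)) (*-zeroʳ (α _))
  cup-zeroʳ (suc p) α (x ∷ L) eq = cup-zeroʳ p _ L (λ M q → eq M (cong suc q))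

  cup-cocycle : ∀ p {α β : List A → ℤ} L → suc p < length L →
                (∀ M → length M ≡ suc (suc p) → D α M ≡ 0ℤ) →
                (∀ M → p ℕ.+ length M ≡ length L → D β M ≡ 0ℤ) → D (cup p α β) L ≡ 0ℤ
  cup-cocycle p {α} {β} L lt dα dβ = begin
    D (cup p α β) L                                     ≡⟨ cup-leibniz p α β L lt ⟩
    cup (suc p) (D α) β L + sgn p * cup p α (D β) L     ≡⟨ cong₂ (λ u v → u + sgn p * v) (cup-zeroˡ (suc p) β dα L) (cup-zeroʳ p α L dβ) ⟩
    0ℤ + sgn p * 0ℤ                                     ≡⟨ cong (0ℤ +_) (*-zeroʳ (sgn p)) ⟩
    0ℤ                                                  ∎

  cup-map : ∀ p (h : A → B) (α β : List B → ℤ) L →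
            cup p α β (map h L) ≡ cup p (λ M → α (map h M)) (λ M → β (map h M)) L
  cup-map zero    h α β []      = refl
  cup-map (suc p) h α β []      = refl
  cup-map zero    h α β (x ∷ L) = refl
  cup-map (suc p) h α β (x ∷ L) = cup-map p h _ β L

  cup-scale : ∀ p c c′ (α β : List A → ℤ) L → cup p (λ M → c * α M) (λ M → c′ * β M) L ≡ c * c′ * cup p α β L
  cup-scale zero    c c′ α β []      = sym (*-zeroʳ (c * c′))
  cup-scale (suc p) c c′ α β []      = sym (*-zeroʳ (c * c′))
  cup-scale zero    c c′ α β (x ∷ L) = rearrange c c′ _ _
    where
    rearrange : ∀ c c′ a b → c * a * (c′ * b) ≡ c * c′ * (a * b)
    rearrange = solve-∀
  cup-scale (suc p) c c′ α β (x ∷ L) = cup-scale p c c′ _ β L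

  lastFrom : A → List A → A
  lastFrom x []      = x
  lastFrom x (y ∷ u) = lastFrom y u

  cup-++ : ∀ (α β : List A → ℤ) x u v → cup (length u) α β (x ∷ u ++ v) ≡ α (x ∷ u) * β (lastFrom x u ∷ v)
  cup-++ α β x []      v = refl
  cup-++ α β x (y ∷ u) v = cup-++ (λ M → α (x ∷ M)) β y u v

  -- Front and back overlap in one entry, so two equal neighbours lie together in one of them.
  cup-normalised : ∀ p {α β : List A → ℤ} → Normalised α → Normalised β → Normalised (cup p α β)
  cup-normalised zero    {α} {β} nα nβ []        a post = trans (cong (α _ *_) (nβ [] a post)) (*-zeroʳ (α _))
  cup-normalised zero    {α} {β} nα nβ (x ∷ pre) a post = trans (cong (α _ *_) (nβ (x ∷ pre) a post)) (*-zeroʳ (α _))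
  cup-normalised (suc p) {α} {β} nα nβ (x ∷ pre) a post = cup-normalised p (λ pre → nα (x ∷ pre)) nβ pre a post
  cup-normalised (suc zero)    {α} {β} nα nβ []  a post = cong (_* β (a ∷ post)) (nα [] a [])
  cup-normalised (suc (suc p)) {α} {β} nα nβ []  a post = cup-zeroˡ p β (λ M _ → nα [] a M) post

-- The signature of a list of labels: alternation and behaviour under rotation.

module Signatures where

  open Cochains
  open import Data.Fin using (Fin; zero; suc; fromℕ; inject₁)
  import Data.Fin as Fin
  open import Data.Fin.Properties using (pigeonhole)
  open import Data.Fin.Relation.Unary.Top using (view; view-fromℕ; view-inject₁; ‵fromℕ; ‵inj₁)
  open import Data.Fin.Induction using (<-weakInduction)
  open import Data.Integer using (ℤ; +_; -[1+_]; 0ℤ; 1ℤ; -1ℤ; _+_; _*_; -_; _-_; _^_)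
  open import Data.Integer.Properties
  open import Data.Integer.Tactic.RingSolver using (solve-∀)
  open import Data.List using (List; []; _∷_; _++_; map; length; lookup)
  open import Data.Nat as ℕ using (ℕ; zero; suc; s≤s)
  open import Data.Product using (_,_; ∃₂)
  open import Relation.Binary.PropositionalEquality
  open import Relation.Nullary using (contradiction)
  open ≡-Reasoning
  open import Algebra.Properties.CommutativeMonoid.Sum +-0-commutativeMonoid
    using (sum; sum-cong-≗; ∑-comm; sum-init-last; sum-replicate-zero)

  private variable
    n : ℕ

  sum-zero : ∀ {f : Fin n → ℤ} → (∀ i → f i ≡ 0ℤ) → sum f ≡ 0ℤ
  sum-zero {n} eq = trans (sum-cong-≗ eq) (sum-replicate-zero n)

  sum-const : ∀ n c → sum {n} (λ _ → c) ≡ + n * c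
  sum-const zero    c = refl
  sum-const (suc n) c = trans (cong (λ z → c + z) (sum-const n c)) (sym (suc-* (+ n) c))

  sum-neg : ∀ (f : Fin n → ℤ) → sum (λ i → - f i) ≡ - sum f
  sum-neg {zero}  f = refl
  sum-neg {suc n} f = trans (cong (λ z → - f zero + z) (sum-neg (λ i → f (suc i)))) (sym (neg-distrib-+ (f zero) _))

  sum-sub : ∀ (f g : Fin n → ℤ) → sum (λ i → f i - g i) ≡ sum f - sum g
  sum-sub {zero}  f g = refl
  sum-sub {suc n} f g = trans (cong (λ z → f zero - g zero + z) (sum-sub (λ i → f (suc i)) (λ i → g (suc i))))
                              (rearrange (f zero) (g zero) _ _)
    where
    rearrange : ∀ a b c d → a - b + (c - d) ≡ a + c - (b + d)
    rearrange = solve-∀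

  sum-single : ∀ (f : Fin n → ℤ) i → (∀ j → j ≢ i → f j ≡ 0ℤ) → sum f ≡ f i
  sum-single f zero    eq = trans (cong (λ z → f zero + z) (sum-zero (λ j → eq (suc j) λ ()))) (+-identityʳ (f zero))
  sum-single f (suc i) eq = trans (cong₂ _+_ (eq zero λ ()) (sum-single (λ j → f (suc j)) i (λ j j≢i → eq (suc j) (λ { refl → j≢i refl }))))
                                  (+-identityˡ (f (suc i)))

  ≡-neg⇒≡0 : ∀ x → x ≡ - x → x ≡ 0ℤ
  ≡-neg⇒≡0 (+ zero)  _ = refl
  ≡-neg⇒≡0 (+ suc _) ()
  ≡-neg⇒≡0 -[1+ _ ] ()

  sum-antisym : ∀ (g : Fin n → Fin n → ℤ) → (∀ i j → g i j ≡ - g j i) → sum (λ i → sum (g i)) ≡ 0ℤ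
  sum-antisym g anti = ≡-neg⇒≡0 _ (begin
    sum (λ i → sum (g i))             ≡⟨ sum-cong-≗ (λ i → sum-cong-≗ (anti i)) ⟩
    sum (λ i → sum (λ j → - g j i))   ≡⟨ sum-cong-≗ (λ i → sum-neg (λ j → g j i)) ⟩
    sum (λ i → - sum (λ j → g j i))   ≡⟨ sum-neg (λ i → sum (λ j → g j i)) ⟩
    - sum (λ i → sum (λ j → g j i))   ≡⟨ cong -_ (∑-comm (λ i j → g j i)) ⟩
    - sum (λ j → sum (λ i → g j i))   ∎)

  rot : Fin (suc n) → Fin (suc n)
  rot i with view i
  ... | ‵fromℕ         = zero
  ... | ‵inj₁ {i = j} _ = suc j

  rot-fromℕ : ∀ n → rot (fromℕ n) ≡ zero
  rot-fromℕ n rewrite view-fromℕ n = refl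

  rot-inject₁ : (i : Fin n) → rot (inject₁ i) ≡ suc i
  rot-inject₁ i rewrite view-inject₁ i = refl

  sum-rot : ∀ (f : Fin (suc n) → ℤ) → sum (λ i → f (rot i)) ≡ sum f
  sum-rot {n} f = begin
    sum (λ i → f (rot i))                                    ≡⟨ sum-init-last (λ i → f (rot i)) ⟩
    sum (λ i → f (rot (inject₁ i))) + f (rot (fromℕ n))      ≡⟨ cong₂ _+_ (sum-cong-≗ (λ i → cong f (rot-inject₁ i))) (cong f (rot-fromℕ n)) ⟩
    sum (λ i → f (suc i)) + f zero                           ≡⟨ +-comm _ (f zero) ⟩
    sum f                                                    ∎

  rot-invariant⇒constant : ∀ (f : Fin (suc n) → ℤ) → (∀ i → f (rot i) ≡ f i) → ∀ i → f i ≡ f zero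
  rot-invariant⇒constant f inv = <-weakInduction (λ i → f i ≡ f zero) refl
    (λ i eq → trans (cong f (sym (rot-inject₁ i))) (trans (inv (inject₁ i)) eq))

  sg : Fin n → Fin n → ℤ
  sg zero    zero    = 0ℤ
  sg zero    (suc _) = 1ℤ
  sg (suc _) zero    = -1ℤ
  sg (suc x) (suc y) = sg x y

  sg-antisym : (x y : Fin n) → sg x y ≡ - sg y x
  sg-antisym zero    zero    = refl
  sg-antisym zero    (suc _) = refl
  sg-antisym (suc _) zero    = refl
  sg-antisym (suc x) (suc y) = sg-antisym x y

  sg-square-idem : (x y : Fin n) → sg x y * sg x y * (sg x y * sg x y) ≡ sg x y * sg x y
  sg-square-idem zero    zero    = refl
  sg-square-idem zero    (suc _) = refl
  sg-square-idem (suc _) zero    = refl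
  sg-square-idem (suc x) (suc y) = sg-square-idem x y

  sg-square-≢ : (x y : Fin n) → x ≢ y → sg x y * sg x y ≡ 1ℤ
  sg-square-≢ zero    zero    x≢y = contradiction refl x≢y
  sg-square-≢ zero    (suc _) _   = refl
  sg-square-≢ (suc _) zero    _   = refl
  sg-square-≢ (suc x) (suc y) x≢y = sg-square-≢ x y (λ eq → x≢y (cong suc eq))

  sg-square-sum : ∀ (g : Fin n → ℤ) z → sum (λ a → sg a z * sg a z * g a) + g z ≡ sum g
  sg-square-sum {suc n} g zero = begin
    0ℤ * g zero + sum (λ a → 1ℤ * g (suc a)) + g zero ≡⟨ cong (λ u → 0ℤ * g zero + u + g zero) (sum-cong-≗ (λ a → *-identityˡ (g (suc a)))) ⟩
    0ℤ * g zero + sum (λ a → g (suc a)) + g zero      ≡⟨ rearrange (g zero) _ ⟩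
    g zero + sum (λ a → g (suc a))                    ∎
    where
    rearrange : ∀ a b → 0ℤ * a + b + a ≡ a + b
    rearrange = solve-∀
  sg-square-sum {suc n} g (suc z) = begin
    1ℤ * g zero + sum (λ a → sg a z * sg a z * g (suc a)) + g (suc z)   ≡⟨ rearrange (g zero) _ (g (suc z)) ⟩
    g zero + (sum (λ a → sg a z * sg a z * g (suc a)) + g (suc z))      ≡⟨ cong (λ u → g zero + u) (sg-square-sum (λ a → g (suc a)) z) ⟩
    g zero + sum (λ a → g (suc a))                                      ∎
    where
    rearrange : ∀ a b c → 1ℤ * a + b + c ≡ a + (b + c)
    rearrange = solve-∀

  sgs : Fin n → List (Fin n) → ℤ
  sgs x []       = 1ℤ
  sgs x (y ∷ ys) = sg x y * sgs x ys

  ε : List (Fin n) → ℤ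
  ε []       = 1ℤ
  ε (x ∷ xs) = sgs x xs * ε xs

  Alternating : {A : Set} → (List A → ℤ) → Set
  Alternating f = ∀ pre a b post → f (pre ++ a ∷ b ∷ post) ≡ - f (pre ++ b ∷ a ∷ post)

  module _ {A : Set} where

    -- Interchanging the head with a later entry takes an odd number of swaps of neighbours,
    -- whatever lies between.
    exchange : ∀ {f : List A → ℤ} → Alternating f → ∀ w pre a post →
               f (w ∷ pre ++ a ∷ post) ≡ - f (a ∷ pre ++ w ∷ post)
    exchange     alt w []        a post = alt [] w a post
    exchange {f} alt w (x ∷ pre) a post = begin
      f (w ∷ x ∷ pre ++ a ∷ post)     ≡⟨ alt [] w x _ ⟩
      - f (x ∷ w ∷ pre ++ a ∷ post)   ≡⟨ cong -_ (exchange {λ M → f (x ∷ M)} (λ pre → alt (x ∷ pre)) w pre a post) ⟩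
      - - f (x ∷ a ∷ pre ++ w ∷ post) ≡⟨ cong (λ z → - - z) (alt [] x a _) ⟩
      - - - f (a ∷ x ∷ pre ++ w ∷ post) ≡⟨ cong -_ (neg-involutive _) ⟩
      - f (a ∷ x ∷ pre ++ w ∷ post)   ∎

    alternating⇒normalised : ∀ {f : List A → ℤ} → Alternating f → Normalised f
    alternating⇒normalised alt pre a post = ≡-neg⇒≡0 _ (alt pre a a post)

    split-at : ∀ (xs : List A) j → ∃₂ λ pre post → xs ≡ pre ++ lookup xs j ∷ post
    split-at (x ∷ xs) zero    = [] , xs , refl
    split-at (x ∷ xs) (suc j) with pre , post , eq ← split-at xs j = x ∷ pre , post , cong (x ∷_) eq

    alternating-repeat : ∀ {f : List A → ℤ} → Alternating f → ∀ L (i j : Fin (length L)) → i Fin.< j →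
                         lookup L i ≡ lookup L j → f L ≡ 0ℤ
    alternating-repeat {f} alt (x ∷ L) zero (suc j) _ eq with pre , post , split ← split-at L j =
      trans (cong (λ M → f (x ∷ M)) split′) (≡-neg⇒≡0 _ (exchange {f} alt x pre x post))
      where
      split′ : L ≡ pre ++ x ∷ post
      split′ = trans split (cong (λ a → pre ++ a ∷ post) (sym eq))
    alternating-repeat {f} alt (x ∷ L) (suc i) (suc j) (s≤s i<j) eq =
      alternating-repeat {λ M → f (x ∷ M)} (λ pre → alt (x ∷ pre)) L i j i<j eq

    -- Together with `alternating-pigeonhole` this makes `ε` a cocycle: `D ε` on r + 1 entries taken
    -- from r labels meets a repetition.
    D-alternating : ∀ {f : List A → ℤ} → Alternating f → Alternating (D f)
    D-alternating {f} alt [] a b post = begin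
      f (b ∷ post) - (f (a ∷ post) - D (λ ys → f (a ∷ b ∷ ys)) post)
        ≡⟨ cong (λ z → f (b ∷ post) - (f (a ∷ post) - z))
             (trans (D-cong post (λ {ys} _ → trans (alt [] a b ys) (sym (-1*i≡-i _)))) (D-scale -1ℤ (λ ys → f (b ∷ a ∷ ys)) post)) ⟩
      f (b ∷ post) - (f (a ∷ post) - -1ℤ * D (λ ys → f (b ∷ a ∷ ys)) post)
        ≡⟨ rearrange (f (b ∷ post)) (f (a ∷ post)) _ ⟩
      - (f (a ∷ post) - (f (b ∷ post) - D (λ ys → f (b ∷ a ∷ ys)) post)) ∎
      where
      rearrange : ∀ u v w → u - (v - -1ℤ * w) ≡ - (v - (u - w))
      rearrange = solve-∀
    D-alternating {f} alt (x ∷ pre) a b post = begin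
      f (pre ++ a ∷ b ∷ post) - D fₓ (pre ++ a ∷ b ∷ post)
        ≡⟨ cong₂ _-_ (alt pre a b post) (D-alternating {fₓ} (λ pre → alt (x ∷ pre)) pre a b post) ⟩
      - f (pre ++ b ∷ a ∷ post) - - D fₓ (pre ++ b ∷ a ∷ post)
        ≡⟨ rearrange (f (pre ++ b ∷ a ∷ post)) _ ⟩
      - (f (pre ++ b ∷ a ∷ post) - D fₓ (pre ++ b ∷ a ∷ post)) ∎
      where
      fₓ = λ M → f (x ∷ M)
      rearrange : ∀ u v → - u - - v ≡ - (u - v)
      rearrange = solve-∀

  alternating-pigeonhole : ∀ {f : List (Fin n) → ℤ} → Alternating f → ∀ L → n ℕ.< length L → f L ≡ 0ℤ
  alternating-pigeonhole {f = f} alt L lt with i , j , i<j , eq ← pigeonhole lt (lookup L) =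
    alternating-repeat {f = f} alt L i j i<j eq

  sgs-swap : (x : Fin n) → ∀ pre a b post → sgs x (pre ++ a ∷ b ∷ post) ≡ sgs x (pre ++ b ∷ a ∷ post)
  sgs-swap x []        a b post = rearrange (sg x a) (sg x b) (sgs x post)
    where
    rearrange : ∀ u v w → u * (v * w) ≡ v * (u * w)
    rearrange = solve-∀
  sgs-swap x (y ∷ pre) a b post = cong (sg x y *_) (sgs-swap x pre a b post)

  ε-alternating : Alternating (ε {n})
  ε-alternating [] a b post = begin
    sg a b * sgs a post * (sgs b post * ε post)     ≡⟨ cong (λ z → z * sgs a post * (sgs b post * ε post)) (sg-antisym a b) ⟩
    - sg b a * sgs a post * (sgs b post * ε post)   ≡⟨ rearrange (sg b a) (sgs a post) (sgs b post) (ε post) ⟩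
    - (sg b a * sgs b post * (sgs a post * ε post)) ∎
    where
    rearrange : ∀ s u v e → - s * u * (v * e) ≡ - (s * v * (u * e))
    rearrange = solve-∀
  ε-alternating (x ∷ pre) a b post = begin
    sgs x (pre ++ a ∷ b ∷ post) * ε (pre ++ a ∷ b ∷ post)     ≡⟨ cong₂ _*_ (sgs-swap x pre a b post) (ε-alternating pre a b post) ⟩
    sgs x (pre ++ b ∷ a ∷ post) * - ε (pre ++ b ∷ a ∷ post)   ≡⟨ neg-distribʳ-* (sgs x (pre ++ b ∷ a ∷ post)) _ ⟨
    - (sgs x (pre ++ b ∷ a ∷ post) * ε (pre ++ b ∷ a ∷ post)) ∎

  -- Only the top label wraps past all others under `rot`; `tau` is the sign that this puts on each
  -- of its comparisons.
  tau : Fin (suc n) → ℤ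
  tau i with view i
  ... | ‵fromℕ  = -1ℤ
  ... | ‵inj₁ _ = 1ℤ

  sg-fromℕ-inject₁ : (j : Fin n) → sg (fromℕ n) (inject₁ j) ≡ -1ℤ
  sg-fromℕ-inject₁ zero    = refl
  sg-fromℕ-inject₁ (suc j) = sg-fromℕ-inject₁ j

  sg-inject₁ : (i j : Fin n) → sg (inject₁ i) (inject₁ j) ≡ sg i j
  sg-inject₁ zero    zero    = refl
  sg-inject₁ zero    (suc _) = refl
  sg-inject₁ (suc _) zero    = refl
  sg-inject₁ (suc i) (suc j) = sg-inject₁ i j

  sg-diag : (i : Fin n) → sg i i ≡ 0ℤ
  sg-diag i = ≡-neg⇒≡0 _ (sg-antisym i i)

  sg-rot : (x y : Fin (suc n)) → sg (rot x) (rot y) ≡ tau x * tau y * sg x y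
  sg-rot {n} x y with view x | view y
  ... | ‵fromℕ          | ‵fromℕ          rewrite sg-diag (fromℕ n) = refl
  ... | ‵fromℕ          | ‵inj₁ {i = j} _ rewrite sg-fromℕ-inject₁ j = refl
  ... | ‵inj₁ {i = i} _ | ‵fromℕ          rewrite sg-antisym (inject₁ i) (fromℕ n) | sg-fromℕ-inject₁ i = refl
  ... | ‵inj₁ {i = i} _ | ‵inj₁ {i = j} _ = trans (sym (sg-inject₁ i j)) (sym (*-identityˡ _))

  tau-square : (x : Fin (suc n)) → tau x * tau x ≡ 1ℤ
  tau-square x with view x
  ... | ‵fromℕ  = refl
  ... | ‵inj₁ _ = refl

  taus : List (Fin (suc n)) → ℤ
  taus []      = 1ℤ
  taus (x ∷ L) = tau x * taus L

  taus-square : (L : List (Fin (suc n))) → taus L * taus L ≡ 1ℤ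
  taus-square []      = refl
  taus-square (x ∷ L) = trans (rearrange (tau x) (taus L)) (cong₂ _*_ (tau-square x) (taus-square L))
    where
    rearrange : ∀ a b → a * b * (a * b) ≡ a * a * (b * b)
    rearrange = solve-∀

  sgs-rot : (x : Fin (suc n)) → ∀ ys → sgs (rot x) (map rot ys) ≡ tau x ^ length ys * taus ys * sgs x ys
  sgs-rot x []       = refl
  sgs-rot x (y ∷ ys) = trans (cong₂ _*_ (sg-rot x y) (sgs-rot x ys))
                             (rearrange (tau x) (tau y) (sg x y) (tau x ^ length ys) (taus ys) (sgs x ys))
    where
    rearrange : ∀ a b c d e f → a * b * c * (d * e * f) ≡ a * d * (b * e) * (c * f)
    rearrange = solve-∀

  -- Each label takes part in `length L − 1` comparisons. The extra factor `taus L` raises the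
  -- exponent to `length L` and avoids the subtraction.
  ε-rot-taus : (L : List (Fin (suc n))) → ε (map rot L) * taus L ≡ taus L ^ length L * ε L
  ε-rot-taus []      = refl
  ε-rot-taus (x ∷ L) = begin
    sgs (rot x) (map rot L) * ε (map rot L) * (tau x * taus L)
      ≡⟨ cong (λ z → z * ε (map rot L) * (tau x * taus L)) (sgs-rot x L) ⟩
    tau x ^ k * taus L * sgs x L * ε (map rot L) * (tau x * taus L)
      ≡⟨ rearrange (tau x ^ k) (taus L) (sgs x L) (ε (map rot L)) (tau x) ⟩
    tau x * taus L * (tau x ^ k * sgs x L * (ε (map rot L) * taus L))
      ≡⟨ cong (λ z → tau x * taus L * (tau x ^ k * sgs x L * z)) (ε-rot-taus L) ⟩
    tau x * taus L * (tau x ^ k * sgs x L * (taus L ^ k * ε L))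
      ≡⟨ rearrange′ (tau x * taus L) (tau x ^ k) (sgs x L) (taus L ^ k) (ε L) ⟩
    tau x * taus L * (tau x ^ k * taus L ^ k) * (sgs x L * ε L)
      ≡⟨ cong (λ z → tau x * taus L * z * (sgs x L * ε L)) (pow (tau x) (taus L) k) ⟨
    tau x * taus L * (tau x * taus L) ^ k * (sgs x L * ε L) ∎
    where
    k = length L
    rearrange : ∀ a b c d e → a * b * c * d * (e * b) ≡ e * b * (a * c * (d * b))
    rearrange = solve-∀
    rearrange′ : ∀ a b c d e → a * (b * c * (d * e)) ≡ a * (b * d) * (c * e)
    rearrange′ = solve-∀
    pow : ∀ a b k → (a * b) ^ k ≡ a ^ k * b ^ k
    pow a b zero    = refl
    pow a b (suc k) = trans (cong (a * b *_) (pow a b k)) (rearrange″ a b (a ^ k) (b ^ k))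
      where
      rearrange″ : ∀ a b c d → a * b * (c * d) ≡ a * c * (b * d)
      rearrange″ = solve-∀

  -- Each label takes part in 2h comparisons, so its sign `tau` occurs to an even power.
  ε-rot-even : ∀ h (L : List (Fin (suc n))) → length L ≡ suc (2 ℕ.* h) → ε (map rot L) ≡ ε L
  ε-rot-even h L len = begin
    ε (map rot L)                          ≡⟨ *-identityʳ _ ⟨
    ε (map rot L) * 1ℤ                     ≡⟨ cong (ε (map rot L) *_) (taus-square L) ⟨
    ε (map rot L) * (taus L * taus L)      ≡⟨ *-assoc (ε (map rot L)) (taus L) (taus L) ⟨
    ε (map rot L) * taus L * taus L        ≡⟨ cong (_* taus L) (trans (ε-rot-taus L) (cong (_* ε L) power)) ⟩
    taus L * ε L * taus L                  ≡⟨ rearrange (taus L) (ε L) ⟩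
    taus L * taus L * ε L                  ≡⟨ cong (_* ε L) (taus-square L) ⟩
    1ℤ * ε L                               ≡⟨ *-identityˡ (ε L) ⟩
    ε L                                    ∎
    where
    rearrange : ∀ a b → a * b * a ≡ a * a * b
    rearrange = solve-∀
    power : taus L ^ length L ≡ taus L
    power = begin
      taus L ^ length L           ≡⟨ cong (taus L ^_) len ⟩
      taus L * taus L ^ (2 ℕ.* h) ≡⟨ cong (taus L *_) (^-*-assoc (taus L) 2 h) ⟨
      taus L * (taus L ^ 2) ^ h   ≡⟨ cong (λ z → taus L * z ^ h) (trans (cong (taus L *_) (*-identityʳ (taus L))) (taus-square L)) ⟩
      taus L * 1ℤ ^ h             ≡⟨ cong (taus L *_) (^-zeroˡ h) ⟩
      taus L * 1ℤ                 ≡⟨ *-identityʳ (taus L) ⟩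
      taus L                      ∎

  ε-rot-two : ∀ (L : List (Fin 2)) → length L ≡ 2 → ε (map rot L) ≡ -1ℤ * ε L
  ε-rot-two (zero ∷ zero ∷ [])         _ = refl
  ε-rot-two (zero ∷ suc zero ∷ [])     _ = refl
  ε-rot-two (suc zero ∷ zero ∷ [])     _ = refl
  ε-rot-two (suc zero ∷ suc zero ∷ []) _ = refl

  -- The square of `sgs a L` is 1 exactly for the labels `a` outside `L`, and the square of `ε L` is
  -- 1 exactly for lists without repetition. Such a list leaves `n − length L` labels; the factor
  -- `ε L * ε L` silences all other lists.
  ε-count : (L : List (Fin n)) → (sum (λ a → sgs a L * sgs a L) + + length L) * (ε L * ε L) ≡ + n * (ε L * ε L)
  ε-count {n} []      = cong (_* 1ℤ) (trans (+-identityʳ _) (trans (sum-const n 1ℤ) (*-identityʳ (+ n))))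
  ε-count {n} (z ∷ L) = begin
    (sum (λ a → sg a z * sgs a L * (sg a z * sgs a L)) + + suc (length L)) * (sgs z L * ε L * (sgs z L * ε L))
      ≡⟨ cong₂ (λ u v → (u + v) * (sgs z L * ε L * (sgs z L * ε L)))
           (sum-cong-≗ (λ a → square-* (sg a z) (sgs a L))) (pos-+ 1 (length L)) ⟩
    (sum (λ a → sg a z * sg a z * q a) + (1ℤ + + length L)) * (sgs z L * ε L * (sgs z L * ε L))
      ≡⟨ rearrange (sum (λ a → sg a z * sg a z * q a)) (+ length L) (sgs z L) (ε L) ⟩
    ((sum (λ a → sg a z * sg a z * q a) + q z) + + length L) * (ε L * ε L) * q z + (q z - q z * q z) * (ε L * ε L)
      ≡⟨ cong₂ (λ u v → (u + + length L) * (ε L * ε L) * q z + (q z - v) * (ε L * ε L)) (sg-square-sum q z) (idem z L) ⟩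
    (sum q + + length L) * (ε L * ε L) * q z + (q z - q z) * (ε L * ε L)
      ≡⟨ cong (λ u → u * q z + (q z - q z) * (ε L * ε L)) (ε-count L) ⟩
    + n * (ε L * ε L) * q z + (q z - q z) * (ε L * ε L)
      ≡⟨ rearrange′ (+ n) (ε L) (sgs z L) ⟩
    + n * (sgs z L * ε L * (sgs z L * ε L)) ∎
    where
    q = λ a → sgs a L * sgs a L
    square-* : ∀ a b → a * b * (a * b) ≡ a * a * (b * b)
    square-* = solve-∀
    rearrange : ∀ s l p e → (s + (1ℤ + l)) * (p * e * (p * e)) ≡ ((s + p * p) + l) * (e * e) * (p * p) + (p * p - p * p * (p * p)) * (e * e)
    rearrange = solve-∀
    rearrange′ : ∀ n e p → n * (e * e) * (p * p) + (p * p - p * p) * (e * e) ≡ n * (p * e * (p * e))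
    rearrange′ = solve-∀
    idem : ∀ z M → sgs z M * sgs z M * (sgs z M * sgs z M) ≡ sgs z M * sgs z M
    idem z []      = refl
    idem z (y ∷ M) = begin
      sg z y * sgs z M * (sg z y * sgs z M) * (sg z y * sgs z M * (sg z y * sgs z M)) ≡⟨ r1 (sg z y) (sgs z M) ⟩
      sg z y * sg z y * (sg z y * sg z y) * (sgs z M * sgs z M * (sgs z M * sgs z M)) ≡⟨ cong₂ _*_ (sg-square-idem z y) (idem z M) ⟩
      sg z y * sg z y * (sgs z M * sgs z M)                                           ≡⟨ square-* (sg z y) (sgs z M) ⟨
      sg z y * sgs z M * (sg z y * sgs z M)                                           ∎
      where
      r1 : ∀ a b → a * b * (a * b) * (a * b * (a * b)) ≡ a * a * (a * a) * (b * b * (b * b))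
      r1 = solve-∀

-- The fundamental cycle of the join, the cocycle `ω`, and their pairing modulo r.

module Degrees where

  open Cochains
  open Signatures
  open import Data.Fin using (Fin; zero; suc)
  open import Data.Integer using (ℤ; +_; 0ℤ; 1ℤ; _+_; _*_; -_; _-_; _^_; ∣_∣)
  open import Data.Integer.Properties
  open import Data.Integer.Tactic.RingSolver using (solve-∀)
  open import Data.List using (List; []; _∷_; _++_; map; length; concat; take; drop)
  open import Data.List.Properties using (length-map; map-++; length-++; take-map; drop-map; length-take; length-drop)
  open import Data.List.Relation.Unary.All using (All; []; _∷_)
  import Data.List.Relation.Unary.All as All
  open import Data.Nat as ℕ using (ℕ; zero; suc; s≤s; _<_; _≤_; _∸_)
  import Data.Nat.Properties as ℕ
  open import Data.Nat.Divisibility using (_∣_; divides; ∣⇒≤; ∣1⇒≡1; _∤_)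
  open import Data.Nat.Primality using (Prime; euclidsLemma; ¬prime[1])
  open import Data.Product using (_×_; _,_; proj₁; proj₂; ∃)
  open import Data.Sum using (inj₁; inj₂)
  open import Relation.Binary.PropositionalEquality
  open import Relation.Nullary using (contradiction)
  open ≡-Reasoning
  open import Algebra.Properties.CommutativeMonoid.Sum +-0-commutativeMonoid
    using (sum; sum-cong-≗; ∑-comm)
  open import Algebra.Properties.Semiring.Sum +-*-semiring using (*-distribˡ-sum; *-distribʳ-sum)

  -- Here `n` is r - 1: `Z` is ℤ/r, and a block consists of `n` columns from `C`.
  module Faces (n : ℕ) (C : Set) where

    Z X : Set
    Z = Fin (suc n)
    X = C × Z

    rotX : X → X
    rotX (c , a) = c , rot a

    labels : List X → List Z
    labels = map proj₂

    labels-length : ∀ τ {cs} → map proj₁ τ ≡ cs → length (labels τ) ≡ length cs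
    labels-length τ p = trans (length-map proj₂ τ) (trans (sym (length-map proj₁ τ)) (cong length p))

    -- All labellings are summed, also those that repeat a label within a block; the latter get
    -- weight 0 from `P`.
    Σf : List C → (List X → ℤ) → ℤ
    Σf []       f = f []
    Σf (c ∷ cs) f = sum (λ a → Σf cs (λ τ → f ((c , a) ∷ τ)))

    Σf-cong : ∀ cs {f g : List X → ℤ} → (∀ τ → map proj₁ τ ≡ cs → f τ ≡ g τ) → Σf cs f ≡ Σf cs g
    Σf-cong []       eq = eq [] refl
    Σf-cong (c ∷ cs) eq = sum-cong-≗ (λ a → Σf-cong cs (λ τ p → eq ((c , a) ∷ τ) (cong (c ∷_) p)))

    Σf-zero : ∀ cs {f : List X → ℤ} → (∀ τ → map proj₁ τ ≡ cs → f τ ≡ 0ℤ) → Σf cs f ≡ 0ℤ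
    Σf-zero []       eq = eq [] refl
    Σf-zero (c ∷ cs) eq = sum-zero (λ a → Σf-zero cs (λ τ p → eq ((c , a) ∷ τ) (cong (c ∷_) p)))

    Σf-scale : ∀ cs c (f : List X → ℤ) → Σf cs (λ τ → c * f τ) ≡ c * Σf cs f
    Σf-scale []       c f = refl
    Σf-scale (b ∷ cs) c f = trans (sum-cong-≗ (λ a → Σf-scale cs c (λ τ → f ((b , a) ∷ τ))))
                                   (sym (*-distribˡ-sum c (λ a → Σf cs (λ τ → f ((b , a) ∷ τ)))))

    Σf-sum-comm : ∀ {m} cs (f : Fin m → List X → ℤ) → Σf cs (λ τ → sum (λ i → f i τ)) ≡ sum (λ i → Σf cs (f i))
    Σf-sum-comm []       f = refl
    Σf-sum-comm (c ∷ cs) f = trans (sum-cong-≗ (λ a → Σf-sum-comm cs (λ i τ → f i ((c , a) ∷ τ))))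
                                   (∑-comm (λ a i → Σf cs (λ τ → f i ((c , a) ∷ τ))))

    Σf-sub : ∀ cs (f g : List X → ℤ) → Σf cs (λ τ → f τ - g τ) ≡ Σf cs f - Σf cs g
    Σf-sub []       f g = refl
    Σf-sub (c ∷ cs) f g = trans (sum-cong-≗ (λ a → Σf-sub cs (λ τ → f ((c , a) ∷ τ)) (λ τ → g ((c , a) ∷ τ))))
                                (sum-sub (λ a → Σf cs (λ τ → f ((c , a) ∷ τ))) (λ a → Σf cs (λ τ → g ((c , a) ∷ τ))))

    Σf-++ : ∀ bs cs (f : List X → ℤ) → Σf (bs ++ cs) f ≡ Σf bs (λ u → Σf cs (λ v → f (u ++ v)))
    Σf-++ []       cs f = refl
    Σf-++ (b ∷ bs) cs f = sum-cong-≗ (λ a → Σf-++ bs cs (λ τ → f ((b , a) ∷ τ)))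

    Σf-D : ∀ cs {A : Set} (g : List X → List A → ℤ) u → Σf cs (λ v → D (g v) u) ≡ D (λ u′ → Σf cs (λ v → g v u′)) u
    Σf-D cs g []      = Σf-zero cs (λ _ _ → refl)
    Σf-D cs g (x ∷ u) = trans (Σf-sub cs (λ v → g v u) (λ v → D (λ u′ → g v (x ∷ u′)) u))
                              (cong (λ z → Σf cs (λ v → g v u) - z) (Σf-D cs (λ v u′ → g v (x ∷ u′)) u))

    Σf-rot : ∀ cs (f : List X → ℤ) → Σf cs (λ τ → f (map rotX τ)) ≡ Σf cs f
    Σf-rot []       f = refl
    Σf-rot (c ∷ cs) f = trans (sum-cong-≗ (λ a → Σf-rot cs (λ τ → f ((c , rot a) ∷ τ))))
                              (sum-rot (λ a → Σf cs (λ τ → f ((c , a) ∷ τ))))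

    -- Rotation moves the labels of the first column in a single cycle, so every label there
    -- contributes the same amount.
    Σf-invariant : ∀ c cs (f : List X → ℤ) → (∀ τ → map proj₁ τ ≡ c ∷ cs → f (map rotX τ) ≡ f τ) →
                   ∃ λ z → Σf (c ∷ cs) f ≡ + suc n * z
    Σf-invariant c cs f inv = g zero , trans (sum-cong-≗ (rot-invariant⇒constant g g-inv)) (sum-const (suc n) (g zero))
      where
      g : Z → ℤ
      g a = Σf cs (λ τ → f ((c , a) ∷ τ))
      g-inv : ∀ a → g (rot a) ≡ g a
      g-inv a = trans (sym (Σf-rot cs (λ τ → f ((c , rot a) ∷ τ))))
                      (Σf-cong cs (λ τ p → inv ((c , a) ∷ τ) (cong (c ∷_) p)))

    -- The constant 0-cochain 1. It is set to 0 on longer lists, which makes it normalised and lets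
    -- `ω` inherit this.
    unit : List Z → ℤ
    unit (_ ∷ []) = 1ℤ
    unit _        = 0ℤ

    unit-normalised : Normalised unit
    unit-normalised []            a post = refl
    unit-normalised (x ∷ [])      a post = refl
    unit-normalised (x ∷ y ∷ pre) a post = refl

    ω : ℕ → List Z → ℤ
    ω zero    = unit
    ω (suc ℓ) = cup n ε (ω ℓ)

    ω-normalised : ∀ ℓ → Normalised (ω ℓ)
    ω-normalised zero    = unit-normalised
    ω-normalised (suc ℓ) = cup-normalised n (alternating⇒normalised {f = ε} ε-alternating) (ω-normalised ℓ)

    ω-cocycle : ∀ ℓ L → length L ≡ suc (suc (ℓ ℕ.* n)) → D (ω ℓ) L ≡ 0ℤ
    ω-cocycle zero    (x ∷ y ∷ []) _ = refl
    ω-cocycle (suc ℓ) L len = cup-cocycle n {ε} {ω ℓ} L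
      (subst (suc n <_) (sym len) (s≤s (s≤s (ℕ.m≤m+n n (ℓ ℕ.* n)))))
      (λ M p → alternating-pigeonhole {f = D ε} (D-alternating {f = ε} ε-alternating) M (ℕ.≤-reflexive (sym p)))
      (λ M p → ω-cocycle ℓ M (ℕ.+-cancelˡ-≡ n _ _ (trans p (trans len shift))))
      where
      shift : suc (suc (n ℕ.+ ℓ ℕ.* n)) ≡ n ℕ.+ suc (suc (ℓ ℕ.* n))
      shift = sym (trans (ℕ.+-suc n _) (cong suc (ℕ.+-suc n _)))

    -- The coefficients of the fundamental cycle of the chessboard complex with
    -- n + 1 rows and n columns: only the label missing from u contributes.
    p₁ : List Z → ℤ
    p₁ u = sum (λ w → ε (w ∷ u))

    P : ℕ → List Z → ℤ
    P zero    L = 1ℤ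
    P (suc ℓ) L = p₁ (take n L) * P ℓ (drop n L)

    P-++ : ∀ ℓ u v → length u ≡ n → P (suc ℓ) (u ++ v) ≡ p₁ u * P ℓ v
    P-++ ℓ u v len = cong₂ (λ a b → p₁ a * P ℓ b) (take-length u len) (drop-length u len)
      where
      take-length : ∀ {m} u → length u ≡ m → take m (u ++ v) ≡ u
      take-length []      refl = refl
      take-length (x ∷ u) refl = cong (x ∷_) (take-length u refl)
      drop-length : ∀ {m} u → length u ≡ m → drop m (u ++ v) ≡ v
      drop-length []      refl = refl
      drop-length (x ∷ u) refl = drop-length u refl

    -- `κ` will be the sign of the r-cycle: 1 for odd r and -1 for r = 2. It enters `ω ℓ` and `P ℓ`
    -- with the same exponent, so it cancels in their product.
    module Twist (κ : ℤ) (ε-rot : ∀ (L : List (Fin (suc n))) → length L ≡ suc n → ε (map rot L) ≡ κ * ε L) where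

      ω-rot : ∀ ℓ L → length L ≡ suc (ℓ ℕ.* n) → ω ℓ (map rot L) ≡ κ ^ ℓ * ω ℓ L
      ω-rot zero    (x ∷ []) _   = refl
      ω-rot (suc ℓ) L        len = begin
        cup n ε (ω ℓ) (map rot L)                              ≡⟨ cup-map n rot ε (ω ℓ) L ⟩
        cup n (λ M → ε (map rot M)) (λ M → ω ℓ (map rot M)) L  ≡⟨ cup-cong n ε-rot L
          (λ M p → ω-rot ℓ M (ℕ.+-cancelˡ-≡ n _ _ (trans p (trans len (sym (ℕ.+-suc n _)))))) ⟩
        cup n (λ M → κ * ε M) (λ M → κ ^ ℓ * ω ℓ M) L          ≡⟨ cup-scale n κ (κ ^ ℓ) ε (ω ℓ) L ⟩
        κ * κ ^ ℓ * cup n ε (ω ℓ) L                            ∎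

      p₁-rot : ∀ u → length u ≡ n → p₁ (map rot u) ≡ κ * p₁ u
      p₁-rot u len = begin
        sum (λ w → ε (w ∷ map rot u))      ≡⟨ sum-rot (λ w → ε (w ∷ map rot u)) ⟨
        sum (λ w → ε (map rot (w ∷ u)))    ≡⟨ sum-cong-≗ (λ w → ε-rot (w ∷ u) (cong suc len)) ⟩
        sum (λ w → κ * ε (w ∷ u))          ≡⟨ *-distribˡ-sum κ (λ w → ε (w ∷ u)) ⟨
        κ * sum (λ w → ε (w ∷ u))          ∎

      P-rot : ∀ ℓ L → length L ≡ ℓ ℕ.* n → P ℓ (map rot L) ≡ κ ^ ℓ * P ℓ L
      P-rot zero    L _   = refl
      P-rot (suc ℓ) L len = begin
        p₁ (take n (map rot L)) * P ℓ (drop n (map rot L)) ≡⟨ cong₂ (λ a b → p₁ a * P ℓ b) (take-map n L) (drop-map n L) ⟩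
        p₁ (map rot (take n L)) * P ℓ (map rot (drop n L)) ≡⟨ cong₂ _*_ (p₁-rot (take n L) take-len) (P-rot ℓ (drop n L) drop-len) ⟩
        κ * p₁ (take n L) * (κ ^ ℓ * P ℓ (drop n L))       ≡⟨ rearrange κ (p₁ (take n L)) (κ ^ ℓ) _ ⟩
        κ * κ ^ ℓ * (p₁ (take n L) * P ℓ (drop n L))       ∎
        where
        rearrange : ∀ a b c d → a * b * (c * d) ≡ a * c * (b * d)
        rearrange = solve-∀
        take-len : length (take n L) ≡ n
        take-len = trans (length-take n L) (ℕ.m≤n⇒m⊓n≡m (subst (n ≤_) (sym len) (ℕ.m≤m+n n (ℓ ℕ.* n))))
        drop-len : length (drop n L) ≡ ℓ ℕ.* n
        drop-len = trans (length-drop n L) (trans (cong (_∸ n) len) (ℕ.m+n∸m≡n n (ℓ ℕ.* n)))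

    -- That `Q` is a cycle, in dual form: it pairs to 0 with every coboundary.
    Balanced : List C → (List Z → ℤ) → Set
    Balanced cs Q = ∀ F → Σf cs (λ τ → Q (labels τ) * D F τ) ≡ 0ℤ

    -- Once the column labelled `a` is deleted, `F` no longer sees `a`, while `p₁` sums over a
    -- missing label `w`. Exchanging `a` and `w` reverses the sign, so the sum over both is 0. `pre`
    -- collects the columns whose deletion has been treated.
    p₁-balanced : ∀ pre cs → Balanced cs (λ u → p₁ (pre ++ u))
    p₁-balanced pre []       F = *-zeroʳ (p₁ (pre ++ []))
    p₁-balanced pre (c ∷ cs) F = begin
      sum (λ a → Σf cs (λ τ → p₁ (pre ++ a ∷ labels τ) * (F τ - D (Fₐ a) τ)))
        ≡⟨ sum-cong-≗ (λ a → Σf-cong cs (λ τ _ → distrib (p₁ (pre ++ a ∷ labels τ)) (F τ) (D (Fₐ a) τ))) ⟩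
      sum (λ a → Σf cs (λ τ → p₁ (pre ++ a ∷ labels τ) * F τ - p₁ (pre ++ a ∷ labels τ) * D (Fₐ a) τ))
        ≡⟨ sum-cong-≗ (λ a → Σf-sub cs (λ τ → p₁ (pre ++ a ∷ labels τ) * F τ) (λ τ → p₁ (pre ++ a ∷ labels τ) * D (Fₐ a) τ)) ⟩
      sum (λ a → Σf cs (λ τ → p₁ (pre ++ a ∷ labels τ) * F τ) - Σf cs (λ τ → p₁ (pre ++ a ∷ labels τ) * D (Fₐ a) τ))
        ≡⟨ sum-cong-≗ (λ a → trans (cong (λ z → Σf cs (λ τ → p₁ (pre ++ a ∷ labels τ) * F τ) - z) (rest a)) (+-identityʳ (Σf cs (λ τ → p₁ (pre ++ a ∷ labels τ) * F τ)))) ⟩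
      sum (λ a → Σf cs (λ τ → p₁ (pre ++ a ∷ labels τ) * F τ))
        ≡⟨ Σf-sum-comm cs (λ a τ → p₁ (pre ++ a ∷ labels τ) * F τ) ⟨
      Σf cs (λ τ → sum (λ a → p₁ (pre ++ a ∷ labels τ) * F τ))
        ≡⟨ Σf-zero cs (λ τ _ → trans (sym (*-distribʳ-sum (F τ) (λ a → p₁ (pre ++ a ∷ labels τ)))) (cong (_* F τ) (column (labels τ)))) ⟩
      0ℤ ∎
      where
      Fₐ = λ a τ → F ((c , a) ∷ τ)
      distrib : ∀ a b c → a * (b - c) ≡ a * b - a * c
      distrib = solve-∀
      reassoc : ∀ {A : Set} (pre : List A) {a u} → (pre ++ a ∷ []) ++ u ≡ pre ++ a ∷ u
      reassoc []        = refl
      reassoc (x ∷ pre) = cong (x ∷_) (reassoc pre)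
      rest : ∀ a → Σf cs (λ τ → p₁ (pre ++ a ∷ labels τ) * D (Fₐ a) τ) ≡ 0ℤ
      rest a = trans (Σf-cong cs (λ τ _ → cong (λ u → p₁ u * D (Fₐ a) τ) (sym (reassoc pre))))
                     (p₁-balanced (pre ++ a ∷ []) cs (Fₐ a))
      column : ∀ u → sum (λ a → p₁ (pre ++ a ∷ u)) ≡ 0ℤ
      column u = sum-antisym (λ a w → ε (w ∷ pre ++ a ∷ u)) (λ a w → exchange {f = ε} ε-alternating w pre a u)

    -- A join of cycles is a cycle. Deletions in the first block see the later blocks only through
    -- the sum `G`; deletions in the later blocks vanish by induction for each fixed `u`.
    P-balanced : ∀ bs → All (λ b → length b ≡ n) bs → Balanced (concat bs) (P (length bs))
    P-balanced []       []          F = refl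
    P-balanced (b ∷ bs) (len ∷ lens) F = begin
      Σf (b ++ cs) (λ τ → P (suc ℓ) (labels τ) * D F τ)
        ≡⟨ Σf-++ b cs _ ⟩
      Σf b (λ u → Σf cs (λ v → P (suc ℓ) (labels (u ++ v)) * D F (u ++ v)))
        ≡⟨ Σf-cong b (λ u p → Σf-cong cs (λ v _ → cong₂ _*_ (factor u v p) (D-++ F u v))) ⟩
      Σf b (λ u → Σf cs (λ v → p₁ (labels u) * P ℓ (labels v) * (Dˡ u v + sgn (length u) * Dʳ u v)))
        ≡⟨ Σf-cong b (λ u _ → Σf-cong cs (λ v _ → rearrange (p₁ (labels u)) (P ℓ (labels v)) (Dˡ u v) (sgn (length u)) (Dʳ u v))) ⟩
      Σf b (λ u → Σf cs (λ v → p₁ (labels u) * (P ℓ (labels v) * Dˡ u v) - - (p₁ (labels u) * sgn (length u)) * (P ℓ (labels v) * Dʳ u v)))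
        ≡⟨ Σf-cong b (λ u _ → trans (Σf-sub cs (λ v → p₁ (labels u) * (P ℓ (labels v) * Dˡ u v)) (λ v → - (p₁ (labels u) * sgn (length u)) * (P ℓ (labels v) * Dʳ u v)))
             (cong₂ _-_ (trans (Σf-scale cs (p₁ (labels u)) (λ v → P ℓ (labels v) * Dˡ u v)) (cong (p₁ (labels u) *_) (collect u))) (right u))) ⟩
      Σf b (λ u → p₁ (labels u) * D G u - 0ℤ)
        ≡⟨ Σf-cong b (λ u _ → +-identityʳ (p₁ (labels u) * D G u)) ⟩
      Σf b (λ u → p₁ (labels u) * D G u)
        ≡⟨ p₁-balanced [] b G ⟩
      0ℤ ∎
      where
      cs = concat bs
      ℓ = length bs
      Dˡ Dʳ : List X → List X → ℤ
      Dˡ u v = D (λ u′ → F (u′ ++ v)) u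
      Dʳ u v = D (λ v′ → F (u ++ v′)) v
      G : List X → ℤ
      G u′ = Σf cs (λ v → P ℓ (labels v) * F (u′ ++ v))
      factor : ∀ u v → map proj₁ u ≡ b → P (suc ℓ) (labels (u ++ v)) ≡ p₁ (labels u) * P ℓ (labels v)
      factor u v p = trans (cong (P (suc ℓ)) (map-++ proj₂ u v))
        (P-++ ℓ (labels u) (labels v) (trans (labels-length u p) len))
      rearrange : ∀ a b c s d → a * b * (c + s * d) ≡ a * (b * c) - - (a * s) * (b * d)
      rearrange = solve-∀
      collect : ∀ u → Σf cs (λ v → P ℓ (labels v) * Dˡ u v) ≡ D G u
      collect u = trans (Σf-cong cs (λ v _ → sym (D-scale (P ℓ (labels v)) (λ u′ → F (u′ ++ v)) u)))
                        (Σf-D cs (λ v u′ → P ℓ (labels v) * F (u′ ++ v)) u)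
      right : ∀ u → Σf cs (λ v → - (p₁ (labels u) * sgn (length u)) * (P ℓ (labels v) * Dʳ u v)) ≡ 0ℤ
      right u = trans (Σf-scale cs (- (p₁ (labels u) * sgn (length u))) (λ v → P ℓ (labels v) * Dʳ u v))
        (trans (cong (- (p₁ (labels u) * sgn (length u)) *_) (P-balanced bs lens (λ v′ → F (u ++ v′)))) (*-zeroʳ (- (p₁ (labels u) * sgn (length u)))))

    -- The falling factorial of `n` with `k` factors; `falling n` is (r - 1)!.
    falling : ℕ → ℕ
    falling zero    = 1
    falling (suc k) = (n ∸ k) ℕ.* falling k

    -- The squares are 1 on the injective continuations of `w` and 0 elsewhere. With `k` columns
    -- labelled, `k + 1` labels are in use, counting `w`, so n - k remain for the next column.
    Σf-ε-square : ∀ cs w → length cs ≤ n → Σf cs (λ u → ε (w ∷ labels u) * ε (w ∷ labels u)) ≡ + falling (length cs)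
    Σf-ε-square []       w _  = refl
    Σf-ε-square (c ∷ cs) w le = begin
      sum (λ a → Σf cs (λ u → e (w ∷ a ∷ labels u)))
        ≡⟨ Σf-sum-comm cs (λ a u → e (w ∷ a ∷ labels u)) ⟨
      Σf cs (λ u → sum (λ a → e (w ∷ a ∷ labels u)))
        ≡⟨ Σf-cong cs (λ u p → extend (labels u) (labels-length u p)) ⟩
      Σf cs (λ u → + (n ∸ k) * e (w ∷ labels u))
        ≡⟨ Σf-scale cs (+ (n ∸ k)) (λ u → e (w ∷ labels u)) ⟩
      + (n ∸ k) * Σf cs (λ u → e (w ∷ labels u))
        ≡⟨ cong (+ (n ∸ k) *_) (Σf-ε-square cs w (ℕ.<⇒≤ le)) ⟩
      + (n ∸ k) * + falling k
        ≡⟨ pos-* (n ∸ k) (falling k) ⟨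
      + ((n ∸ k) ℕ.* falling k) ∎
      where
      k = length cs
      e : List Z → ℤ
      e L = ε L * ε L
      move : ∀ a u → e (w ∷ a ∷ u) ≡ sgs a (w ∷ u) * sgs a (w ∷ u) * e (w ∷ u)
      move a u = trans (cong (λ z → z * sgs w u * (sgs a u * ε u) * (z * sgs w u * (sgs a u * ε u))) (sg-antisym w a))
                       (rearrange (sg a w) (sgs w u) (sgs a u) (ε u))
        where
        rearrange : ∀ s p q e → - s * p * (q * e) * (- s * p * (q * e)) ≡ s * q * (s * q) * (p * e * (p * e))
        rearrange = solve-∀
      extend : ∀ u → length u ≡ k → sum (λ a → e (w ∷ a ∷ u)) ≡ + (n ∸ k) * e (w ∷ u)
      extend u len = begin
        sum (λ a → e (w ∷ a ∷ u))                                  ≡⟨ sum-cong-≗ (λ a → move a u) ⟩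
        sum (λ a → sgs a (w ∷ u) * sgs a (w ∷ u) * e (w ∷ u))      ≡⟨ *-distribʳ-sum (e (w ∷ u)) (λ a → sgs a (w ∷ u) * sgs a (w ∷ u)) ⟨
        s * e (w ∷ u)                                              ≡⟨ insert s (+ suc (length u)) (e (w ∷ u)) ⟩
        (s + + suc (length u)) * e (w ∷ u) - + suc (length u) * e (w ∷ u)  ≡⟨ cong (λ z → z - + suc (length u) * e (w ∷ u)) (ε-count (w ∷ u)) ⟩
        + suc n * e (w ∷ u) - + suc (length u) * e (w ∷ u)         ≡⟨ factor (+ suc n) (+ suc (length u)) (e (w ∷ u)) ⟩
        (+ suc n - + suc (length u)) * e (w ∷ u)                   ≡⟨ cong (λ m → (+ suc n - + suc m) * e (w ∷ u)) len ⟩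
        (+ suc n - + suc k) * e (w ∷ u)                            ≡⟨ cong (_* e (w ∷ u)) (trans (m-n≡m⊖n (suc n) (suc k)) (⊖-≥ (s≤s (ℕ.<⇒≤ le)))) ⟩
        + (n ∸ k) * e (w ∷ u)                                      ∎
        where
        s = sum (λ a → sgs a (w ∷ u) * sgs a (w ∷ u))
        insert : ∀ s l e → s * e ≡ (s + l) * e - l * e
        insert = solve-∀
        factor : ∀ a b e → a * e - b * e ≡ (a - b) * e
        factor = solve-∀

    -- Two distinct labels cannot both complete the n labels u to n + 1 distinct ones.
    ε-orthogonal : ∀ w w′ u → length u ≡ n → w′ ≢ w → ε (w′ ∷ u) * ε (w ∷ u) ≡ 0ℤ
    ε-orthogonal w w′ u len w′≢w = begin
      ε (w′ ∷ u) * ε (w ∷ u)                       ≡⟨ *-identityˡ _ ⟨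
      1ℤ * (ε (w′ ∷ u) * ε (w ∷ u))                ≡⟨ cong (_* (ε (w′ ∷ u) * ε (w ∷ u))) (sg-square-≢ w′ w w′≢w) ⟨
      g * g * (ε (w′ ∷ u) * ε (w ∷ u))             ≡⟨ rearrange g (sgs w′ u) (ε u) (ε (w ∷ u)) ⟩
      g * (ε u * ε (w′ ∷ w ∷ u))                   ≡⟨ cong (λ z → g * (ε u * z)) (alternating-pigeonhole {f = ε} ε-alternating (w′ ∷ w ∷ u)
                                                         (s≤s (s≤s (ℕ.≤-reflexive (sym len))))) ⟩
      g * (ε u * 0ℤ)                               ≡⟨ vanish g (ε u) ⟩
      0ℤ                                           ∎
      where
      g = sg w′ w
      rearrange : ∀ g p e q → g * g * (p * e * q) ≡ g * (e * (g * p * q))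
      rearrange = solve-∀
      vanish : ∀ a b → a * (b * 0ℤ) ≡ 0ℤ
      vanish = solve-∀

    -- `p₁` offers every label `w′` as the missing one; by orthogonality only `w′ = w` counts. What
    -- remains are the (r - 1)! orders of the other labels, for every `w` alike.
    block-degree : ∀ b w → length b ≡ n → Σf b (λ u → p₁ (labels u) * ε (w ∷ labels u)) ≡ + falling n
    block-degree b w len = begin
      Σf b (λ u → p₁ (labels u) * ε (w ∷ labels u))
        ≡⟨ Σf-cong b (λ u p → trans (*-distribʳ-sum (ε (w ∷ labels u)) (λ w′ → ε (w′ ∷ labels u)))
             (sum-single (λ w′ → ε (w′ ∷ labels u) * ε (w ∷ labels u)) w
               (λ w′ → ε-orthogonal w w′ (labels u) (trans (labels-length u p) len)))) ⟩
      Σf b (λ u → ε (w ∷ labels u) * ε (w ∷ labels u))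
        ≡⟨ Σf-ε-square b w (ℕ.≤-reflexive len) ⟩
      + falling (length b)
        ≡⟨ cong (λ k → + falling k) len ⟩
      + falling n ∎

    -- The later blocks start at the last label of this block, but their sum does not depend on it.
    -- Hence the pairing is a product over the blocks.
    degree : ∀ bs → All (λ b → length b ≡ n) bs → ∀ x →
             Σf (concat bs) (λ τ → P (length bs) (labels τ) * ω (length bs) (x ∷ labels τ)) ≡ + (falling n ℕ.^ length bs)
    degree []       []           x = refl
    degree (b ∷ bs) (len ∷ lens) x = begin
      Σf (b ++ cs) (λ τ → P (suc ℓ) (labels τ) * ω (suc ℓ) (x ∷ labels τ))
        ≡⟨ Σf-++ b cs _ ⟩
      Σf b (λ u → Σf cs (λ v → P (suc ℓ) (labels (u ++ v)) * ω (suc ℓ) (x ∷ labels (u ++ v))))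
        ≡⟨ Σf-cong b (λ u p → Σf-cong cs (λ v _ → split u v (trans (labels-length u p) len))) ⟩
      Σf b (λ u → Σf cs (λ v → p₁ (labels u) * ε (x ∷ labels u) * (P ℓ (labels v) * ω ℓ (lastFrom x (labels u) ∷ labels v))))
        ≡⟨ Σf-cong b (λ u _ → trans (Σf-scale cs (p₁ (labels u) * ε (x ∷ labels u)) (λ v → P ℓ (labels v) * ω ℓ (lastFrom x (labels u) ∷ labels v)))
             (trans (cong (p₁ (labels u) * ε (x ∷ labels u) *_) (degree bs lens (lastFrom x (labels u)))) (*-comm _ (+ (falling n ℕ.^ ℓ))))) ⟩
      Σf b (λ u → + (falling n ℕ.^ ℓ) * (p₁ (labels u) * ε (x ∷ labels u)))
        ≡⟨ Σf-scale b (+ (falling n ℕ.^ ℓ)) (λ u → p₁ (labels u) * ε (x ∷ labels u)) ⟩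
      + (falling n ℕ.^ ℓ) * Σf b (λ u → p₁ (labels u) * ε (x ∷ labels u))
        ≡⟨ cong (+ (falling n ℕ.^ ℓ) *_) (block-degree b x len) ⟩
      + (falling n ℕ.^ ℓ) * + falling n
        ≡⟨ *-comm (+ (falling n ℕ.^ ℓ)) (+ falling n) ⟩
      + falling n * + (falling n ℕ.^ ℓ)
        ≡⟨ pos-* (falling n) (falling n ℕ.^ ℓ) ⟨
      + (falling n ℕ.* falling n ℕ.^ ℓ) ∎
      where
      cs = concat bs
      ℓ = length bs
      split : ∀ u v → length (labels u) ≡ n → P (suc ℓ) (labels (u ++ v)) * ω (suc ℓ) (x ∷ labels (u ++ v)) ≡
              p₁ (labels u) * ε (x ∷ labels u) * (P ℓ (labels v) * ω ℓ (lastFrom x (labels u) ∷ labels v))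
      split u v len rewrite map-++ proj₂ u v = trans (cong₂ _*_ (P-++ ℓ (labels u) (labels v) len)
        (trans (cong (λ m → cup m ε (ω ℓ) (x ∷ labels u ++ labels v)) (sym len)) (cup-++ ε (ω ℓ) x (labels u) (labels v))))
        (rearrange (p₁ (labels u)) (P ℓ (labels v)) (ε (x ∷ labels u)) _)
        where
        rearrange : ∀ a b c d → a * b * (c * d) ≡ a * c * (b * d)
        rearrange = solve-∀

    falling-coprime : Prime (suc n) → ∀ k → k ≤ n → suc n ∤ falling k
    falling-coprime pr zero    _   d with refl ← ∣1⇒≡1 d = contradiction pr ¬prime[1]
    falling-coprime pr (suc k) k<n d with euclidsLemma (n ∸ k) (falling k) pr d
    ... | inj₁ d′ = ℕ.<⇒≱ (s≤s (ℕ.m∸n≤m n k)) (∣⇒≤ ⦃ ℕ.>-nonZero (ℕ.m<n⇒0<n∸m k<n) ⦄ d′)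
    ... | inj₂ d′ = falling-coprime pr k (ℕ.<⇒≤ k<n) d′

    power-coprime : Prime (suc n) → ∀ {x} → suc n ∤ x → ∀ ℓ → suc n ∤ x ℕ.^ ℓ
    power-coprime pr x∤ zero    d with refl ← ∣1⇒≡1 d = contradiction pr ¬prime[1]
    power-coprime pr {x} x∤ (suc ℓ) d with euclidsLemma x (x ℕ.^ ℓ) pr d
    ... | inj₁ d′ = x∤ d′
    ... | inj₂ d′ = power-coprime pr x∤ ℓ d′

    module Degree (isPrime : Prime (suc n)) (κ : ℤ) (κ-square : κ * κ ≡ 1ℤ) (ε-rot : ∀ (L : List (Fin (suc n))) → length L ≡ suc n → ε (map rot L) ≡ κ * ε L)
                  (bs : List (List C)) (lens : All (λ b → length b ≡ n) bs)
                  (c₀ : C) (cs₀ : List C) (nonempty : concat bs ≡ c₀ ∷ cs₀)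
                  (s : List X → Z) (s-rot : ∀ τ → 0 < length τ → s (map rotX τ) ≡ rot (s τ))
                  (e : C) where

      open Twist κ ε-rot

      ℓ m : ℕ
      ℓ = length bs
      m = length (concat bs)

      m≡ℓ*n : m ≡ ℓ ℕ.* n
      m≡ℓ*n = go bs lens
        where
        go : ∀ bs → All (λ b → length b ≡ n) bs → length (concat bs) ≡ length bs ℕ.* n
        go []       []           = refl
        go (b ∷ bs) (len ∷ lens) = trans (length-++ b) (cong₂ ℕ._+_ len (go bs lens))

      t : List X → Z
      t = headLabel proj₂ zero

      open Prism s t

      Hω : List (List X) → ℤ
      Hω = H (ω ℓ)

      -- The sum over the cone whose apex carries only the label `zero`; rotation is applied to its
      -- base alone.
      total : (List X → Z) → ℤ
      total σ = Σf (concat bs) (λ τ → P ℓ (labels τ) * S (suc m) (λ L → ω ℓ (map σ L)) ((e , zero) ∷ τ))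

      total-head : total t ≡ + (falling n ℕ.^ ℓ)
      total-head = trans
        (Σf-cong (concat bs) (λ τ p → cong (P ℓ (labels τ) *_)
          (S-headLabel proj₂ zero (suc m) {ω ℓ} (ω-normalised ℓ) ((e , zero) ∷ τ) (cong suc (trans (sym (length-map proj₁ τ)) (cong length p))))))
        (degree bs lens zero)

      difference : ∀ τ → S (suc m) (λ L → ω ℓ (map t L)) τ - S (suc m) (λ L → ω ℓ (map s L)) τ ≡ D (S m Hω) τ
      difference τ = begin
        S (suc m) (λ L → ω ℓ (map t L)) τ - S (suc m) (λ L → ω ℓ (map s L)) τ ≡⟨ S-sub (suc m) (λ L → ω ℓ (map t L)) (λ L → ω ℓ (map s L)) τ ⟨
        S (suc m) (λ L → ω ℓ (map t L) - ω ℓ (map s L)) τ                     ≡⟨ S-cong (suc m) τ (λ F → sym (prism F)) ⟩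
        S (suc m) (D Hω) τ                                                    ≡⟨ S-stokes m Hω τ ⟩
        D (S m Hω) τ                                                          ∎
        where
        prism : ∀ {L} → Flag (suc m) τ L → D Hω L ≡ ω ℓ (map t L) - ω ℓ (map s L)
        prism {L} F = begin
          D Hω L                     ≡⟨ +-identityʳ (D Hω L) ⟨
          D Hω L + 0ℤ                ≡⟨ cong (λ z → D Hω L + z) (H-zero L (λ M p → ω-cocycle ℓ M (trans p (cong suc (trans (flag-length F) (cong suc m≡ℓ*n)))))) ⟨
          D Hω L + H (D (ω ℓ)) L     ≡⟨ homotopy (ω ℓ) L ⟩
          ω ℓ (map t L) - ω ℓ (map s L) ∎

      boundary : List X → ℤ
      boundary τ = P ℓ (labels τ) * S m Hω τ

      -- Deleting the apex leaves `boundary`. Deleting a column of the base gives a coboundary,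
      -- against which the weights sum to 0.
      total-difference : total t - total s ≡ Σf (concat bs) boundary
      total-difference = begin
        total t - total s
          ≡⟨ Σf-sub (concat bs) _ _ ⟨
        Σf (concat bs) (λ τ → P ℓ (labels τ) * S (suc m) (λ L → ω ℓ (map t L)) (x ∷ τ) - P ℓ (labels τ) * S (suc m) (λ L → ω ℓ (map s L)) (x ∷ τ))
          ≡⟨ Σf-cong (concat bs) (λ τ _ → trans (factor (P ℓ (labels τ)) _ _) (cong (P ℓ (labels τ) *_) (difference (x ∷ τ)))) ⟩
        Σf (concat bs) (λ τ → P ℓ (labels τ) * (S m Hω τ - D (λ ρ → S m Hω (x ∷ ρ)) τ))
          ≡⟨ Σf-cong (concat bs) (λ τ _ → sym (factor (P ℓ (labels τ)) _ _)) ⟩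
        Σf (concat bs) (λ τ → boundary τ - P ℓ (labels τ) * D (λ ρ → S m Hω (x ∷ ρ)) τ)
          ≡⟨ Σf-sub (concat bs) boundary (λ τ → P ℓ (labels τ) * D (λ ρ → S m Hω (x ∷ ρ)) τ) ⟩
        Σf (concat bs) boundary - Σf (concat bs) (λ τ → P ℓ (labels τ) * D (λ ρ → S m Hω (x ∷ ρ)) τ)
          ≡⟨ cong (λ z → Σf (concat bs) boundary - z) (P-balanced bs lens (λ ρ → S m Hω (x ∷ ρ))) ⟩
        Σf (concat bs) boundary - 0ℤ
          ≡⟨ +-identityʳ (Σf (concat bs) boundary) ⟩
        Σf (concat bs) boundary ∎
        where
        x : X
        x = e , zero
        factor : ∀ a b c → a * b - a * c ≡ a * (b - c)
        factor = solve-∀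

      -- `P` and `Hω` each pick up `κ ^ ℓ`, and the two signs cancel. A flag consists of nonempty
      -- faces, so `s` and `t` are equivariant on all of its entries.
      boundary-rot : ∀ τ → map proj₁ τ ≡ concat bs → boundary (map rotX τ) ≡ boundary τ
      boundary-rot τ p = begin
        P ℓ (labels (map rotX τ)) * S m Hω (map rotX τ)
          ≡⟨ cong₂ _*_ (trans (cong (P ℓ) (labels-rot τ)) (P-rot ℓ (labels τ) len))
                       (trans (sym (S-map m rotX Hω τ)) (trans (S-cong m τ Hω-rot) (S-scale m (κ ^ ℓ) Hω τ))) ⟩
        κ ^ ℓ * P ℓ (labels τ) * (κ ^ ℓ * S m Hω τ)
          ≡⟨ rearrange (κ ^ ℓ) (P ℓ (labels τ)) (S m Hω τ) ⟩
        κ ^ ℓ * κ ^ ℓ * boundary τ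
          ≡⟨ cong (_* boundary τ) (square ℓ) ⟩
        1ℤ * boundary τ
          ≡⟨ *-identityˡ (boundary τ) ⟩
        boundary τ ∎
        where
        rearrange : ∀ k a b → k * a * (k * b) ≡ k * k * (a * b)
        rearrange = solve-∀
        square : ∀ ℓ → κ ^ ℓ * κ ^ ℓ ≡ 1ℤ
        square zero    = refl
        square (suc ℓ) = trans (interchange κ (κ ^ ℓ)) (cong₂ _*_ κ-square (square ℓ))
          where
          interchange : ∀ a b → a * b * (a * b) ≡ a * a * (b * b)
          interchange = solve-∀
        labels-rot : ∀ τ → labels (map rotX τ) ≡ map rot (labels τ)
        labels-rot []      = refl
        labels-rot (x ∷ τ) = cong (_ ∷_) (labels-rot τ)
        len : length (labels τ) ≡ ℓ ℕ.* n
        len = trans (labels-length τ p) m≡ℓ*n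
        t-rot : ∀ τ → 0 < length τ → t (map rotX τ) ≡ rot (t τ)
        t-rot (_ ∷ _) _ = refl
        Hω-rot : ∀ {L} → Flag m τ L → Hω (map (map rotX) L) ≡ κ ^ ℓ * Hω L
        Hω-rot {L} F = begin
          H (ω ℓ) (map (map rotX) L)       ≡⟨ H-map (map rotX) rot (ω ℓ) (All.map (λ {ρ} ne → s-rot ρ ne , t-rot ρ ne) (flag-nonempty F)) ⟩
          H (λ M → ω ℓ (map rot M)) L      ≡⟨ H-cong L (λ M q → ω-rot ℓ M (trans q (cong suc (trans (flag-length F) m≡ℓ*n)))) ⟩
          H (λ M → κ ^ ℓ * ω ℓ M) L        ≡⟨ H-scale (κ ^ ℓ) (ω ℓ) L ⟩
          κ ^ ℓ * H (ω ℓ) L                ∎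

      -- If the sum were 0, then ((r - 1)!)^ℓ would equal the rotation-invariant sum `boundary`,
      -- hence be a multiple of the prime r.
      total-≢0 : total s ≢ 0ℤ
      total-≢0 zero-total with z , eq ← Σf-invariant c₀ cs₀ boundary (λ τ p → boundary-rot τ (trans p (sym nonempty))) =
        power-coprime isPrime (falling-coprime isPrime n ℕ.≤-refl) ℓ (divides ∣ z ∣ (begin
          falling n ℕ.^ ℓ            ≡⟨⟩
          ∣ + (falling n ℕ.^ ℓ) ∣    ≡⟨ cong ∣_∣ total≡ ⟩
          ∣ + suc n * z ∣            ≡⟨ abs-* (+ suc n) z ⟩
          suc n ℕ.* ∣ z ∣            ≡⟨ ℕ.*-comm (suc n) ∣ z ∣ ⟩
          ∣ z ∣ ℕ.* suc n            ∎))
        where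
        total≡ : + (falling n ℕ.^ ℓ) ≡ + suc n * z
        total≡ = begin
          + (falling n ℕ.^ ℓ)             ≡⟨ total-head ⟨
          total t                     ≡⟨ +-identityʳ (total t) ⟨
          total t - 0ℤ                ≡⟨ cong (λ z → total t - z) zero-total ⟨
          total t - total s           ≡⟨ total-difference ⟩
          Σf (concat bs) boundary     ≡⟨ cong (λ cs → Σf cs boundary) nonempty ⟩
          Σf (c₀ ∷ cs₀) boundary      ≡⟨ eq ⟩
          + suc n * z                 ∎

-- A Tucker lemma for the join: an equivariant sign needs as many values as a flag has faces.

module AlternatingFlags where

  open Cochains
  open Signatures
  open Degrees
  open import Data.Empty using (⊥)
  open import Data.Fin using (Fin; zero; suc; _≟_)
  open import Data.Integer as ℤ using (ℤ; +_; 0ℤ; 1ℤ; -1ℤ; _*_)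
  open import Data.Integer.Properties using (*-zeroʳ; *-identityˡ)
  open import Data.List using (List; []; _∷_; _++_; map; length; concat)
  open import Data.List.Properties using (length-map; map-++; ∷-injective)
  open import Data.List.Relation.Unary.All using (All; []; _∷_)
  import Data.List.Relation.Unary.All as All
  open import Data.List.Relation.Unary.All.Properties using (++⁺)
  open import Data.List.Relation.Unary.AllPairs using (AllPairs; []; _∷_)
  open import Data.Nat as ℕ using (ℕ; zero; suc; s≤s; z≤n; _<_; _≤_)
  import Data.Nat.Properties as ℕ
  open import Data.Nat.Divisibility using (divides)
  open import Data.Nat.Primality using (Prime; prime⇒irreducible)
  open import Data.Product using (_×_; _,_; proj₁; proj₂; ∃; ∃₂)
  open import Data.Sum using (_⊎_; inj₁; inj₂)
  open import Relation.Binary.PropositionalEquality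
  open import Relation.Nullary using (yes; no; contradiction)

  half : ∀ n → ∃ λ h → n ≡ 2 ℕ.* h ⊎ n ≡ suc (2 ℕ.* h)
  half zero = 0 , inj₁ refl
  half (suc n) with half n
  ... | h , inj₁ eq = h , inj₂ (cong suc eq)
  ... | h , inj₂ eq = suc h , inj₁ (trans (cong suc eq) (cong suc (sym (ℕ.+-suc h (h ℕ.+ 0)))))

  -- Rotation changes the sign of ε only in the case of the prime 2.
  ε-rot : ∀ n → Prime (suc n) →
          ∃ λ κ → κ * κ ≡ 1ℤ × (∀ (L : List (Fin (suc n))) → length L ≡ suc n → ε (map rot L) ≡ κ * ε L)
  ε-rot n isPrime with half n
  ... | h , inj₁ refl = 1ℤ , refl , λ L len → trans (ε-rot-even h L len) (sym (*-identityˡ (ε L)))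
  ... | h , inj₂ refl with prime⇒irreducible isPrime {2} (divides (suc h) (trans (sym (ℕ.*-suc 2 h)) (ℕ.*-comm 2 (suc h))))
  ...   | inj₂ eq with refl ← ℕ.*-cancelˡ-≡ h 0 2 (sym (ℕ.suc-injective (ℕ.suc-injective eq))) = -1ℤ , refl , ε-rot-two

  ε-tail : ∀ {n} (w : Fin n) u → ε (w ∷ u) ≢ 0ℤ → ε u ≢ 0ℤ
  ε-tail w u ne eq = ne (trans (cong (sgs w u *_) eq) (*-zeroʳ (sgs w u)))

  ε-≢0⇒distinct : ∀ {n} (L : List (Fin n)) → ε L ≢ 0ℤ → AllPairs _≢_ L
  ε-≢0⇒distinct []      _  = []
  ε-≢0⇒distinct (x ∷ L) ne = sgs-≢0 L (λ eq → ne (cong (_* ε L) eq)) ∷ ε-≢0⇒distinct L (ε-tail x L ne)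
    where
    sgs-≢0 : ∀ M → sgs x M ≢ 0ℤ → All (x ≢_) M
    sgs-≢0 []      _  = []
    sgs-≢0 (y ∷ M) ne = (λ { refl → ne (cong (_* sgs x M) (sg-diag x)) })
                      ∷ sgs-≢0 M (λ eq → ne (trans (cong (sg x y *_) eq) (*-zeroʳ (sg x y))))

  module NoLabelling (n : ℕ) (C : Set) where

    open Faces n C

    p₁-≢0⇒distinct : ∀ u → p₁ u ≢ 0ℤ → AllPairs _≢_ u
    p₁-≢0⇒distinct u ne = ε-≢0⇒distinct u (λ eq → ne (sum-zero (λ w → trans (cong (sgs w u *_) eq) (*-zeroʳ (sgs w u)))))

    unappend : ∀ (b : List C) {cs} (τ : List X) → map proj₁ τ ≡ b ++ cs →
               ∃₂ λ u v → τ ≡ u ++ v × map proj₁ u ≡ b × map proj₁ v ≡ cs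
    unappend []      τ       eq = [] , τ , refl , refl , eq
    unappend (c ∷ b) (x ∷ τ) eq with u , v , refl , equ , eqv ← unappend b τ (proj₂ (∷-injective eq)) =
      x ∷ u , v , refl , cong₂ _∷_ (proj₁ (∷-injective eq)) equ , eqv

    module _ (R : X → X → Set) where

      Same Cross : C → C → Set
      Same  c d = ∀ i j → i ≢ j → R (c , i) (d , j)
      Cross c d = ∀ i j → R (c , i) (d , j)

      -- A repeated label in a block makes `ε`, hence the weight, vanish, and columns of different
      -- blocks are compatible under any labels. So the sums over all labellings see valid top faces
      -- only.
      P-≢0⇒AllPairs : ∀ bs → All (λ b → length b ≡ n) bs → All (AllPairs Same) bs →
                      AllPairs (λ b b′ → All (λ c → All (Cross c) b′) b) bs →
                      ∀ τ → map proj₁ τ ≡ concat bs → P (length bs) (labels τ) ≢ 0ℤ → AllPairs R τ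
      P-≢0⇒AllPairs []       []           []             []               []    _  _  = []
      P-≢0⇒AllPairs (b ∷ bs) (len ∷ lens) (same ∷ sames) (cross ∷ crosses) τ eq ne
        with u , v , refl , equ , eqv ← unappend b τ eq = append u v
          (block u b equ same (p₁-≢0⇒distinct (labels u) (λ z → ne′ (cong (_* P (length bs) (labels v)) z))))
          (P-≢0⇒AllPairs bs lens sames crosses v eqv (λ z → ne′ (trans (cong (p₁ (labels u) *_) z) (*-zeroʳ (p₁ (labels u))))))
          (across u b equ (All.map (λ {c} → flatten c v bs eqv) (transpose cross)))
        where
        ne′ : p₁ (labels u) * P (length bs) (labels v) ≢ 0ℤ
        ne′ z = ne (trans (cong (P (suc (length bs))) (map-++ proj₂ u v))
          (trans (P-++ (length bs) (labels u) (labels v) (trans (labels-length u equ) len)) z))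
        row : ∀ {c i} (u : List X) b → map proj₁ u ≡ b → All (Same c) b → All (i ≢_) (labels u) → All (R (c , i)) u
        row []            []      _    []       []       = []
        row ((d , j) ∷ u) (_ ∷ b) refl (q ∷ qs) (r ∷ rs) = q _ j r ∷ row u b refl qs rs
        block : ∀ u b → map proj₁ u ≡ b → AllPairs Same b → AllPairs _≢_ (labels u) → AllPairs R u
        block []            []      _    []       []       = []
        block ((c , i) ∷ u) (_ ∷ b) refl (q ∷ qs) (r ∷ rs) = row u b refl q r ∷ block u b refl qs rs
        transpose : ∀ {b bs} → All (λ b′ → All (λ c → All (Cross c) b′) b) bs → All (λ c → All (All (Cross c)) bs) b
        transpose {[]}          _  = []
        transpose {c ∷ b} {bs} qs = All.map All.head qs ∷ transpose (All.map All.tail qs)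
        flatten : ∀ c v bs → map proj₁ v ≡ concat bs → All (All (Cross c)) bs → ∀ i → All (R (c , i)) v
        flatten c v bs eqv qs i = label v (concat bs) eqv (glue qs)
          where
          glue : ∀ {bs} → All (All (Cross c)) bs → All (Cross c) (concat bs)
          glue []       = []
          glue (q ∷ qs) = ++⁺ q (glue qs)
          label : ∀ v ds → map proj₁ v ≡ ds → All (Cross c) ds → All (R (c , i)) v
          label []            []      _    []       = []
          label ((d , j) ∷ v) (_ ∷ _) refl (q ∷ qs) = q i j ∷ label v _ refl qs
        across : ∀ {v} u b → map proj₁ u ≡ b → All (λ c → ∀ i → All (R (c , i)) v) b → All (λ x → All (R x) v) u
        across []            []      _    []       = []
        across ((c , i) ∷ u) (_ ∷ _) refl (q ∷ qs) = q i ∷ across u _ refl qs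
        append : ∀ u v → AllPairs R u → AllPairs R v → All (λ x → All (R x) v) u → AllPairs R (u ++ v)
        append []      v []       rv []       = rv
        append (x ∷ u) v (r ∷ rs) rv (q ∷ qs) = ++⁺ r q ∷ append u v rs rv qs

    uncons : ∀ {cs : List C} → 0 < length cs → ∃₂ λ c cs′ → cs ≡ c ∷ cs′
    uncons {c ∷ cs} _ = c , cs , refl

    module _ (isPrime : Prime (suc n)) (bs : List (List C)) (lens : All (λ b → length b ≡ n) bs)
             (nonempty : 0 < length (concat bs)) (e : C)
             (s : List X → Z) (s-rot : ∀ τ → 0 < length τ → s (map rotX τ) ≡ rot (s τ))
             (Valid : List X → Set) (valid-⋖ : ∀ {ρ τ} → ρ ⋖ τ → Valid τ → Valid ρ)
             (P-valid : ∀ τ → map proj₁ τ ≡ concat bs → P (length bs) (labels τ) ≢ 0ℤ → Valid ((e , zero) ∷ τ))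
             (v : List X → ℕ) (v-pos : ∀ τ → Valid τ → 0 < length τ → 0 < v τ)
             (v-mono : ∀ {ρ τ} → ρ ⋖ τ → Valid τ → 0 < length ρ → v ρ ≤ v τ × (v ρ ≡ v τ → s ρ ≡ s τ))
             (v-bound : ∀ τ → map proj₁ τ ≡ concat bs → Valid ((e , zero) ∷ τ) → v ((e , zero) ∷ τ) ≤ length (concat bs)) where

      -- A flag of k + 1 faces with at most k values repeats a value, hence a sign, at consecutive faces.
      S-vanish : ∀ k {g : List Z → ℤ} → Normalised g → ∀ τ → Valid τ → length τ ≡ suc k → v τ ≤ k →
                 S (suc k) (λ L → g (map s L)) τ ≡ 0ℤ
      S-vanish zero    norm τ valid len le = contradiction (v-pos τ valid (ℕ.≤-reflexive (sym len))) (ℕ.≤⇒≯ le)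
      S-vanish (suc k) {g} norm τ valid len le = D-zero τ below
        where
        below : ∀ {ρ} → ρ ⋖ τ → S (suc k) (λ L → g (map s (τ ∷ L))) ρ ≡ 0ℤ
        below {ρ} d with len′ ← ℕ.suc-injective (trans (⋖-length d) len) | v ρ ℕ.≟ v τ
        ... | yes eq = S-zero (suc k) {λ L → g (map s (τ ∷ L))} ρ λ { (_∷_ {L = L} _ _) →
                trans (cong (λ a → g (s τ ∷ a ∷ map s L)) (proj₂ (v-mono d valid (ℕ.≤-trans (s≤s z≤n) (ℕ.≤-reflexive (sym len′)))) eq)) (norm [] (s τ) (map s L)) }
        ... | no neq = S-vanish k {λ M → g (s τ ∷ M)} (λ pre → norm (s τ ∷ pre)) ρ (valid-⋖ d valid) len′
                (ℕ.≤-pred (ℕ.≤-trans (ℕ.≤∧≢⇒< (proj₁ (v-mono d valid (ℕ.≤-trans (s≤s z≤n) (ℕ.≤-reflexive (sym len′))))) neq) le))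

      -- By `S-vanish` every top face of nonzero weight contributes 0 to `total s`, contrary to
      -- `total-≢0`.
      no-labelling : ⊥
      no-labelling with c , cs , nonempty-eq ← uncons nonempty | κ , κ-square , rotκ ← ε-rot n isPrime =
        total-≢0 (Σf-zero (concat bs) vanish)
        where
        open Degree isPrime κ κ-square rotκ bs lens c cs nonempty-eq s s-rot e
        vanish : ∀ τ → map proj₁ τ ≡ concat bs → P ℓ (labels τ) * S (suc m) (λ L → ω ℓ (map s L)) ((e , zero) ∷ τ) ≡ 0ℤ
        vanish τ eq with P ℓ (labels τ) ℤ.≟ 0ℤ
        ... | yes z = cong (_* S (suc m) (λ L → ω ℓ (map s L)) ((e , zero) ∷ τ)) z
        ... | no nz = trans (cong (P ℓ (labels τ) *_)
                (S-vanish m {ω ℓ} (ω-normalised ℓ) ((e , zero) ∷ τ) (P-valid τ eq nz) (cong suc (trans (sym (length-map proj₁ τ)) (cong length eq))) (v-bound τ eq (P-valid τ eq nz))))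
                (*-zeroʳ (P ℓ (labels τ)))

-- Counting in finite sets, and barycentres of subsets of ℤ/r.

module Subsets where

  open Signatures using (rot; rot-fromℕ; rot-inject₁)
  open import Data.Bool using (Bool; true; false)
  open import Data.Fin using (Fin; zero; suc; toℕ; fromℕ; fromℕ<; inject₁; punchOut)
  open import Data.Fin.Properties using (any?; toℕ<n; toℕ-injective; toℕ-fromℕ; toℕ-inject₁; toℕ-fromℕ<; suc-injective; punchOut-injective; <⇒notInjective)
  open import Data.Fin.Relation.Unary.Top using (view; ‵fromℕ; ‵inj₁)
  open import Data.Fin.Subset using (Subset; _∈_; _∉_; _⊆_; ∣_∣; Nonempty)
  open import Data.Fin.Subset.Properties
  open import Data.Nat using (ℕ; NonZero; >-nonZero; zero; suc; _+_; _*_; _∸_; _≤_; _<_; z≤n; s≤s)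
  open import Data.Nat.Properties hiding (suc-injective)
  open import Data.Nat.DivMod
  open import Data.Nat.Divisibility using (_∣_; divides; ∣⇒≤)
  open import Data.Nat.Primality using (Prime; euclidsLemma)
  open import Data.Product using (_×_; _,_; proj₁; proj₂; ∃)
  open import Data.Sum using (inj₁; inj₂)
  open import Data.Vec using ([]; _∷_; lookup; tabulate; here; there)
  open import Data.Vec.Properties using (lookup∘tabulate; []=⇒lookup; lookup⇒[]=)
  open import Function using (_∘_)
  open import Relation.Binary.PropositionalEquality
  open import Relation.Nullary using (Dec; does; yes; no; contradiction)
  open import Relation.Nullary.Decidable using (dec-true; _×-dec_)
  open import Algebra.Properties.CommutativeMonoid.Sum +-0-commutativeMonoid
    using (sum; sum-cong-≗; ∑-comm; ∑-distrib-+; sum-init-last)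
  open import Algebra.Properties.Semiring.Sum +-*-semiring using (*-distribʳ-sum)

  private variable
    m n : ℕ

  bit : Bool → ℕ
  bit true  = 1
  bit false = 0

  card-sum : (U : Subset n) → ∣ U ∣ ≡ sum (λ x → bit (lookup U x))
  card-sum []          = refl
  card-sum (true  ∷ U) = cong suc (card-sum U)
  card-sum (false ∷ U) = card-sum U

  sum-mono : ∀ {f g : Fin n → ℕ} → (∀ i → f i ≤ g i) → sum f ≤ sum g
  sum-mono {zero}  le = z≤n
  sum-mono {suc n} le = +-mono-≤ (le zero) (sum-mono (le ∘ suc))

  +-≤-≡ : ∀ {a b c d} → a ≤ c → b ≤ d → a + b ≡ c + d → a ≡ c × b ≡ d
  +-≤-≡ {a} {b} {c} {d} a≤c b≤d eq = a≡c , +-cancelˡ-≡ a b d (trans eq (cong (_+ d) (sym a≡c)))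
    where
    a≡c : a ≡ c
    a≡c = ≤-antisym a≤c (≮⇒≥ (λ a<c → <-irrefl eq (+-mono-<-≤ a<c b≤d)))

  sum-≡⇒≗ : ∀ {f g : Fin n → ℕ} → (∀ i → f i ≤ g i) → sum f ≡ sum g → ∀ i → f i ≡ g i
  sum-≡⇒≗ le eq zero    = proj₁ (+-≤-≡ (le zero) (sum-mono (le ∘ suc)) eq)
  sum-≡⇒≗ le eq (suc i) = sum-≡⇒≗ (le ∘ suc) (proj₂ (+-≤-≡ (le zero) (sum-mono (le ∘ suc)) eq)) i

  ≤-sum : ∀ (f : Fin n → ℕ) i → f i ≤ sum f
  ≤-sum f zero    = m≤m+n (f zero) _
  ≤-sum f (suc i) = ≤-trans (≤-sum (f ∘ suc) i) (m≤n+m _ (f zero))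

  sum-≤-* : ∀ (f : Fin n → ℕ) c → (∀ i → f i ≤ c) → sum f ≤ n * c
  sum-≤-* {zero}  f c le = z≤n
  sum-≤-* {suc n} f c le = +-mono-≤ (le zero) (sum-≤-* (f ∘ suc) c (le ∘ suc))

  sum-ge-* : ∀ (f : Fin n → ℕ) c → (∀ i → c ≤ f i) → n * c ≤ sum f
  sum-ge-* {zero}  f c le = z≤n
  sum-ge-* {suc n} f c le = +-mono-≤ (le zero) (sum-ge-* (f ∘ suc) c (le ∘ suc))

  ⊆∧∣∣≡⇒≡ : ∀ {U V : Subset n} → U ⊆ V → ∣ U ∣ ≡ ∣ V ∣ → U ≡ V
  ⊆∧∣∣≡⇒≡ {U = U} {V} U⊆V eq = ⊆-antisym U⊆V V⊆U
    where
    V⊆U : V ⊆ U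
    V⊆U {x} x∈V with x ∈? U
    ... | yes x∈U = x∈U
    ... | no  x∉U = contradiction (p⊂q⇒∣p∣<∣q∣ (U⊆V , x , x∈V , x∉U)) (<-irrefl eq)

  module _ {P : Fin n → Set} (P? : ∀ x → Dec (P x)) where

    tabulate-does⁻ : ∀ {x} → x ∈ tabulate (does ∘ P?) → P x
    tabulate-does⁻ {x} x∈ with P? x | trans (sym (lookup∘tabulate (does ∘ P?) x)) ([]=⇒lookup x∈)
    ... | yes px | _ = px

    tabulate-does⁺ : ∀ {x} → P x → x ∈ tabulate (does ∘ P?)
    tabulate-does⁺ {x} px = lookup⇒[]= x _ (trans (lookup∘tabulate (does ∘ P?) x) (dec-true (P? x) px))

    abstract

      comprehension : Subset n
      comprehension = tabulate (does ∘ P?)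

      lookup-comprehension : ∀ x → lookup comprehension x ≡ does (P? x)
      lookup-comprehension = lookup∘tabulate (does ∘ P?)

      comprehension⁺ : ∀ {x} → P x → x ∈ comprehension
      comprehension⁺ = tabulate-does⁺

      comprehension⁻ : ∀ {x} → x ∈ comprehension → P x
      comprehension⁻ = tabulate-does⁻

  bit-∈ : ∀ {x} {U : Subset n} → x ∈ U → bit (lookup U x) ≡ 1
  bit-∈ x∈U = cong bit ([]=⇒lookup x∈U)

  bit-∉ : ∀ {x} {U : Subset n} → x ∉ U → bit (lookup U x) ≡ 0
  bit-∉ {x = x} {U} x∉U with lookup U x in eq
  ... | true  = contradiction (lookup⇒[]= x U eq) x∉U
  ... | false = refl

  union-bound : ∀ (M : Subset n) (F : Fin m → Subset n) → (∀ {x} → x ∈ M → ∃ λ j → x ∈ F j) →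
                ∣ M ∣ ≤ sum (λ j → ∣ F j ∣)
  union-bound M F cover = begin
    ∣ M ∣                                        ≡⟨ card-sum M ⟩
    sum (λ x → bit (lookup M x))                 ≤⟨ sum-mono pointwise ⟩
    sum (λ x → sum (λ j → bit (lookup (F j) x))) ≡⟨ ∑-comm (λ x j → bit (lookup (F j) x)) ⟩
    sum (λ j → sum (λ x → bit (lookup (F j) x))) ≡⟨ sum-cong-≗ (λ j → card-sum (F j)) ⟨
    sum (λ j → ∣ F j ∣)                          ∎
    where
    open ≤-Reasoning
    pointwise : ∀ x → bit (lookup M x) ≤ sum (λ j → bit (lookup (F j) x))
    pointwise x with x ∈? M
    ... | no  x∉M = ≤-trans (≤-reflexive (bit-∉ x∉M)) z≤n
    ... | yes x∈M with j , x∈Fj ← cover x∈M =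
      ≤-trans (≤-reflexive (trans (bit-∈ x∈M) (sym (bit-∈ x∈Fj)))) (≤-sum (λ j → bit (lookup (F j) x)) j)

  disjoint-bound : ∀ (A : Subset n) (F : Fin m → Subset n) → (∀ j → F j ⊆ A) →
                   (∀ {x i j} → x ∈ F i → x ∈ F j → i ≡ j) → sum (λ j → ∣ F j ∣) ≤ ∣ A ∣
  disjoint-bound {m = m} A F sub disj = begin
    sum (λ j → ∣ F j ∣)                          ≡⟨ sum-cong-≗ (λ j → card-sum (F j)) ⟩
    sum (λ j → sum (λ x → bit (lookup (F j) x))) ≡⟨ ∑-comm (λ j x → bit (lookup (F j) x)) ⟩
    sum (λ x → sum (λ j → bit (lookup (F j) x))) ≤⟨ sum-mono pointwise ⟩
    sum (λ x → bit (lookup A x))                 ≡⟨ card-sum A ⟨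
    ∣ A ∣                                        ∎
    where
    open ≤-Reasoning
    at-most : ∀ {m} (f : Fin m → Bool) → (∀ {i j} → f i ≡ true → f j ≡ true → i ≡ j) → sum (bit ∘ f) ≤ 1
    at-most {zero}  f uniq = z≤n
    at-most {suc m} f uniq with f zero in eq
    ... | true  = ≤-reflexive (cong suc (n≤0⇒n≡0 (≤-trans (sum-≤-* (bit ∘ f ∘ suc) 0 none) (≤-reflexive (*-zeroʳ m)))))
      where
      none : ∀ i → bit (f (suc i)) ≤ 0
      none i with f (suc i) in eq′
      ... | true  = contradiction (uniq eq eq′) λ ()
      ... | false = z≤n
    ... | false = at-most (f ∘ suc) (λ p q → suc-injective (uniq p q))
    pointwise : ∀ x → sum (λ j → bit (lookup (F j) x)) ≤ bit (lookup A x)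
    pointwise x with x ∈? A
    ... | yes x∈A = ≤-trans (at-most (λ j → lookup (F j) x) (λ p q → disj (lookup⇒[]= x _ p) (lookup⇒[]= x _ q)))
                            (≤-reflexive (sym (bit-∈ x∈A)))
    ... | no  x∉A = ≤-trans (sum-≤-* (λ j → bit (lookup (F j) x)) 0 (λ j → ≤-reflexive (bit-∉ (λ x∈ → x∉A (sub j x∈)))))
                            (≤-trans (≤-reflexive (*-zeroʳ m)) z≤n)

  interpolate : ∀ (B U : Subset n) k → B ⊆ U → ∣ B ∣ ≤ k → k ≤ ∣ U ∣ → ∃ λ V → B ⊆ V × V ⊆ U × ∣ V ∣ ≡ k
  interpolate []          []          zero    B⊆U lo hi = [] , (λ x → x) , (λ x → x) , refl
  interpolate (true ∷ B)  (false ∷ U) k       B⊆U lo hi = contradiction (B⊆U here) λ ()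
  interpolate (true ∷ B)  (true ∷ U)  (suc k) B⊆U (s≤s lo) (s≤s hi)
    with V , B⊆V , V⊆U , eq ← interpolate B U k (drop-∷-⊆ B⊆U) lo hi = true ∷ V , s⊆s B⊆V , s⊆s V⊆U , cong suc eq
  interpolate (false ∷ B) (false ∷ U) k       B⊆U lo hi
    with V , B⊆V , V⊆U , eq ← interpolate B U k (drop-∷-⊆ B⊆U) lo hi = false ∷ V , s⊆s B⊆V , s⊆s V⊆U , eq
  interpolate (false ∷ B) (true ∷ U)  k       B⊆U lo hi with m≤n⇒m<n∨m≡n hi
  ... | inj₂ eq = true ∷ U , B⊆U , (λ x → x) , sym eq
  ... | inj₁ (s≤s hi′)
    with V , B⊆V , V⊆U , eq ← interpolate B U k (drop-∷-⊆ B⊆U) lo hi′ = false ∷ V , s⊆s B⊆V , out⊆ V⊆U , eq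

  interval-card : ∀ (V : Subset n) lo t → (∀ {x} → x ∈ V → lo ≤ toℕ x × toℕ x < lo + t) → ∣ V ∣ ≤ t
  interval-card []          lo       t       _ = z≤n
  interval-card (true ∷ V)  (suc lo) t       h = contradiction (proj₁ (h here)) λ ()
  interval-card (false ∷ V) (suc lo) t       h = interval-card V lo t (λ x∈ → ≤-pred (proj₁ (h (there x∈))) , ≤-pred (proj₂ (h (there x∈))))
  interval-card (true ∷ V)  zero     zero    h = contradiction (proj₂ (h here)) λ ()
  interval-card (true ∷ V)  zero     (suc t) h = s≤s (interval-card V zero t (λ x∈ → z≤n , ≤-pred (proj₂ (h (there x∈)))))
  interval-card (false ∷ V) zero     zero    h = interval-card V zero zero (λ x∈ → contradiction (proj₂ (h (there x∈))) λ ())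
  interval-card (false ∷ V) zero     (suc t) h = m≤n⇒m≤1+n (interval-card V zero t (λ x∈ → z≤n , ≤-pred (proj₂ (h (there x∈)))))

  least : ∀ (V : Subset n) → Nonempty V → ∃ λ x → x ∈ V × (∀ {y} → y ∈ V → toℕ x ≤ toℕ y)
  least (true ∷ V)  _ = zero , here , λ _ → z≤n
  least (false ∷ V) (suc x , there x∈) with y , y∈ , min ← least V (x , x∈) = suc y , there y∈ , λ { (there z∈) → s≤s (min z∈) }

  greatest : ∀ (V : Subset n) → Nonempty V → ∃ λ x → x ∈ V × (∀ {y} → y ∈ V → toℕ y ≤ toℕ x)
  greatest (b ∷ V) ne with nonempty? V
  ... | yes ne′ with y , y∈ , max ← greatest V ne′ = suc y , there y∈ , λ { here → z≤n ; (there z∈) → s≤s (max z∈) }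
  greatest (true ∷ V)  ne                 | no empty = zero , here , λ { here → z≤n ; (there z∈) → contradiction (_ , z∈) empty }
  greatest (false ∷ V) (suc x , there x∈) | no empty = contradiction (x , x∈) empty

  0<∣∣⇒nonempty : ∀ (M : Subset n) → 0 < ∣ M ∣ → Nonempty M
  0<∣∣⇒nonempty {n} M lt with nonempty? M
  ... | yes ne    = ne
  ... | no  empty = contradiction (subst (λ V → 0 < ∣ V ∣) (Empty-unique empty) lt) (≤⇒≯ (≤-reflexive (∣⊥∣≡0 n)))

  module _ {P : Fin (suc n) → Set} (P? : ∀ x → Dec (P x)) where

    -- The default `zero` is not equivariant, so every argument about a chosen element goes through
    -- `choose-unique`.
    choose : Fin (suc n)
    choose with any? P?
    ... | yes (i , _) = i
    ... | no  _       = zero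

    choose-unique : ∀ {i} → P i → (∀ {j} → P j → j ≡ i) → choose ≡ i
    choose-unique {i} pi uniq with any? P?
    ... | yes (j , pj) = uniq pj
    ... | no  none     = contradiction (i , pi) none

  rot-surjective : ∀ (i : Fin (suc n)) → ∃ λ j → rot j ≡ i
  rot-surjective zero    = fromℕ _ , rot-fromℕ _
  rot-surjective (suc i) = inject₁ i , rot-inject₁ i

  -- The carry of `rot`. It turns a rotation into an equation between natural numbers, to be reduced
  -- modulo r afterwards.
  top : Fin (suc n) → ℕ
  top i with view i
  ... | ‵fromℕ  = 1
  ... | ‵inj₁ _ = 0

  toℕ-rot : ∀ (i : Fin (suc n)) → toℕ (rot i) + top i * suc n ≡ suc (toℕ i)
  toℕ-rot {n} i with view i
  ... | ‵fromℕ          = trans (+-identityʳ (suc n)) (cong suc (sym (toℕ-fromℕ n)))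
  ... | ‵inj₁ {i = j} _ = trans (+-identityʳ _) (cong suc (sym (toℕ-inject₁ j)))

  *-toℕ-rot : ∀ c (i : Fin (suc n)) → c * toℕ (rot i) + c * top i * suc n ≡ c * toℕ i + c
  *-toℕ-rot {n} c i = begin
    c * toℕ (rot i) + c * top i * suc n   ≡⟨ cong (c * toℕ (rot i) +_) (*-assoc c (top i) (suc n)) ⟩
    c * toℕ (rot i) + c * (top i * suc n) ≡⟨ *-distribˡ-+ c (toℕ (rot i)) (top i * suc n) ⟨
    c * (toℕ (rot i) + top i * suc n)     ≡⟨ cong (c *_) (toℕ-rot i) ⟩
    c * suc (toℕ i)                       ≡⟨ *-suc c (toℕ i) ⟩
    c + c * toℕ i                         ≡⟨ +-comm c _ ⟩
    c * toℕ i + c                         ∎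
    where open ≡-Reasoning

  rot-injective : ∀ {i j : Fin (suc n)} → rot i ≡ rot j → i ≡ j
  rot-injective {n} {i} {j} eq with view i | view j
  ... | ‵fromℕ  | ‵fromℕ  = refl
  ... | ‵inj₁ _ | ‵inj₁ _ = cong inject₁ (suc-injective eq)

  sum-rot-ℕ : ∀ (f : Fin (suc n) → ℕ) → sum (f ∘ rot) ≡ sum f
  sum-rot-ℕ {n} f = trans (sum-init-last (f ∘ rot))
    (trans (cong₂ _+_ (sum-cong-≗ (λ i → cong f (rot-inject₁ i))) (cong f (rot-fromℕ n))) (+-comm _ (f zero)))

  Rotated : Subset (suc n) → Subset (suc n) → Set
  Rotated U V = ∀ j → lookup V (rot j) ≡ lookup U j

  rotated-card : ∀ {U V : Subset (suc n)} → Rotated U V → ∣ V ∣ ≡ ∣ U ∣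
  rotated-card {U = U} {V} rel = trans (card-sum V) (trans (sym (sum-rot-ℕ (bit ∘ lookup V)))
    (trans (sum-cong-≗ (λ j → cong bit (rel j))) (sym (card-sum U))))

  %-≡⇒∣∸ : ∀ a b r {{_ : NonZero r}} → a ≤ b → a % r ≡ b % r → r ∣ b ∸ a
  %-≡⇒∣∸ a b r a≤b eq = divides (b / r ∸ a / r) (begin
    b ∸ a                                               ≡⟨ cong₂ _∸_ (m≡m%n+[m/n]*n b r) (m≡m%n+[m/n]*n a r) ⟩
    (b % r + b / r * r) ∸ (a % r + a / r * r)           ≡⟨ cong (λ z → (z + b / r * r) ∸ (a % r + a / r * r)) eq ⟨
    (a % r + b / r * r) ∸ (a % r + a / r * r)           ≡⟨ [m+n]∸[m+o]≡n∸o (a % r) (b / r * r) (a / r * r) ⟩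
    b / r * r ∸ a / r * r                               ≡⟨ *-distribʳ-∸ r (b / r) (a / r) ⟨
    (b / r ∸ a / r) * r                                 ∎)
    where open ≡-Reasoning

  -- For a prime r and a proper nonempty U ⊆ ℤ/r, the barycentre of U is the
  -- unique b with ∣U∣ b = Σ U; it is an equivariant choice of an element of ℤ/r.
  module Barycentre (q : ℕ) (isPrime : Prime (suc q)) where

    private
      r = suc q

    mass : Subset r → ℕ
    mass U = sum (λ u → bit (lookup U u) * toℕ u)

    IsBarycentre : Subset r → Fin r → Set
    IsBarycentre U b = (∣ U ∣ * toℕ b) % r ≡ mass U % r

    isBarycentre? : ∀ U b → Dec (IsBarycentre U b)
    isBarycentre? U b = (∣ U ∣ * toℕ b) % r ≟ mass U % r

    barycentre : Subset r → Fin r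
    barycentre U = choose (isBarycentre? U)

    Proper : Subset r → Set
    Proper U = 0 < ∣ U ∣ × ∣ U ∣ < r

    proper? : ∀ U → Dec (Proper U)
    proper? U = (0 <? ∣ U ∣) ×-dec (∣ U ∣ <? r)

    -- As a prime, r would divide `c` or the difference of `b′` and `b`; both are smaller than r, so
    -- the difference is 0.
    multiple-injective-≤ : ∀ {c} → 0 < c → c < r → ∀ (b b′ : Fin r) → toℕ b ≤ toℕ b′ →
                           (c * toℕ b) % r ≡ (c * toℕ b′) % r → b ≡ b′
    multiple-injective-≤ {c} 0<c c<r b b′ le eq with euclidsLemma c (toℕ b′ ∸ toℕ b) isPrime
        (subst (r ∣_) (sym (*-distribˡ-∸ c (toℕ b′) (toℕ b))) (%-≡⇒∣∸ (c * toℕ b) (c * toℕ b′) r (*-monoʳ-≤ c le) eq))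
    ... | inj₁ d = contradiction (∣⇒≤ {{>-nonZero 0<c}} d) (<⇒≱ c<r)
    ... | inj₂ d with m≤n⇒m<n∨m≡n le
    ...   | inj₂ b≡b′ = toℕ-injective b≡b′
    ...   | inj₁ b<b′ = contradiction (∣⇒≤ {{>-nonZero (m<n⇒0<n∸m b<b′)}} d) (<⇒≱ (≤-<-trans (m∸n≤m (toℕ b′) (toℕ b)) (toℕ<n b′)))

    multiple-injective : ∀ {c} → 0 < c → c < r → ∀ (b b′ : Fin r) → (c * toℕ b) % r ≡ (c * toℕ b′) % r → b ≡ b′
    multiple-injective {c} 0<c c<r b b′ eq with ≤-total (toℕ b) (toℕ b′)
    ... | inj₁ le = multiple-injective-≤ 0<c c<r b b′ le eq
    ... | inj₂ le = sym (multiple-injective-≤ 0<c c<r b′ b le (sym eq))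

    -- Multiplication by `∣ U ∣` is injective on residues. If it missed the residue of the mass,
    -- `punchOut` would inject r residues into r - 1.
    barycentre-exists : ∀ {U} → Proper U → ∃ (IsBarycentre U)
    barycentre-exists {U} (0<c , c<r) with any? (isBarycentre? U)
    ... | yes found = found
    ... | no  none  = contradiction (λ {i} {j} → inj {i} {j}) (<⇒notInjective {f = λ b → punchOut (avoid b)} ≤-refl)
      where
      residue : Fin r → Fin r
      residue b = fromℕ< (m%n<n (∣ U ∣ * toℕ b) r)
      target : Fin r
      target = fromℕ< (m%n<n (mass U) r)
      avoid : ∀ b → target ≢ residue b
      avoid b eq = none (b , trans (sym (toℕ-fromℕ< _)) (trans (cong toℕ (sym eq)) (toℕ-fromℕ< _)))
      inj : ∀ {b b′} → punchOut (avoid b) ≡ punchOut (avoid b′) → b ≡ b′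
      inj {b} {b′} eq = multiple-injective 0<c c<r b b′
        (trans (sym (toℕ-fromℕ< _)) (trans (cong toℕ (punchOut-injective (avoid b) (avoid b′) eq)) (toℕ-fromℕ< _)))

    mass-rot : ∀ {U V} → Rotated U V → ∃ λ k → mass V + k * r ≡ mass U + ∣ U ∣
    mass-rot {U} {V} rel = sum (λ u → bit (lookup U u) * top u) , (begin
      mass V + sum (λ u → bit (lookup U u) * top u) * r
        ≡⟨ cong₂ _+_ (trans (sym (sum-rot-ℕ (λ u → bit (lookup V u) * toℕ u))) (sum-cong-≗ (λ u → cong (λ z → bit z * toℕ (rot u)) (rel u))))
                     (*-distribʳ-sum r (λ u → bit (lookup U u) * top u)) ⟩
      sum (λ u → bit (lookup U u) * toℕ (rot u)) + sum (λ u → bit (lookup U u) * top u * r)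
        ≡⟨ ∑-distrib-+ (λ u → bit (lookup U u) * toℕ (rot u)) (λ u → bit (lookup U u) * top u * r) ⟨
      sum (λ u → bit (lookup U u) * toℕ (rot u) + bit (lookup U u) * top u * r)
        ≡⟨ sum-cong-≗ (λ u → *-toℕ-rot (bit (lookup U u)) u) ⟩
      sum (λ u → bit (lookup U u) * toℕ u + bit (lookup U u))
        ≡⟨ ∑-distrib-+ (λ u → bit (lookup U u) * toℕ u) (λ u → bit (lookup U u)) ⟩
      mass U + sum (λ u → bit (lookup U u))
        ≡⟨ cong (mass U +_) (card-sum U) ⟨
      mass U + ∣ U ∣ ∎)
      where
      open ≡-Reasoning

    -- Shifting the elements of `U` by 1 adds `∣ U ∣` to the mass modulo r, and shifting `b` adds as
    -- much to `∣ U ∣` times `b`.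
    isBarycentre-rot : ∀ {U V b} → Rotated U V → IsBarycentre U b → IsBarycentre V (rot b)
    isBarycentre-rot {U} {V} {b} rel eq with k , mass-eq ← mass-rot {U} {V} rel = begin
      (∣ V ∣ * toℕ (rot b)) % r                    ≡⟨ cong (λ c → (c * toℕ (rot b)) % r) (rotated-card {U = U} {V} rel) ⟩
      (c * toℕ (rot b)) % r                        ≡⟨ [m+kn]%n≡m%n (c * toℕ (rot b)) (c * top b) r ⟨
      (c * toℕ (rot b) + c * top b * r) % r        ≡⟨ cong (_% r) (*-toℕ-rot c b) ⟩
      (c * toℕ b + c) % r                          ≡⟨ %-distribˡ-+ (c * toℕ b) c r ⟩
      ((c * toℕ b) % r + c % r) % r                ≡⟨ cong (λ z → (z + c % r) % r) eq ⟩
      (mass U % r + c % r) % r                     ≡⟨ %-distribˡ-+ (mass U) c r ⟨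
      (mass U + c) % r                             ≡⟨ cong (_% r) mass-eq ⟨
      (mass V + k * r) % r                         ≡⟨ [m+kn]%n≡m%n (mass V) k r ⟩
      mass V % r                                   ∎
      where
      open ≡-Reasoning
      c = ∣ U ∣

    barycentre-rot : ∀ {U V} → Proper U → Rotated U V → barycentre V ≡ rot (barycentre U)
    barycentre-rot {U} {V} proper rel with b , isB ← barycentre-exists {U} proper =
      trans (choose-unique (isBarycentre? V) (isBarycentre-rot {U} {V} {b} rel isB) (λ {b′} isB′ → unique V properV b′ (rot b) isB′ (isBarycentre-rot {U} {V} {b} rel isB)))
            (cong rot (sym (choose-unique (isBarycentre? U) isB (λ {b′} isB′ → unique U proper b′ b isB′ isB))))
      where
      properV : Proper V
      properV = subst (λ c → 0 < c × c < r) (sym (rotated-card {U = U} {V} rel)) proper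
      unique : ∀ W → Proper W → ∀ b b′ → IsBarycentre W b → IsBarycentre W b′ → b ≡ b′
      unique W (0<c , c<r) b b′ p q = multiple-injective 0<c c<r b b′ (trans p (sym q))

-- Values and signs of families of disjoint sets indexed by ℤ/r.

module Families where

  open import Defs
  open Signatures using (rot)
  open Subsets
  open import Data.Bool.Properties using (T-∧; T-≡)
  open import Data.Fin using (Fin; zero; suc; toℕ; _≟_)
  import Data.Fin as Fin
  open import Data.Fin.Properties using (any?; all?; <-cmp; ¬∀⟶∃¬; toℕ-injective) renaming (_<?_ to _<ᶠ?_; _≤?_ to _≤ᶠ?_)
  open import Data.Fin.Subset using (Subset; _∈_; _∉_; _⊆_; ∣_∣; ⊤; ⊥; ⁅_⁆; _∩_; _∪_; Nonempty; Empty)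
  open import Data.Fin.Subset.Properties
  open import Data.List as List using (List; []; _∷_; _++_)
  open import Data.List.Properties using (tabulate-cong)
  open import Data.List.Relation.Binary.Pointwise as Pw using (Pointwise; []; _∷_)
  open import Data.List.Relation.Unary.All as All using (All; []; _∷_)
  import Data.List.Relation.Unary.All.Properties as All
  open import Data.List.Relation.Unary.Any as Any using (Any; here; there)
  import Data.List.Relation.Unary.Any.Properties as Any
  open import Data.Nat using (ℕ; zero; suc; _+_; _*_; _⊓_; _≤_; _<_; z≤n; s≤s; _<?_; _≤?_)
  open import Data.Nat.Properties hiding (<-cmp; _≟_; _≤?_; _<?_)
  import Data.Nat.Properties as ℕ
  open import Data.Nat.Primality using (Prime)
  open import Data.Product using (_×_; _,_; proj₁; proj₂; ∃; ∃₂)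
  open import Data.Sum using (inj₁; inj₂; [_,_]′)
  open import Data.Vec.Properties using (lookup∘tabulate; []=⇒lookup)
  open import Function using (_∘_; Equivalence)
  open import Relation.Binary.Definitions using (tri<; tri≈; tri>)
  open import Relation.Binary.PropositionalEquality
  open import Relation.Nullary using (Dec; does; yes; no; ¬_; contradiction)
  open import Relation.Nullary.Decidable using (_×-dec_; _→-dec_; ¬?; map′)
  open import Algebra.Properties.CommutativeMonoid.Sum +-0-commutativeMonoid using (sum)

  window⁻ : ∀ {n} i t {x : Fin n} → x ∈ window n i t → i ≤ toℕ x × toℕ x < i + t
  window⁻ i t {x} x∈ with Equivalence.to T-∧ (Equivalence.from T-≡ (trans (sym (lookup∘tabulate _ x)) ([]=⇒lookup x∈)))
  ... | lo , hi = ≤ᵇ⇒≤ i (toℕ x) lo , <ᵇ⇒< (toℕ x) (i + t) hi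

  ∣∣≤1 : ∀ {n} (V : Subset n) → (∀ {x y} → x ∈ V → y ∈ V → x ≡ y) → ∣ V ∣ ≤ 1
  ∣∣≤1 {n} V uniq with nonempty? V
  ... | no empty = subst (λ W → ∣ W ∣ ≤ 1) (sym (Empty-unique empty)) (≤-trans (≤-reflexive (∣⊥∣≡0 n)) z≤n)
  ... | yes (x , x∈V) = ≤-trans (p⊆q⇒∣p∣≤∣q∣ V⊆⁅x⁆) (≤-reflexive (∣⁅x⁆∣≡1 x))
    where
    V⊆⁅x⁆ : V ⊆ ⁅ x ⁆
    V⊆⁅x⁆ y∈V with refl ← uniq y∈V x∈V = x∈⁅x⁆ x

  ∈⇒0<∣∣ : ∀ {n} {V : Subset n} {x} → x ∈ V → 0 < ∣ V ∣
  ∈⇒0<∣∣ {V = V} {x} x∈V = ≤-trans (≤-reflexive (sym (∣⁅x⁆∣≡1 x))) (p⊆q⇒∣p∣≤∣q∣ (λ y∈ → subst (_∈ V) (sym (x∈⁅y⁆⇒x≡y x y∈)) x∈V))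

  ∣insert∣ : ∀ {n} {V W : Subset n} {x} → V ⊆ W → x ∈ W → x ∉ V → suc ∣ V ∣ ≤ ∣ V ∪ ⁅ x ⁆ ∣ × V ∪ ⁅ x ⁆ ⊆ W
  ∣insert∣ {V = V} {W} {x} V⊆W x∈W x∉V =
    p⊂q⇒∣p∣<∣q∣ (p⊆p∪q ⁅ x ⁆ , x , q⊆p∪q V ⁅ x ⁆ (x∈⁅x⁆ x) , x∉V) , λ {y} → sub {y}
    where
    sub : V ∪ ⁅ x ⁆ ⊆ W
    sub y∈ with x∈p∪q⁻ V ⁅ x ⁆ y∈
    ... | inj₁ y∈V = V⊆W y∈V
    ... | inj₂ y∈x = subst (_∈ W) (sym (x∈⁅y⁆⇒x≡y x y∈x)) x∈W

  squeeze : ∀ {n} {V W : Subset n} {x z} → x ∉ V → z ∉ V → x ≢ z → V ⊆ W → x ∈ W → z ∈ W → 2 + ∣ V ∣ ≤ ∣ W ∣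
  squeeze {V = V} {W} {x} {z} x∉V z∉V x≢z V⊆W x∈W z∈W
    with le , sub ← ∣insert∣ {V = V} {W} {x} V⊆W x∈W x∉V
    with le′ , sub′ ← ∣insert∣ {V = V ∪ ⁅ x ⁆} {W} {z} sub z∈W (λ z∈ → [ z∉V , (λ z∈x → x≢z (sym (x∈⁅y⁆⇒x≡y x z∈x))) ]′ (x∈p∪q⁻ V ⁅ x ⁆ z∈))
    = ≤-trans (s≤s le) (≤-trans le′ (p⊆q⇒∣p∣≤∣q∣ sub′))

  pair-⊆ : ∀ {n} {U : Subset n} {x z} → x ∈ U → z ∈ U → ⁅ x ⁆ ∪ ⁅ z ⁆ ⊆ U
  pair-⊆ {U = U} {x} {z} x∈U z∈U y∈ with x∈p∪q⁻ ⁅ x ⁆ ⁅ z ⁆ y∈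
  ... | inj₁ y∈x = subst (_∈ U) (sym (x∈⁅y⁆⇒x≡y x y∈x)) x∈U
  ... | inj₂ y∈z = subst (_∈ U) (sym (x∈⁅y⁆⇒x≡y z y∈z)) z∈U

  ∣pair∣≤2 : ∀ {n} (x z : Fin n) → ∣ ⁅ x ⁆ ∪ ⁅ z ⁆ ∣ ≤ 2
  ∣pair∣≤2 {n} x z = ≤-trans (union-bound (⁅ x ⁆ ∪ ⁅ z ⁆) pair cover) (≤-reflexive (cong₂ (λ a b → a + (b + 0)) (∣⁅x⁆∣≡1 x) (∣⁅x⁆∣≡1 z)))
    where
    pair : Fin 2 → Subset n
    pair zero    = ⁅ x ⁆
    pair (suc _) = ⁅ z ⁆
    cover : ∀ {y} → y ∈ ⁅ x ⁆ ∪ ⁅ z ⁆ → ∃ λ i → y ∈ pair i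
    cover y∈ with x∈p∪q⁻ ⁅ x ⁆ ⁅ z ⁆ y∈
    ... | inj₁ y∈x = zero , y∈x
    ... | inj₂ y∈z = suc zero , y∈z

  module Labelling (q n k₃ t m ℓ : ℕ) (isPrime : Prime (suc q)) (p : Fin n → Fin ℓ)
                   (t-bound : t ≤ suc q * k₃ + 2)
                   (c : Subset n → Fin m) (isColouring : IsColouring n (3 + k₃) t p (suc q) m c) where

    open Barycentre q isPrime

    -- `α` is r(k - 1) in the shape of its use: at most r from `signs`, at most r from `late`, and
    -- among more than r(k - 3) elements of `middle` some label has more than k - 3.
    r k α : ℕ
    r = suc q
    k = 3 + k₃
    α = r + r + r * k₃

    Family : Set
    Family = Fin r → Subset n

    Passed Reached Coming : Family → Fin n → Set
    Passed  F y = ∀ i → ∃ λ x → x Fin.< y × x ∈ F i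
    Reached F y = ∀ i → ∃ λ x → x Fin.≤ y × x ∈ F i
    Coming  F y = ∀ i → ∃ λ z → y Fin.< z × z ∈ F i

    passed? : ∀ F y → Dec (Passed F y)
    passed? F y = all? (λ i → any? (λ x → (x <ᶠ? y) ×-dec (x ∈? F i)))

    reached? : ∀ F y → Dec (Reached F y)
    reached? F y = all? (λ i → any? (λ x → (x ≤ᶠ? y) ×-dec (x ∈? F i)))

    coming? : ∀ F y → Dec (Coming F y)
    coming? F y = all? (λ i → any? (λ z → (y <ᶠ? z) ×-dec (z ∈? F i)))

    twide? : ∀ σ → Dec (TWide n t σ)
    twide? σ = map′ (λ h i le → h {i} (s≤s (m+n≤o⇒m≤o i le)) le) (λ h {i} _ → h i)
                    (allUpTo? (λ i → (i + t ≤? n) →-dec ¬? (σ ⊆? window n i t)) (suc n))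

    vertex? : ∀ σ → Dec (IsVertex n k t p σ)
    vertex? σ = (∣ σ ∣ ℕ.≟ k) ×-dec (twide? σ ×-dec all? (λ b → ∣ σ ∩ block p b ∣ ≤? 1))

    Late : Family → Fin r → Set
    Late F j = ∃ λ y → y ∈ F j × Passed F y

    late? : ∀ F j → Dec (Late F j)
    late? F j = any? (λ y → (y ∈? F j) ×-dec passed? F y)

    Middle : Family → Fin n → Set
    Middle F y = (∃ λ j → y ∈ F j) × Passed F y × Coming F y

    middle? : ∀ F y → Dec (Middle F y)
    middle? F y = any? (λ j → y ∈? F j) ×-dec (passed? F y ×-dec coming? F y)

    Coloured : Family → Fin m → Fin r → Set
    Coloured F a j = ∃ λ σ → σ ⊆ F j × IsVertex n k t p σ × c σ ≡ a

    coloured? : ∀ F a j → Dec (Coloured F a j)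
    coloured? F a j = anySubset? (λ σ → (σ ⊆? F j) ×-dec (vertex? σ ×-dec (c σ ≟ a)))

    -- The sets S, T, M and U_a are `signs`, `late`, `middle` and `coloured`.
    signs late : Family → Subset r
    signs F = comprehension (λ j → nonempty? (F j))
    late  F = comprehension (late? F)

    middle : Family → Subset n
    middle F = comprehension (middle? F)

    coloured : Family → Fin m → Subset r
    coloured F a = comprehension (coloured? F a)

    width : Family → ℕ
    width F = ∣ signs F ∣ + ∣ late F ∣ + ∣ middle F ∣

    value : Family → ℕ
    value F = α ⊓ width F + sum (λ a → ∣ coloured F a ∣)

    -- At a critical element the last missing label occurs for the first time.
    Critical : Family → Fin n → Fin r → Set
    Critical F y j = y ∈ F j × Reached F y × ¬ Passed F y

    critical? : ∀ F j → Dec (∃ λ y → Critical F y j)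
    critical? F j = any? (λ y → (y ∈? F j) ×-dec (reached? F y ×-dec ¬? (passed? F y)))

    critical : Family → Fin r
    critical F = choose (critical? F)

    pick : List (Subset r) → Fin r → Fin r
    pick []       d = d
    pick (U ∷ Us) d with proper? U
    ... | yes _ = barycentre U
    ... | no  _ = pick Us d

    colours : Family → List (Subset r)
    colours F = List.tabulate (coloured F)

    -- The colours come first: once a vertex exists, the width may exceed `α`, so that equal values
    -- no longer control `signs`, `late` and `middle` but still control the coloured sets.
    stages : Family → List (Subset r)
    stages F = colours F ++ signs F ∷ late F ∷ []

    sign : Family → Fin r
    sign F = pick (stages F) (critical F)

    pick-++ : ∀ {Us Vs Ws d d′} → Any Proper Us → pick (Us ++ Vs) d ≡ pick (Us ++ Ws) d′
    pick-++ {U ∷ Us} any with proper? U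
    pick-++ {U ∷ Us} any         | yes _ = refl
    pick-++ {U ∷ Us} (here px)   | no ¬p = contradiction px ¬p
    pick-++ {U ∷ Us} {Vs} {Ws} (there any) | no _ = pick-++ {Us} {Vs} {Ws} any

    pick-default : ∀ {d d′} Us → (All (¬_ ∘ Proper) Us → d ≡ d′) → pick Us d ≡ pick Us d′
    pick-default []       eq = eq []
    pick-default (U ∷ Us) eq with proper? U
    ... | yes _ = refl
    ... | no ¬p = pick-default Us (λ all → eq (¬p ∷ all))

    pick-rot : ∀ {Us Vs d d′} → Pointwise Rotated Us Vs → (All (¬_ ∘ Proper) Us → d′ ≡ rot d) → pick Vs d′ ≡ rot (pick Us d)
    pick-rot []                       eq = eq []
    pick-rot {U ∷ _} {V ∷ _} (rel ∷ rels) eq with proper? U | proper? V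
    ... | yes pU | yes _  = barycentre-rot {U} {V} pU rel
    ... | no ¬pU | no _   = pick-rot rels (λ all → eq (¬pU ∷ all))
    ... | yes pU | no ¬pV = contradiction (subst (λ c → 0 < c × c < r) (sym (rotated-card {U = U} {V} rel)) pU) ¬pV
    ... | no ¬pU | yes pV = contradiction (subst (λ c → 0 < c × c < r) (rotated-card {U = U} {V} rel) pV) ¬pU

    infix 4 _≼_
    _≼_ : Family → Family → Set
    F ≼ G = ∀ j → F j ⊆ G j

    Disjoint Transversal Inhabited : Family → Set
    Disjoint    F = ∀ {x i j} → x ∈ F i → x ∈ F j → i ≡ j
    Transversal F = ∀ {x y j} → x ∈ F j → y ∈ F j → p x ≡ p y → x ≡ y
    Inhabited   F = ∃ λ j → Nonempty (F j)

    module _ {F G : Family} (F≼G : F ≼ G) where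

      passed-mono : ∀ {y} → Passed F y → Passed G y
      passed-mono h i with x , x<y , x∈ ← h i = x , x<y , F≼G i x∈

      reached-mono : ∀ {y} → Reached F y → Reached G y
      reached-mono h i with x , x≤y , x∈ ← h i = x , x≤y , F≼G i x∈

      signs-mono : signs F ⊆ signs G
      signs-mono {j} j∈ with x , x∈ ← comprehension⁻ (λ j → nonempty? (F j)) j∈ = comprehension⁺ (λ j → nonempty? (G j)) (x , F≼G j x∈)

      late-mono : late F ⊆ late G
      late-mono {j} j∈ with y , y∈ , h ← comprehension⁻ (late? F) j∈ = comprehension⁺ (late? G) (y , F≼G j y∈ , passed-mono h)

      middle-mono : middle F ⊆ middle G
      middle-mono {y} y∈ with (j , y∈j) , h , h′ ← comprehension⁻ (middle? F) y∈ =
        comprehension⁺ (middle? G) ((j , F≼G j y∈j) , passed-mono h , λ i → let z , y<z , z∈ = h′ i in z , y<z , F≼G i z∈)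

      coloured-mono : ∀ a → coloured F a ⊆ coloured G a
      coloured-mono a {j} j∈ with σ , sub , rest ← comprehension⁻ (coloured? F a) j∈ = comprehension⁺ (coloured? G a) (σ , (λ x∈ → F≼G j (sub x∈)) , rest)

      width-mono : width F ≤ width G
      width-mono = +-mono-≤ (+-mono-≤ (p⊆q⇒∣p∣≤∣q∣ signs-mono) (p⊆q⇒∣p∣≤∣q∣ late-mono)) (p⊆q⇒∣p∣≤∣q∣ middle-mono)

      coloured-sum-mono : sum (λ a → ∣ coloured F a ∣) ≤ sum (λ a → ∣ coloured G a ∣)
      coloured-sum-mono = sum-mono (λ a → p⊆q⇒∣p∣≤∣q∣ (coloured-mono a))

      value-mono : value F ≤ value G
      value-mono = +-mono-≤ (⊓-monoʳ-≤ α width-mono) coloured-sum-mono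

    full-signs : ∀ {F} → Inhabited F → ¬ Proper (signs F) → ∀ j → Nonempty (F j)
    full-signs {F} (i , ne) ¬proper j = comprehension⁻ (λ j → nonempty? (F j)) (subst (j ∈_) (sym full) ∈⊤)
      where
      full : signs F ≡ ⊤
      full = ∣p∣≡n⇒p≡⊤ (≤-antisym (∣p∣≤n (signs F)) (≮⇒≥ (λ lt → ¬proper (∈⇒0<∣∣ (comprehension⁺ (λ j → nonempty? (F j)) {i} ne) , lt))))

    reached-somewhere : ∀ {F} → (∀ j → Nonempty (F j)) → Nonempty (comprehension (reached? F))
    reached-somewhere {F} ne with y , _ , max ← greatest ⊤ (proj₁ (ne zero) , ∈⊤) =
      y , comprehension⁺ (reached? F) (λ i → proj₁ (ne i) , max ∈⊤ , proj₂ (ne i))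

    passed⇒reached-earlier : ∀ {F y} → Passed F y → ∃ λ y′ → y′ Fin.< y × Reached F y′
    passed⇒reached-earlier {F} {y} passed with x₀ , x₀<y , _ ← passed zero
      with y′ , y′∈ , max ← greatest (comprehension (λ x → x <ᶠ? y)) (x₀ , comprehension⁺ (λ x → x <ᶠ? y) x₀<y) =
      y′ , comprehension⁻ (λ x → x <ᶠ? y) y′∈ , λ i → let x , x<y , x∈ = passed i in x , max (comprehension⁺ (λ x → x <ᶠ? y) x<y) , x∈

    abstract

      -- Take the least reached element. Were it passed, the last element before it would already be
      -- reached; so some label occurs there for the first time.
      critical-exists : ∀ {F} → (∀ j → Nonempty (F j)) → ∃₂ (Critical F)
      critical-exists {F} ne
        with y , y∈ , min ← least (comprehension (reached? F)) (reached-somewhere ne)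
        with reached ← comprehension⁻ (reached? F) y∈
        with passed? F y
      ... | yes passed with y′ , y′<y , h ← passed⇒reached-earlier passed = contradiction (min (comprehension⁺ (reached? F) h)) (<⇒≱ y′<y)
      ... | no ¬passed with i , none ← ¬∀⟶∃¬ r _ (λ i → any? (λ x → (x <ᶠ? y) ×-dec (x ∈? F i))) ¬passed
        with x , x≤y , x∈ ← reached i
        with m≤n⇒m<n∨m≡n x≤y
      ... | inj₁ x<y = contradiction (x , x<y , x∈) none
      ... | inj₂ eq  = y , i , subst (_∈ F i) (toℕ-injective eq) x∈ , reached , ¬passed

    -- An element after a reached one is passed, so two critical elements coincide.
    critical-unique : ∀ {F y y′ j j′} → Disjoint F → Critical F y j → Critical F y′ j′ → j ≡ j′
    critical-unique {F} {y} {y′} disj (y∈ , reached , ¬passed) (y′∈ , reached′ , ¬passed′) with <-cmp y y′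
    ... | tri< y<y′ _ _ = contradiction (λ i → let x , x≤y , x∈ = reached i in x , ≤-<-trans x≤y y<y′ , x∈) ¬passed′
    ... | tri≈ _ refl _ = disj y∈ y′∈
    ... | tri> _ _ y′<y = contradiction (λ i → let x , x≤y′ , x∈ = reached′ i in x , ≤-<-trans x≤y′ y′<y , x∈) ¬passed

    critical-≡ : ∀ {F y j} → Disjoint F → Critical F y j → critical F ≡ j
    critical-≡ {F} disj crit = choose-unique (critical? F) (_ , crit) (λ { (_ , crit′) → critical-unique disj crit′ crit })

    -- The ends `x` and `z` complete the k - 2 elements of `M ∩ U` to a vertex. Wideness comes from
    -- `M` and not from the size of σ: a window with both ends contains all of `M`, hence more than
    -- r k₃ + 2 ≥ t elements.
    vertex-between : ∀ {U M : Subset n} {x z} → (∀ {u v} → u ∈ U → v ∈ U → p u ≡ p v → u ≡ v) →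
                     x ∈ U → z ∈ U → (∀ {y} → y ∈ M → toℕ x < toℕ y) → (∀ {y} → y ∈ M → toℕ y < toℕ z) → toℕ x < toℕ z →
                     r * k₃ < ∣ M ∣ → k₃ < ∣ M ∩ U ∣ → ∃ λ σ → σ ⊆ U × IsVertex n k t p σ
    vertex-between {U} {M} {x} {z} trans-U x∈U z∈U x<M M<z x<z M-large M∩U-large
      = finish (interpolate (⁅ x ⁆ ∪ ⁅ z ⁆) U k (pair-⊆ x∈U z∈U) (≤-trans (∣pair∣≤2 x z) (s≤s (s≤s z≤n)))
          (≤-trans (s≤s (s≤s M∩U-large)) (squeeze (λ x∈ → x∉M (p∩q⊆p M U x∈)) (λ z∈ → z∉M (p∩q⊆p M U z∈)) x≢z (p∩q⊆q M U) x∈U z∈U)))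
      where
      x∉M : x ∉ M
      x∉M x∈M = <-irrefl refl (x<M x∈M)
      z∉M : z ∉ M
      z∉M z∈M = <-irrefl refl (M<z z∈M)
      x≢z : x ≢ z
      x≢z refl = <-irrefl refl x<z
      transversal : ∀ σ → σ ⊆ U → ∀ b {u v} → u ∈ σ ∩ block p b → v ∈ σ ∩ block p b → u ≡ v
      transversal σ σ⊆U b u∈ v∈ with uσ , ub ← x∈p∩q⁻ σ (block p b) u∈ | vσ , vb ← x∈p∩q⁻ σ (block p b) v∈ =
        trans-U (σ⊆U uσ) (σ⊆U vσ) (trans (tabulate-does⁻ (λ y → p y ≟ b) ub) (sym (tabulate-does⁻ (λ y → p y ≟ b) vb)))
      twide : ∀ σ → ⁅ x ⁆ ∪ ⁅ z ⁆ ⊆ σ → TWide n t σ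
      twide σ ends⊆σ i _ σ⊆W = contradiction (≤-trans (interval-card span i t inside-window) t-bound) (<⇒≱ too-large)
        where
        x∈W : i ≤ toℕ x × toℕ x < i + t
        x∈W = window⁻ i t (σ⊆W (ends⊆σ (p⊆p∪q ⁅ z ⁆ (x∈⁅x⁆ x))))
        z∈W : i ≤ toℕ z × toℕ z < i + t
        z∈W = window⁻ i t (σ⊆W (ends⊆σ (q⊆p∪q ⁅ x ⁆ ⁅ z ⁆ (x∈⁅x⁆ z))))
        span : Subset n
        span = M ∪ (⁅ x ⁆ ∪ ⁅ z ⁆)
        inside-window : ∀ {y} → y ∈ span → i ≤ toℕ y × toℕ y < i + t
        inside-window y∈ with x∈p∪q⁻ M (⁅ x ⁆ ∪ ⁅ z ⁆) y∈
        ... | inj₁ y∈M = ≤-trans (proj₁ x∈W) (<⇒≤ (x<M y∈M)) , <-trans (M<z y∈M) (proj₂ z∈W)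
        ... | inj₂ y∈′ with x∈p∪q⁻ ⁅ x ⁆ ⁅ z ⁆ y∈′
        ...   | inj₁ y∈x = subst (λ y → i ≤ toℕ y × toℕ y < i + t) (sym (x∈⁅y⁆⇒x≡y x y∈x)) x∈W
        ...   | inj₂ y∈z = subst (λ y → i ≤ toℕ y × toℕ y < i + t) (sym (x∈⁅y⁆⇒x≡y z y∈z)) z∈W
        too-large : r * k₃ + 2 < ∣ span ∣
        too-large = <-≤-trans (≤-<-trans (≤-reflexive (+-comm (r * k₃) 2)) (+-monoʳ-< 2 M-large))
          (squeeze x∉M z∉M x≢z (p⊆p∪q (⁅ x ⁆ ∪ ⁅ z ⁆)) (q⊆p∪q M _ (p⊆p∪q ⁅ z ⁆ (x∈⁅x⁆ x))) (q⊆p∪q M _ (q⊆p∪q ⁅ x ⁆ ⁅ z ⁆ (x∈⁅x⁆ z))))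
      finish : (∃ λ σ → ⁅ x ⁆ ∪ ⁅ z ⁆ ⊆ σ × σ ⊆ U × ∣ σ ∣ ≡ k) → ∃ λ σ → σ ⊆ U × IsVertex n k t p σ
      finish (σ , ends⊆σ , σ⊆U , ∣σ∣≡k) = σ , σ⊆U , ∣σ∣≡k , twide σ ends⊆σ , λ b → ∣∣≤1 (σ ∩ block p b) (transversal σ σ⊆U b)

    frequent : ∀ (M : Subset n) (F : Family) → (∀ {x} → x ∈ M → ∃ λ j → x ∈ F j) → r * k₃ < ∣ M ∣ → ∃ λ j → k₃ < ∣ M ∩ F j ∣
    frequent M F cover M-large with any? (λ j → k₃ <? ∣ M ∩ F j ∣)
    ... | yes found = found
    ... | no  none  = contradiction
      (≤-trans (union-bound M (λ j → M ∩ F j) (λ x∈ → let j , x∈j = cover x∈ in j , x∈p∩q⁺ (x∈ , x∈j)))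
               (sum-≤-* (λ j → ∣ M ∩ F j ∣) k₃ (λ j → ≮⇒≥ (λ lt → none (j , lt))))) (<⇒≱ M-large)

    -- The middle part is squeezed between an x and a z of every sign, so the
    -- sign occurring most often in it carries a vertex spanning all of it.
    abstract

      wide⇒vertex : ∀ {F} → Transversal F → α < width F → ∃₂ λ j σ → σ ⊆ F j × IsVertex n k t p σ
      wide⇒vertex {F} trans-F lt = core (middle F) (comprehension⁻ (middle? F))
        (+-cancelˡ-< (r + r) _ _ (<-≤-trans lt (+-monoˡ-≤ ∣ middle F ∣ (+-mono-≤ (∣p∣≤n (signs F)) (∣p∣≤n (late F))))))
        where
        core : ∀ M → (∀ {y} → y ∈ M → Middle F y) → r * k₃ < ∣ M ∣ → ∃₂ λ j σ → σ ⊆ F j × IsVertex n k t p σ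
        core M M⁻ M-large
          with j , M∩Fj-large ← frequent M F (λ y∈ → proj₁ (M⁻ y∈)) M-large
          with y₁ , y₁∈ , min ← least M (0<∣∣⇒nonempty M (≤-<-trans z≤n M-large))
          with y₂ , y₂∈ , max ← greatest M (0<∣∣⇒nonempty M (≤-<-trans z≤n M-large))
          with x , x<y₁ , x∈ ← proj₁ (proj₂ (M⁻ y₁∈)) j
          with z , y₂<z , z∈ ← proj₂ (proj₂ (M⁻ y₂∈)) j
          = j , vertex-between trans-F x∈ z∈ (λ y∈ → <-≤-trans x<y₁ (min y∈)) (λ y∈ → ≤-<-trans (max y∈) y₂<z)
                  (<-trans x<y₁ (≤-<-trans (max y₁∈) y₂<z)) M-large M∩Fj-large

    wide⇒coloured : ∀ {F} → Transversal F → α < width F → ∃ λ a → Nonempty (coloured F a)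
    wide⇒coloured {F} trans-F lt with j , σ , σ⊆ , vertex ← wide⇒vertex {F} trans-F lt =
      c σ , j , comprehension⁺ (coloured? F (c σ)) (σ , σ⊆ , vertex , refl)

    -- Here the colouring enters: vertices of colour `a` in all r disjoint parts would form a
    -- monochromatic hyperedge.
    coloured-proper : ∀ {F} → Disjoint F → ∀ a → ∣ coloured F a ∣ ≤ q
    coloured-proper {F} disj a = ≤-pred (≤∧≢⇒< (∣p∣≤n (coloured F a)) not-full)
      where
      not-full : ∣ coloured F a ∣ ≢ r
      not-full eq = isColouring (λ j → proj₁ (all-coloured j))
        ((λ j → proj₁ (proj₂ (proj₂ (all-coloured j)))) , λ i j i≢j → Empty-unique (λ { (x , x∈) →
           let x∈i , x∈j = x∈p∩q⁻ _ _ x∈ in i≢j (disj (proj₁ (proj₂ (all-coloured i)) x∈i) (proj₁ (proj₂ (all-coloured j)) x∈j)) }))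
        (a , λ j → proj₂ (proj₂ (proj₂ (all-coloured j))))
        where
        all-coloured : ∀ j → Coloured F a j
        all-coloured j = comprehension⁻ (coloured? F a) (subst (j ∈_) (sym (∣p∣≡n⇒p≡⊤ eq)) ∈⊤)

    value-bound : ∀ {F} → Disjoint F → value F ≤ α + m * q
    value-bound {F} disj = +-mono-≤ (m⊓n≤m α (width F)) (sum-≤-* (λ a → ∣ coloured F a ∣) q (coloured-proper {F} disj))

    value-pos : ∀ {F} → Inhabited F → 0 < value F
    value-pos {F} (j , ne) = <-≤-trans (⊓-glb (s≤s z≤n) (≤-trans (≤-trans (∈⇒0<∣∣ (comprehension⁺ (λ j → nonempty? (F j)) {j} ne)) (m≤m+n _ ∣ late F ∣)) (m≤m+n _ ∣ middle F ∣)))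
                                       (m≤m+n _ _)

    -- Both summands of the value are monotone, so each stays equal. If a coloured set is nonempty,
    -- it is proper and a coloured stage decides. Otherwise `wide⇒coloured` shows that the
    -- truncation at `α` is idle; then the width agrees term by term, and only the critical label is
    -- left to compare.
    sign-constant : ∀ {F G} → F ≼ G → Inhabited F → Disjoint G → Transversal G → value F ≡ value G → sign F ≡ sign G
    sign-constant {F} {G} F≼G inhabited disj trans-G eq = result
      where
      parts : α ⊓ width F ≡ α ⊓ width G × sum (λ a → ∣ coloured F a ∣) ≡ sum (λ a → ∣ coloured G a ∣)
      parts = +-≤-≡ (⊓-monoʳ-≤ α (width-mono {F} {G} F≼G)) (coloured-sum-mono {F} {G} F≼G) eq
      coloured-≡ : ∀ a → coloured F a ≡ coloured G a
      coloured-≡ a = ⊆∧∣∣≡⇒≡ (coloured-mono {F} {G} F≼G a) (sum-≡⇒≗ (λ a → p⊆q⇒∣p∣≤∣q∣ (coloured-mono {F} {G} F≼G a)) (proj₂ parts) a)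
      colours-≡ : colours F ≡ colours G
      colours-≡ = tabulate-cong coloured-≡
      result : sign F ≡ sign G
      result with any? (λ a → nonempty? (coloured G a))
      ... | yes (a , j , j∈) = trans (cong (λ Us → pick (Us ++ signs F ∷ late F ∷ []) (critical F)) colours-≡)
              (pick-++ (Any.tabulate⁺ a (∈⇒0<∣∣ j∈ , s≤s (coloured-proper {G} disj a))))
      ... | no none = trans (cong (λ Us → pick Us (critical F)) stages-≡) (pick-default (stages G) critical-agree)
        where
        narrow : width G ≤ α
        narrow = ≮⇒≥ (λ lt → none (wide⇒coloured {G} trans-G lt))
        width-≡ : width F ≡ width G
        width-≡ = trans (sym (m≥n⇒m⊓n≡n (≤-trans (width-mono {F} {G} F≼G) narrow))) (trans (proj₁ parts) (m≥n⇒m⊓n≡n narrow))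
        split₁ : ∣ signs F ∣ + ∣ late F ∣ ≡ ∣ signs G ∣ + ∣ late G ∣ × ∣ middle F ∣ ≡ ∣ middle G ∣
        split₁ = +-≤-≡ (+-mono-≤ (p⊆q⇒∣p∣≤∣q∣ (signs-mono {F} {G} F≼G)) (p⊆q⇒∣p∣≤∣q∣ (late-mono {F} {G} F≼G)))
                       (p⊆q⇒∣p∣≤∣q∣ (middle-mono {F} {G} F≼G)) width-≡
        split₂ : ∣ signs F ∣ ≡ ∣ signs G ∣ × ∣ late F ∣ ≡ ∣ late G ∣
        split₂ = +-≤-≡ (p⊆q⇒∣p∣≤∣q∣ (signs-mono {F} {G} F≼G)) (p⊆q⇒∣p∣≤∣q∣ (late-mono {F} {G} F≼G)) (proj₁ split₁)
        signs-≡ : signs F ≡ signs G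
        signs-≡ = ⊆∧∣∣≡⇒≡ (signs-mono {F} {G} F≼G) (proj₁ split₂)
        late-≡ : late F ≡ late G
        late-≡ = ⊆∧∣∣≡⇒≡ (late-mono {F} {G} F≼G) (proj₂ split₂)
        middle-≡ : middle F ≡ middle G
        middle-≡ = ⊆∧∣∣≡⇒≡ (middle-mono {F} {G} F≼G) (proj₂ split₁)
        stages-≡ : stages F ≡ stages G
        stages-≡ = cong₂ _++_ colours-≡ (cong₂ (λ U V → U ∷ V ∷ []) signs-≡ late-≡)
        disj-F : Disjoint F
        disj-F x∈i x∈j = disj (F≼G _ x∈i) (F≼G _ x∈j)
        critical-agree : All (¬_ ∘ Proper) (stages G) → critical F ≡ critical G
        critical-agree all with ¬signs ∷ ¬late ∷ [] ← All.++⁻ʳ (colours G) all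
          with y , j , crit@(y∈ , reached , ¬passed) ← critical-exists {F} (full-signs {F} inhabited (subst (¬_ ∘ Proper) (sym signs-≡) ¬signs)) =
          trans (critical-≡ {F} disj-F crit) (sym (critical-≡ {G} disj (F≼G j y∈ , reached-mono {F} {G} F≼G reached , still-not-passed)))
          where
          -- If y were passed in G, then y would be a late element of sign j, so
          -- every sign is late, and then y would be a middle element of G but not of F.
          still-not-passed : ¬ Passed G y
          still-not-passed passed = ¬passed (proj₁ (proj₂ (comprehension⁻ (middle? F) (subst (y ∈_) (sym middle-≡)
            (comprehension⁺ (middle? G) ((j , F≼G j y∈) , passed , coming))))))
            where
            late-full : late F ≡ ⊤
            late-full = trans late-≡ (∣p∣≡n⇒p≡⊤ (≤-antisym (∣p∣≤n (late G))
              (≮⇒≥ (λ lt → ¬late (∈⇒0<∣∣ (comprehension⁺ (late? G) {j} (y , F≼G j y∈ , passed)) , lt)))))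
            coming : Coming G y
            coming i with z , z∈ , passed-z ← comprehension⁻ (late? F) (subst (i ∈_) (sym late-full) ∈⊤) =
              -- A late `z` of label `i` at or before `y` would make `y` passed in `F`.
              z , ≰⇒> (λ z≤y → ¬passed (λ i′ → let x , x<z , x∈ = passed-z i′ in x , <-≤-trans x<z z≤y , x∈)) , F≼G i z∈

    module _ {F G : Family} (shift : ∀ j → G (rot j) ≡ F j) where

      to : ∀ {i x} → x ∈ F i → x ∈ G (rot i)
      to {i} {x} = subst (x ∈_) (sym (shift i))

      from : ∀ {i x} → x ∈ G (rot i) → x ∈ F i
      from {i} {x} = subst (x ∈_) (shift i)

      along : ∀ {R : Fin n → Set} → (∀ i → ∃ λ x → R x × x ∈ F i) → ∀ i → ∃ λ x → R x × x ∈ G i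
      along h i with i′ , refl ← rot-surjective i with x , rx , x∈ ← h i′ = x , rx , to x∈

      against : ∀ {R : Fin n → Set} → (∀ i → ∃ λ x → R x × x ∈ G i) → ∀ i → ∃ λ x → R x × x ∈ F i
      against h i with x , rx , x∈ ← h (rot i) = x , rx , from x∈

      rotated : ∀ {P Q : Fin r → Set} (P? : ∀ j → Dec (P j)) (Q? : ∀ j → Dec (Q j)) →
                (∀ j → P j → Q (rot j)) → (∀ j → Q (rot j) → P j) → Rotated (comprehension P?) (comprehension Q?)
      rotated P? Q? f g j = trans (lookup-comprehension Q? (rot j)) (trans (agree (P? j) (Q? (rot j)) (f j) (g j)) (sym (lookup-comprehension P? j)))
        where
        agree : ∀ {A B : Set} (a? : Dec A) (b? : Dec B) → (A → B) → (B → A) → does b? ≡ does a?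
        agree (yes a) (yes b) _ _ = refl
        agree (no _)  (no _)  _ _ = refl
        agree (yes a) (no ¬b) f _ = contradiction (f a) ¬b
        agree (no ¬a) (yes b) _ g = contradiction (g b) ¬a

      signs-rot : Rotated (signs F) (signs G)
      signs-rot = rotated (λ j → nonempty? (F j)) (λ j → nonempty? (G j)) (λ _ (x , x∈) → x , to x∈) (λ _ (x , x∈) → x , from x∈)

      late-rot : Rotated (late F) (late G)
      late-rot = rotated (late? F) (late? G) (λ _ (y , y∈ , h) → y , to y∈ , along h) (λ _ (y , y∈ , h) → y , from y∈ , against h)

      coloured-rot : ∀ a → Rotated (coloured F a) (coloured G a)
      coloured-rot a = rotated (coloured? F a) (coloured? G a)
        (λ _ (σ , sub , rest) → σ , (λ x∈ → to (sub x∈)) , rest) (λ _ (σ , sub , rest) → σ , (λ x∈ → from (sub x∈)) , rest)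

      sign-rot : Inhabited F → Disjoint F → sign G ≡ rot (sign F)
      sign-rot inhabited disj = pick-rot
        (Pw.++⁺ (Pw.tabulate⁺ {f = coloured F} {g = coloured G} coloured-rot) (signs-rot ∷ late-rot ∷ [])) critical-rot
        where
        disj-G : Disjoint G
        disj-G {x} {i} {j} x∈i x∈j with i′ , refl ← rot-surjective i | j′ , refl ← rot-surjective j = cong rot (disj (from x∈i) (from x∈j))
        critical-rot : All (¬_ ∘ Proper) (stages F) → critical G ≡ rot (critical F)
        critical-rot all with ¬signs ∷ _ ← All.++⁻ʳ (colours F) all
          with y , j , crit@(y∈ , reached , ¬passed) ← critical-exists {F} (full-signs {F} inhabited ¬signs) =
          trans (critical-≡ {G} disj-G (to y∈ , along reached , λ h → ¬passed (against h))) (cong rot (sym (critical-≡ {F} disj crit)))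

-- The lower bound: columns, dummies, and the sign and value of a face.

module LowerBounds where

  open import Defs
  open Cochains using (_⋖_; here; there; headLabel)
  open Signatures using (rot)
  open Degrees
  open AlternatingFlags
  open Subsets
  open Families
  open import Data.Bool using (true; false)
  open import Data.Empty renaming (⊥ to Absurd)
  open import Data.Fin using (Fin; zero; suc; _≟_)
  open import Data.Fin.Properties using (any?)
  open import Data.Fin.Subset using (Subset; _∈_; _⊆_; ∣_∣; ⊤)
  open import Data.Fin.Subset.Properties using (⊆-antisym; ∣⊤∣≡n)
  open import Data.List using (List; []; _∷_; _++_; map; length; concat; replicate; filter; allFin; tabulate)
  open import Data.List.Membership.Propositional using () renaming (_∈_ to _∈ˡ_)
  open import Data.List.Membership.Propositional.Properties using (∈-map⁺; ∈-map⁻)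
  open import Data.List.Properties using (length-map; length-++; length-replicate)
  open import Data.List.Relation.Unary.All as All using (All; []; _∷_)
  import Data.List.Relation.Unary.All.Properties as All
  open import Data.List.Relation.Unary.AllPairs as AllPairs using (AllPairs; []; _∷_; allPairs?)
  import Data.List.Relation.Unary.AllPairs.Properties as AllPairs
  open import Data.List.Relation.Unary.Any as Any using (here; there)
  open import Data.List.Relation.Unary.Unique.Propositional using (Unique)
  open import Data.List.Relation.Unary.Unique.Propositional.Properties as Unique using (allFin⁺)
  open import Data.Maybe using (Maybe; just; nothing; maybe′)
  import Data.Maybe as Maybe
  import Data.Maybe.Properties as Maybe
  open import Data.Nat using (ℕ; zero; suc; _+_; _*_; _∸_; _≤_; _<_; z≤n; s≤s)
  open import Data.Nat.Properties hiding (_≟_)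
  open import Data.Nat.Primality using (Prime)
  open import Data.Product using (_×_; _,_; proj₁; proj₂)
  open import Data.Product.Properties using (≡-dec)
  open import Data.Sum using (_⊎_; inj₁; inj₂)
  open import Data.Unit using (tt) renaming (⊤ to Unit)
  import Data.Vec as Vec
  open import Function using (_∘_; id)
  open import Relation.Binary.PropositionalEquality
  open import Relation.Nullary using (Dec; does; yes; no; contradiction)
  open import Relation.Nullary.Decidable using (_×-dec_; _→-dec_; ¬?)
  open import Relation.Unary using (Decidable)
  open import Algebra.Properties.CommutativeMonoid.Sum +-0-commutativeMonoid using (sum; sum-cong-≗)

  length-filter-tabulate : ∀ {A : Set} {P : A → Set} (P? : Decidable P) {n} (f : Fin n → A) →
                           length (filter P? (tabulate f)) ≡ ∣ Vec.tabulate (λ i → does (P? (f i))) ∣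
  length-filter-tabulate P? {zero}  f = refl
  length-filter-tabulate P? {suc n} f with does (P? (f zero))
  ... | true  = cong suc (length-filter-tabulate P? (f ∘ suc))
  ... | false = length-filter-tabulate P? (f ∘ suc)

  AllPairs-⋖ : ∀ {A : Set} {R : A → A → Set} {ρ τ} → ρ ⋖ τ → AllPairs R τ → AllPairs R ρ
  AllPairs-⋖ here      (_ ∷ rs) = rs
  AllPairs-⋖ (there d) (r ∷ rs) = All-⋖ d r ∷ AllPairs-⋖ d rs
    where
    All-⋖ : ∀ {A : Set} {P : A → Set} {ρ τ} → ρ ⋖ τ → All P τ → All P ρ
    All-⋖ here      (_ ∷ ps) = ps
    All-⋖ (there d) (p ∷ ps) = p ∷ All-⋖ d ps

  AllPairs-∈ : ∀ {A : Set} {R : A → A → Set} {xs a b} → AllPairs R xs → a ∈ˡ xs → b ∈ˡ xs → a ≡ b ⊎ R a b ⊎ R b a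
  AllPairs-∈ (r ∷ rs) (here refl) (here refl) = inj₁ refl
  AllPairs-∈ (r ∷ rs) (here refl) (there b∈)  = inj₂ (inj₁ (All.lookup r b∈))
  AllPairs-∈ (r ∷ rs) (there a∈)  (here refl) = inj₂ (inj₂ (All.lookup r a∈))
  AllPairs-∈ (r ∷ rs) (there a∈)  (there b∈)  = AllPairs-∈ rs a∈ b∈

  ⋖-∈ : ∀ {A : Set} {ρ τ : List A} {a} → ρ ⋖ τ → a ∈ˡ ρ → a ∈ˡ τ
  ⋖-∈ here      a∈          = there a∈
  ⋖-∈ (there d) (here refl) = here refl
  ⋖-∈ (there d) (there a∈)  = there (⋖-∈ d a∈)

  module LowerBound (q n k₃ t m ℓ : ℕ) (isPrime : Prime (suc q)) (p : Fin n → Fin ℓ)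
                    (small : ∀ b → ∣ block p b ∣ ≤ q) (t-bound : t ≤ suc q * k₃ + 2)
                    (n-bound : suc q + suc q + suc q * k₃ + m * q < n)
                    (c : Subset n → Fin m) (isColouring : IsColouring n (3 + k₃) t p (suc q) m c) where

    -- A column is an element of [n] or, if it is nothing, a dummy.
    C : Set
    C = Maybe (Fin n)

    open Faces q C using (X; Z; rotX; labels; P)
    open NoLabelling q C using (Same; Cross; P-≢0⇒AllPairs; no-labelling)
    open Labelling q n k₃ t m ℓ isPrime p t-bound c isColouring

    members : Fin ℓ → List (Fin n)
    members b = filter (λ x → p x ≟ b) (allFin n)

    dummies : Fin ℓ → ℕ
    dummies b = q ∸ length (members b)

    column : Fin ℓ → List C
    column b = map just (members b) ++ replicate (dummies b) nothing

    blocks : List (List C)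
    blocks = map column (allFin ℓ)

    members-length : ∀ b → length (members b) ≡ ∣ block p b ∣
    members-length b = length-filter-tabulate (λ x → p x ≟ b) id

    column-length : ∀ b → length (column b) ≡ q
    column-length b = trans (length-++ (map just (members b))) (trans (cong₂ _+_ (length-map just (members b)) (length-replicate (dummies b)))
      (m+[n∸m]≡n (subst (_≤ q) (sym (members-length b)) (small b))))

    -- Injectivity is recorded only between elements of [n]: `family` does not see the dummies,
    -- which are merely counted.
    R : X → X → Set
    R (just x , i) (just y , j) = x ≢ y × (p x ≡ p y → i ≢ j)
    R (just _ , _) (nothing , _) = Unit
    R (nothing , _) _            = Unit

    R? : ∀ a b → Dec (R a b)
    R? (just x , i) (just y , j) = ¬? (x ≟ y) ×-dec ((p x ≟ p y) →-dec ¬? (i ≟ j))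
    R? (just _ , _) (nothing , _) = yes tt
    R? (nothing , _) _            = yes tt

    Valid : List X → Set
    Valid = AllPairs R

    column-same : ∀ b → AllPairs (Same R) (column b)
    column-same b = AllPairs.++⁺
      (AllPairs.map⁺ (AllPairs.map (λ x≢y i j i≢j → x≢y , λ _ → i≢j) (Unique.filter⁺ (λ x → p x ≟ b) (allFin⁺ n))))
      (padding (dummies b)) (All.map⁺ (All.universal (λ x → All.replicate⁺ (dummies b) (λ _ _ _ → tt)) (members b)))
      where
      padding : ∀ k → AllPairs (Same R) (replicate k nothing)
      padding zero    = []
      padding (suc k) = All.replicate⁺ k (λ _ _ _ → tt) ∷ padding k

    blocks-cross : AllPairs (λ b b′ → All (λ c → All (Cross R c) b′) b) blocks
    blocks-cross = AllPairs.map⁺ (AllPairs.map (λ {b} {b′} b≢b′ → All.map (λ {c} oc → All.map (λ {d} od → cross b≢b′ c d oc od) (of-block b′)) (of-block b)) (allFin⁺ ℓ))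
      where
      OfBlock : Fin ℓ → C → Set
      OfBlock b nothing  = Unit
      OfBlock b (just x) = p x ≡ b
      of-block : ∀ b → All (OfBlock b) (column b)
      of-block b = All.++⁺ (All.map⁺ (All.all-filter (λ x → p x ≟ b) (allFin n))) (All.replicate⁺ (dummies b) tt)
      cross : ∀ {b b′} → b ≢ b′ → ∀ c d → OfBlock b c → OfBlock b′ d → Cross R c d
      cross b≢b′ (just x) (just y) refl refl _ _ = (λ { refl → b≢b′ refl }) , λ eq → contradiction eq b≢b′
      cross b≢b′ (just _) nothing  _    _    _ _ = tt
      cross b≢b′ nothing  _        _    _    _ _ = tt

    occurs? : ∀ (τ : List X) (j : Fin r) (x : Fin n) → Dec ((just x , j) ∈ˡ τ)
    occurs? τ j x = Any.any? (≡-dec (Maybe.≡-dec _≟_) _≟_ (just x , j)) τ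

    family : List X → Family
    family τ j = comprehension (occurs? τ j)

    family-mono : ∀ {ρ τ} → ρ ⋖ τ → family ρ ≼ family τ
    family-mono {ρ} {τ} d j x∈ = comprehension⁺ (occurs? τ j) (⋖-∈ d (comprehension⁻ (occurs? ρ j) x∈))

    family-disjoint : ∀ {τ} → Valid τ → Disjoint (family τ)
    family-disjoint {τ} valid {x} {i} {j} x∈i x∈j
      with AllPairs-∈ valid (comprehension⁻ (occurs? τ i) x∈i) (comprehension⁻ (occurs? τ j) x∈j)
    ... | inj₁ refl              = refl
    ... | inj₂ (inj₁ (x≢x , _)) = contradiction refl x≢x
    ... | inj₂ (inj₂ (x≢x , _)) = contradiction refl x≢x

    family-transversal : ∀ {τ} → Valid τ → Transversal (family τ)
    family-transversal {τ} valid {x} {y} {j} x∈ y∈ eq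
      with AllPairs-∈ valid (comprehension⁻ (occurs? τ j) x∈) (comprehension⁻ (occurs? τ j) y∈)
    ... | inj₁ refl            = refl
    ... | inj₂ (inj₁ (_ , h)) = contradiction refl (h eq)
    ... | inj₂ (inj₂ (_ , h)) = contradiction refl (h (sym eq))

    family-rot : ∀ τ j → family (map rotX τ) (rot j) ≡ family τ j
    family-rot τ j = ⊆-antisym back forth
      where
      back : family (map rotX τ) (rot j) ⊆ family τ j
      back {x} x∈ with (c , i) , a∈ , eq ← ∈-map⁻ rotX (comprehension⁻ (occurs? (map rotX τ) (rot j)) x∈)
        with refl ← cong proj₁ eq | refl ← rot-injective (cong proj₂ eq) = comprehension⁺ (occurs? τ j) a∈
      forth : family τ j ⊆ family (map rotX τ) (rot j)
      forth x∈ = comprehension⁺ (occurs? (map rotX τ) (rot j)) (∈-map⁺ rotX (comprehension⁻ (occurs? τ j) x∈))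

    dummy-count : List X → ℕ
    dummy-count []                = 0
    dummy-count ((nothing , _) ∷ τ) = suc (dummy-count τ)
    dummy-count ((just _ , _) ∷ τ)  = dummy-count τ

    dummy-label : List X → Maybe Z
    dummy-label []                = nothing
    dummy-label ((nothing , i) ∷ τ) = just i
    dummy-label ((just _ , _) ∷ τ)  = dummy-label τ

    dummy-count-mono : ∀ {ρ τ} → ρ ⋖ τ → dummy-count ρ ≤ dummy-count τ × (dummy-count ρ ≡ dummy-count τ → dummy-label ρ ≡ dummy-label τ)
    dummy-count-mono {τ = (nothing , _) ∷ _} here      = n≤1+n _ , λ eq → contradiction eq (<⇒≢ (n<1+n _))
    dummy-count-mono {τ = (just _ , _) ∷ _}  here      = ≤-refl , λ _ → refl
    dummy-count-mono {τ = (nothing , _) ∷ _} (there d) = s≤s (proj₁ (dummy-count-mono d)) , λ _ → refl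
    dummy-count-mono {τ = (just _ , _) ∷ _}  (there d) = dummy-count-mono d

    inhabited : ∀ τ → 0 < length τ → dummy-label τ ≡ nothing → Inhabited (family τ)
    inhabited τ@((just x , j) ∷ _) _ _ = j , x , comprehension⁺ (occurs? τ j) (here refl)

    v : List X → ℕ
    v τ = dummy-count τ + value (family τ)

    -- A face made of dummies has no element from which to take a sign. The label of the first dummy
    -- serves instead, as it stays the same while the number of dummies does.
    s₁ : List X → Z
    s₁ τ = maybe′ id (sign (family τ)) (dummy-label τ)

    -- Invalid faces carry their first label, which makes s equivariant on all of List X.
    s : List X → Z
    s τ with allPairs? R? τ
    ... | yes _ = s₁ τ
    ... | no  _ = headLabel proj₂ zero τ

    s-valid : ∀ {τ} → Valid τ → s τ ≡ s₁ τ
    s-valid {τ} valid with allPairs? R? τ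
    ... | yes _      = refl
    ... | no ¬valid = contradiction valid ¬valid

    R-rot⁺ : ∀ {a b} → R a b → R (rotX a) (rotX b)
    R-rot⁺ {just _ , _}  {just _ , _}  (x≢y , h) = x≢y , λ eq eq′ → h eq (rot-injective eq′)
    R-rot⁺ {just _ , _}  {nothing , _} _         = tt
    R-rot⁺ {nothing , _} {_}           _         = tt

    R-rot⁻ : ∀ {a b} → R (rotX a) (rotX b) → R a b
    R-rot⁻ {just _ , _}  {just _ , _}  (x≢y , h) = x≢y , λ eq eq′ → h eq (cong rot eq′)
    R-rot⁻ {just _ , _}  {nothing , _} _         = tt
    R-rot⁻ {nothing , _} {_}           _         = tt

    s₁-rot : ∀ τ → Valid τ → 0 < length τ → s₁ (map rotX τ) ≡ rot (s₁ τ)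
    s₁-rot τ valid ne = trans (cong (maybe′ id (sign (family (map rotX τ)))) (label-rot τ)) (go (dummy-label τ) refl)
      where
      label-rot : ∀ τ → dummy-label (map rotX τ) ≡ Maybe.map rot (dummy-label τ)
      label-rot []                  = refl
      label-rot ((nothing , _) ∷ τ) = refl
      label-rot ((just _ , _) ∷ τ)  = label-rot τ
      go : ∀ l → dummy-label τ ≡ l → maybe′ id (sign (family (map rotX τ))) (Maybe.map rot l) ≡ rot (maybe′ id (sign (family τ)) l)
      go (just i) _  = refl
      go nothing  eq = sign-rot {family τ} {family (map rotX τ)} (family-rot τ) (inhabited τ ne eq) (family-disjoint {τ} valid)

    s-rot : ∀ τ → 0 < length τ → s (map rotX τ) ≡ rot (s τ)
    s-rot τ@(_ ∷ _) ne with allPairs? R? (map rotX τ) | allPairs? R? τ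
    ... | yes _  | yes valid = s₁-rot τ valid ne
    ... | no _   | no _      = refl
    ... | yes v′ | no ¬v     = contradiction (AllPairs.map (λ {a} {b} → R-rot⁻ {a} {b}) (AllPairs.map⁻ v′)) ¬v
    ... | no ¬v′ | yes v     = contradiction (AllPairs.map⁺ (AllPairs.map (λ {a} {b} → R-rot⁺ {a} {b}) v)) ¬v′

    v-mono : ∀ {ρ τ} → ρ ⋖ τ → Valid τ → 0 < length ρ → v ρ ≤ v τ × (v ρ ≡ v τ → s ρ ≡ s τ)
    v-mono {ρ} {τ} d valid ne = +-mono-≤ (proj₁ (dummy-count-mono d)) vm , λ eq →
      let deq , veq = +-≤-≡ (proj₁ (dummy-count-mono d)) vm eq in
      trans (s-valid (AllPairs-⋖ d valid)) (trans (agree deq veq) (sym (s-valid valid)))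
      where
      vm : value (family ρ) ≤ value (family τ)
      vm = value-mono {family ρ} {family τ} (family-mono d)
      agree : dummy-count ρ ≡ dummy-count τ → value (family ρ) ≡ value (family τ) → s₁ ρ ≡ s₁ τ
      agree deq veq = trans (go (dummy-label ρ) refl) (cong (maybe′ id (sign (family τ))) (proj₂ (dummy-count-mono d) deq))
        where
        go : ∀ l → dummy-label ρ ≡ l → maybe′ id (sign (family ρ)) l ≡ maybe′ id (sign (family τ)) l
        go (just i) _  = refl
        go nothing  eq = sign-constant {family ρ} {family τ} (family-mono d) (inhabited ρ ne eq) (family-disjoint {τ} valid) (family-transversal {τ} valid) veq

    v-pos : ∀ τ → Valid τ → 0 < length τ → 0 < v τ
    v-pos ((nothing , _) ∷ τ)   _ _  = s≤s z≤n
    v-pos τ@((just x , j) ∷ _) _ _ = ≤-trans (value-pos {family τ} (j , x , comprehension⁺ (occurs? τ j) (here refl))) (m≤n+m _ (dummy-count τ))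

    just-count : List C → ℕ
    just-count []             = 0
    just-count (nothing ∷ cs) = just-count cs
    just-count (just _ ∷ cs)  = suc (just-count cs)

    just-count-++ : ∀ cs ds → just-count (cs ++ ds) ≡ just-count cs + just-count ds
    just-count-++ []             ds = refl
    just-count-++ (nothing ∷ cs) ds = just-count-++ cs ds
    just-count-++ (just _ ∷ cs)  ds = cong suc (just-count-++ cs ds)

    n≤just-count : n ≤ just-count (concat blocks)
    n≤just-count = begin
      n                                              ≡⟨ ∣⊤∣≡n n ⟨
      ∣ ⊤ {n} ∣                                      ≤⟨ union-bound ⊤ (block p) (λ {x} _ → p x , in-block x) ⟩
      sum (λ b → ∣ block p b ∣)                      ≡⟨ sum-cong-≗ (λ b → sym (trans (just-count-column b) (members-length b))) ⟩
      sum (λ b → just-count (column b))              ≡⟨ total id ⟨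
      just-count (concat blocks)                     ∎
      where
      open ≤-Reasoning
      in-block : ∀ x → x ∈ block p (p x)
      in-block x = tabulate-does⁺ (λ y → p y ≟ p x) refl
      just-count-column : ∀ b → just-count (column b) ≡ length (members b)
      just-count-column b = trans (just-count-++ (map just (members b)) _) (trans (cong₂ _+_ (all-just (members b)) (no-just (dummies b))) (+-identityʳ _))
        where
        all-just : ∀ xs → just-count (map just xs) ≡ length xs
        all-just []       = refl
        all-just (x ∷ xs) = cong suc (all-just xs)
        no-just : ∀ k → just-count (replicate k nothing) ≡ 0
        no-just zero    = refl
        no-just (suc k) = no-just k
      total : ∀ {m} (f : Fin m → Fin ℓ) → just-count (concat (map column (tabulate f))) ≡ sum (λ i → just-count (column (f i)))
      total {zero}  f = refl
      total {suc m} f = trans (just-count-++ (column (f zero)) _) (cong (just-count (column (f zero)) +_) (total (f ∘ suc)))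

    v-bound : ∀ τ → map proj₁ τ ≡ concat blocks → Valid ((nothing , zero) ∷ τ) → v ((nothing , zero) ∷ τ) ≤ length (concat blocks)
    v-bound τ eq valid = begin
      suc (dummy-count τ) + value (family ρ)         ≤⟨ +-monoʳ-≤ (suc (dummy-count τ)) (value-bound {family ρ} (family-disjoint {ρ} valid)) ⟩
      suc (dummy-count τ) + (α + m * q)              ≡⟨ +-suc (dummy-count τ) (α + m * q) ⟨
      -- The strictness of `n-bound` pays for the apex, which counts as a dummy but is not among the
      -- columns of the blocks.
      dummy-count τ + suc (α + m * q)                ≤⟨ +-monoʳ-≤ (dummy-count τ) (≤-trans n-bound n≤just-count) ⟩
      dummy-count τ + just-count (concat blocks)     ≡⟨ cong (λ cs → dummy-count τ + just-count cs) eq ⟨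
      dummy-count τ + just-count (map proj₁ τ)       ≡⟨ count τ ⟩
      length (map proj₁ τ)                           ≡⟨ cong length eq ⟩
      length (concat blocks)                         ∎
      where
      open ≤-Reasoning
      ρ : List X
      ρ = (nothing , zero) ∷ τ
      count : ∀ τ → dummy-count τ + just-count (map proj₁ τ) ≡ length (map proj₁ τ)
      count []                  = refl
      count ((nothing , _) ∷ τ) = cong suc (count τ)
      count ((just _ , _) ∷ τ)  = trans (+-suc (dummy-count τ) _) (cong suc (count τ))

    lens : All (λ b → length b ≡ q) blocks
    lens = All.map⁺ (All.universal column-length (allFin ℓ))

    just-count≤length : ∀ cs → just-count cs ≤ length cs
    just-count≤length []             = z≤n
    just-count≤length (nothing ∷ cs) = m≤n⇒m≤1+n (just-count≤length cs)
    just-count≤length (just _ ∷ cs)  = s≤s (just-count≤length cs)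

    contradictory : Absurd
    contradictory = no-labelling isPrime blocks lens
      (≤-trans (≤-trans (s≤s z≤n) n-bound) (≤-trans n≤just-count (just-count≤length (concat blocks))))
      nothing s s-rot Valid AllPairs-⋖
      (λ τ eq ne → All.universal (λ _ → tt) τ ∷ P-≢0⇒AllPairs R blocks lens (All.map⁺ (All.universal column-same (allFin ℓ))) blocks-cross τ eq ne)
      v v-pos v-mono v-bound

-- The upper bound and the chromatic number.

open import Defs
open Subsets
open Families
open LowerBounds
open import Data.Fin using (Fin; zero; suc; toℕ; fromℕ<)
open import Data.Fin.Properties using (pigeonhole; toℕ<n; toℕ-injective; toℕ-fromℕ<)
import Data.Fin as Fin
import Data.Fin.Properties as Fin
open import Data.Fin.Subset using (Subset; _∈_; _⊆_; ∣_∣; ⊥; _∩_)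
open import Data.Fin.Subset.Properties using (nonempty?; x∈p∩q⁺; ∉⊥)
open import Data.Nat using (ℕ; zero; suc; _+_; _*_; _∸_; _⊓_; >-nonZero; _≤_; _<_; z≤n; s≤s; _≤?_)
open import Data.Nat.DivMod
open import Data.Nat.Primality using (Prime)
open import Data.Nat.Properties hiding (_≤?_)
open import Data.Nat.Tactic.RingSolver using (solve-∀)
open import Data.Product using (_×_; _,_; proj₁; proj₂; ∃)
open import Data.Sum using (inj₁; inj₂)
open import Relation.Binary.PropositionalEquality
open import Relation.Nullary using (yes; no; ¬_; contradiction)
open import Algebra.Properties.CommutativeMonoid.Sum +-0-commutativeMonoid using (sum)

hyperedge-disjoint : ∀ {n m} {e : Fin m → Subset n} → (∀ i j → i ≢ j → e i ∩ e j ≡ ⊥) →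
                     ∀ {x i j} → x ∈ e i → x ∈ e j → i ≡ j
hyperedge-disjoint disjoint {x} {i} {j} x∈i x∈j with i Fin.≟ j
... | yes eq  = eq
... | no  i≢j = contradiction (subst (x ∈_) (disjoint i j i≢j) (x∈p∩q⁺ (x∈i , x∈j))) ∉⊥

module UpperBound (n k t ℓ q M : ℕ) (p : Fin n → Fin ℓ) (0<k : 0 < k) (bound : n < suc (suc q) * k + M * suc q) where

  minColour : Subset n → ℕ
  minColour σ with nonempty? σ
  ... | yes ne = toℕ (proj₁ (least σ ne)) / suc q
  ... | no  _  = 0

  colour : Subset n → Fin (suc M)
  colour σ = fromℕ< (s≤s (m⊓n≤n (minColour σ) M))

  minColour-least : ∀ {σ} → 0 < ∣ σ ∣ → ∃ λ x → x ∈ σ × (∀ {y} → y ∈ σ → toℕ x ≤ toℕ y) × minColour σ ≡ toℕ x / suc q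
  minColour-least {σ} lt with nonempty? σ
  ... | yes ne    = let x , x∈ , min = least σ ne in x , x∈ , min , refl
  ... | no  empty = contradiction (0<∣∣⇒nonempty σ lt) empty

  -- In the last colour all r sets lie beyond the first M(r - 1) elements, where fewer than r k are
  -- left. In any other colour the r minima lie in an interval of r - 1 elements, so two of them
  -- coincide.
  isColouring : IsColouring n k t p (suc (suc q)) (suc M) colour
  isColouring e (vertices , disjoint) (a , mono) with M ≤? toℕ a
  ... | yes M≤a = contradiction (≤-trans total (≤-trans (disjoint-bound late e e⊆late (hyperedge-disjoint disjoint)) late-small)) (<⇒≱ few)
    where
    open ≤-Reasoning
    late : Subset n
    late = comprehension (λ x → M * suc q ≤? toℕ x)
    e⊆late : ∀ j → e j ⊆ late
    e⊆late j {y} y∈ with x , x∈ , min , eq ← minColour-least {e j} (subst (0 <_) (sym (proj₁ (vertices j))) 0<k) =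
      comprehension⁺ (λ x → M * suc q ≤? toℕ x) (begin
        M * suc q                   ≤⟨ *-monoˡ-≤ (suc q) M≤ ⟩
        toℕ x / suc q * suc q       ≤⟨ m/n*n≤m (toℕ x) (suc q) ⟩
        toℕ x                       ≤⟨ min y∈ ⟩
        toℕ y                       ∎)
      where
      M≤ : M ≤ toℕ x / suc q
      M≤ = begin
        M                           ≤⟨ M≤a ⟩
        toℕ a                       ≡⟨ cong toℕ (mono j) ⟨
        toℕ (colour (e j))          ≡⟨ toℕ-fromℕ< _ ⟩
        minColour (e j) ⊓ M         ≤⟨ m⊓n≤m (minColour (e j)) M ⟩
        minColour (e j)             ≡⟨ eq ⟩
        toℕ x / suc q               ∎
    total : suc (suc q) * k ≤ sum (λ j → ∣ e j ∣)
    total = sum-ge-* (λ j → ∣ e j ∣) k (λ j → ≤-reflexive (sym (proj₁ (vertices j))))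
    late-small : ∣ late ∣ ≤ n ∸ M * suc q
    late-small = interval-card late (M * suc q) (n ∸ M * suc q) (λ {x} x∈ →
      comprehension⁻ (λ x → M * suc q ≤? toℕ x) x∈ , <-≤-trans (toℕ<n x) (m≤n+m∸n n (M * suc q)))
    few : n ∸ M * suc q < suc (suc q) * k
    few = m<n+o⇒m∸n<o n (M * suc q) {{>-nonZero (≤-trans 0<k (m≤m+n k _))}} (subst (n <_) (+-comm (suc (suc q) * k) (M * suc q)) bound)
  ... | no M≰a = clash (pigeonhole (n<1+n (suc q)) residue)
    where
    open ≡-Reasoning
    minimum : ∀ j → ∃ λ x → x ∈ e j × (∀ {y} → y ∈ e j → toℕ x ≤ toℕ y) × minColour (e j) ≡ toℕ x / suc q
    minimum j = minColour-least {e j} (subst (0 <_) (sym (proj₁ (vertices j))) 0<k)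
    x : Fin (suc (suc q)) → Fin n
    x j = proj₁ (minimum j)
    residue : Fin (suc (suc q)) → Fin (suc q)
    residue j = fromℕ< (m%n<n (toℕ (x j)) (suc q))
    quotient : ∀ j → toℕ (x j) / suc q ≡ toℕ a
    quotient j with eq ← trans (sym (toℕ-fromℕ< _)) (cong toℕ (mono j)) with ⊓-sel (minColour (e j)) M
    ... | inj₁ min≡ = trans (sym (proj₂ (proj₂ (proj₂ (minimum j))))) (trans (sym min≡) eq)
    ... | inj₂ min≡ = contradiction (≤-reflexive (trans (sym min≡) eq)) M≰a
    clash : (∃ λ i → ∃ λ j → i Fin.< j × residue i ≡ residue j) → _
    clash (i , j , i<j , eq) = <-irrefl (cong toℕ i≡j) i<j
      where
      x-≡ : x i ≡ x j
      x-≡ = toℕ-injective (begin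
        toℕ (x i)                                               ≡⟨ m≡m%n+[m/n]*n (toℕ (x i)) (suc q) ⟩
        toℕ (x i) % suc q + toℕ (x i) / suc q * suc q           ≡⟨ cong₂ (λ u v → u + v * suc q) (trans (sym (toℕ-fromℕ< _)) (trans (cong toℕ eq) (toℕ-fromℕ< _)))
                                                                     (trans (quotient i) (sym (quotient j))) ⟩
        toℕ (x j) % suc q + toℕ (x j) / suc q * suc q           ≡⟨ m≡m%n+[m/n]*n (toℕ (x j)) (suc q) ⟨
        toℕ (x j)                                               ∎)
      i≡j : i ≡ j
      i≡j = hyperedge-disjoint disjoint (proj₁ (proj₂ (minimum i))) (subst (_∈ e j) (sym x-≡) (proj₁ (proj₂ (minimum j))))

theorem5p1 : (k r n t ℓ : ℕ) → 1 ≤ k → 2 ≤ r → Prime r → r * k ≤ n →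
    (p : Fin n → Fin ℓ) →
    (∀ (b : Fin ℓ) → ∣ block p b ∣ ≤ r ∸ 1) →
    1 ≤ t → t + 3 * r ≤ r * k + 2 →
    ChromaticNumberIs n k t p r ⌈ n ∸ r * (k ∸ 1) / r ∸ 1 ⌉
theorem5p1 k r@(suc (suc q)) n t ℓ 1≤k 2≤r isPrime rk≤n p small 1≤t t-bound = colourable , optimal
  where
  open ≤-Reasoning
  a M : ℕ
  a = n ∸ r * (k ∸ 1)
  M = (a + q) / suc q
  0<a : 0 < a
  0<a = m<n⇒0<n∸m (<-≤-trans (*-monoʳ-< r (∸-monoʳ-< {k} {1} {0} (s≤s z≤n) 1≤k)) rk≤n)
  0<M : 0 < M
  0<M = m≥n⇒m/n>0 (+-monoˡ-≤ q 0<a)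
  a≤M*q : a ≤ M * suc q
  a≤M*q = +-cancelʳ-≤ q a (M * suc q) (begin
    a + q                             ≡⟨ m≡m%n+[m/n]*n (a + q) (suc q) ⟩
    (a + q) % suc q + M * suc q       ≤⟨ +-monoˡ-≤ (M * suc q) (≤-pred (m%n<n (a + q) (suc q))) ⟩
    q + M * suc q                     ≡⟨ +-comm q (M * suc q) ⟩
    M * suc q + q                     ∎)
  colourable : Colourable n k t p r M
  colourable with M | 0<M | a≤M*q
  ... | suc M′ | _ | a≤ = UpperBound.colour n k t ℓ q M′ p 1≤k bound , UpperBound.isColouring n k t ℓ q M′ p 1≤k bound
    where
    bound : n < r * k + M′ * suc q
    bound = begin-strict
      n                                           ≤⟨ m≤n+m∸n n (r * (k ∸ 1)) ⟩
      r * (k ∸ 1) + a                             ≤⟨ +-monoʳ-≤ (r * (k ∸ 1)) a≤ ⟩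
      r * (k ∸ 1) + (suc q + M′ * suc q)          ≡⟨ +-assoc (r * (k ∸ 1)) (suc q) (M′ * suc q) ⟨
      r * (k ∸ 1) + suc q + M′ * suc q            <⟨ +-monoˡ-< (M′ * suc q) (+-monoʳ-< (r * (k ∸ 1)) (n<1+n (suc q))) ⟩
      r * (k ∸ 1) + r + M′ * suc q                ≡⟨ cong (_+ M′ * suc q) (trans (+-comm (r * (k ∸ 1)) r) (trans (sym (*-suc r (k ∸ 1))) (cong (r *_) (m+[n∸m]≡n 1≤k)))) ⟩
      r * k + M′ * suc q                          ∎
  -- The bounds on `t` force k ≥ 3: for k ≤ 2 the right side r k + 2 is at most 3r, since 2 ≤ r,
  -- while the left side exceeds 3r.
  3≤k : 3 ≤ k
  3≤k = ≮⇒≥ (λ k<3 → <⇒≱ (begin-strict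
    r * k + 2       ≤⟨ +-mono-≤ (*-monoʳ-≤ r (≤-pred k<3)) 2≤r ⟩
    r * 2 + r       ≡⟨ three r ⟩
    3 * r           <⟨ +-monoˡ-≤ (3 * r) 1≤t ⟩
    t + 3 * r       ∎) t-bound)
    where
    three : ∀ r → r * 2 + r ≡ 3 * r
    three = solve-∀
  optimal : ∀ m → m < M → ¬ Colourable n k t p r m
  optimal m m<M (c , isColouring) = go k 3≤k refl
    where
    -- From m + 1 ≤ M follows (m + 1)(r - 1) ≤ a + (r - 2), where r - 2 is the rounding term of the
    -- ceiling.
    m*q<a : m * suc q < a
    m*q<a = +-cancelʳ-< q (m * suc q) a (begin-strict
      m * suc q + q     <⟨ +-monoʳ-< (m * suc q) (n<1+n q) ⟩
      m * suc q + suc q ≡⟨ +-comm (m * suc q) (suc q) ⟩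
      suc m * suc q     ≤⟨ *-monoˡ-≤ (suc q) m<M ⟩
      M * suc q         ≤⟨ m/n*n≤m (a + q) (suc q) ⟩
      a + q             ∎)
    r[k-1]+mq<n : r * (k ∸ 1) + m * suc q < n
    r[k-1]+mq<n = subst (_< n) (+-comm (m * suc q) (r * (k ∸ 1)))
      (m≤o∸n⇒m+n≤o (suc (m * suc q)) (≤-trans (*-monoʳ-≤ r (m∸n≤m k 1)) rk≤n) m*q<a)
    go : ∀ k′ → 3 ≤ k′ → k ≡ k′ → _
    -- The parameter `q` of `LowerBound` is r - 1, which is `suc q` here.
    go (suc (suc (suc k₃))) (s≤s (s≤s (s≤s _))) refl = LowerBound.contradictory (suc q) n k₃ t m ℓ isPrime p small
      (+-cancelʳ-≤ (3 * r) t (r * k₃ + 2) (≤-trans t-bound (≤-reflexive (expand r k₃))))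
      (subst (λ z → z + m * suc q < n) (expand′ r k₃) r[k-1]+mq<n) c isColouring
      where
      expand : ∀ r k → r * (3 + k) + 2 ≡ r * k + 2 + 3 * r
      expand = solve-∀
      expand′ : ∀ r k → r * (2 + k) ≡ r + r + r * k
      expand′ = solve-∀
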